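{- Let $\mathcal{D}=\{\alpha_1,\ldots,\alpha_m\}$ be a dissection of a convex $n$-gon $P_n$ of type $\{d_1,\ldots,d_m\}$, with associated indeterminates $x_1,\ldots,x_m$, respectively, and indeterminate weights $q_1,\ldots,q_n$ on the boundary edges $e_1,\ldots,e_n$. Set $\varepsilon=\prod_{k=1}^n q_k$ and $c=\prod_{l=1}^m x_l^{d_l-2}$. Then the following holds for the $2\times2$-minors $d(e,f)$ of the weight matrix $W_{\mathcal{D}}(x;q)$ associated to boundary edges of $P_n$. (a) For every boundary edge $e$ of $P_n$, $d(e,e)=-\varepsilon c$. (b) For boundary edges $e=(i,i+1)\ne f=(j,j+1)$ of $P_n$: $d(e,f)\ne 0$ if and only if there exists a zig-zag sequence from $e$ to $f$, i.e. a sequence $$e=z_0,z_1,\ldots,z_{s-1},z_s=f$$ with $s\in\mathbb{N}_0$, where $z_1,\ldots,z_{s-1}$ are diagonals of the dissection, and pieces $p_0,\ldots,p_{s-1}\in\mathcal{D}$, such that for every $k\in\{0,1,\ldots,s-1\}$: (i) $z_k$ and $z_{k+1}$ belong to the common piece $p_k$; (ii) the pieces $p_0,\ldots,p_{s-1}$ are pairwise different; (iii) $z_k$ is incident to $z_{k+1}$. (c) For boundary edges $e=(i,i+1)\ne f=(j,j+1)$ of $P_n$: if there exists a zig-zag sequence from $e$ to $f$, then $$d(e,f)=q_iq_j\prod_{k=i+1}^{j-1}q_k^2\prod_{\beta}x_\beta^{2(d_\beta-2)},$$ where $k$ runs over the indices $i+1,i+2,\ldots,j-1$ (modulo $n$)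 met counterclockwise strictly between $i$ and $j$ (no index if $j=i+1$), and $\beta$ runs over all zig pieces for $(e,f)$, i.e. those pieces of $\mathcal{D}$ which have at most one vertex on the counterclockwise route from $j+1$ to $i$ around $P_n$.
   Context: $P_n$ is a convex $n$-gon ($n\ge3$) with vertices labelled $1,2,\ldots,n$ in counterclockwise order, labels being taken modulo $n$. A dissection $\mathcal{D}$ of $P_n$ is obtained by drawing $m-1$ ($m\ge 1$) pairwise noncrossing diagonals, which cut $P_n$ into $m$ polygons $\alpha_1,\ldots,\alpha_m$, called the pieces of the dissection; one writes $\mathcal{D}=\{\alpha_1,\ldots,\alpha_m\}$. If $\alpha_l$ has $d_l$ vertices, it is called a piece of degree $d_l$; the multiset $\{d_1,\ldots,d_m\}$ is the type of $\mathcal{D}$. For a piece $\beta$, its degree is also written $d_\beta$ and its indeterminate $x_\beta$. For vertices $i,j$, a (counterclockwise) walk from $i$ to $j$ around $P_n$ is a sequence $w=(p_{i+1},p_{i+2},\ldots,p_{j-1})$ of pieces of $\mathcal{D}$, indexed by the vertices strictly between $i$ and $j$ when going counterclockwise from $i$ to $j$ (labels modulo $n$), such that: (i) $p_k$ is incident to vertex $k$ (i.e. $k$ is a vertex of $p_k$) for all $k\in\{i+1,\ldots,j-1\}$; (ii) each piece $\alpha\in\mathcal{D}$ of degree $d$ appears at most $d-2$ times among $p_{i+1},\ldots,p_{j-1}$. By convention, for $i=j$ there is no walk from $i$ to $i$; for $j=i+1$ (modulo $n$) the empty sequence is the unique walk from $i$ to $i+1$. To each piece $\alpha_l$ an indeterminate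 $x_l=x(\alpha_l)$ is associated, and to each boundary edge $e_i=(i,i+1)$ of $P_n$ (indices modulo $n$) an indeterminate $q_i$. The weight of a walk $w=(p_{i+1},\ldots,p_{j-1})$ from $i$ to $j$ is the monomial $x^wq^w$ with $x^w=\prod_{k=i+1}^{j-1}x(p_k)$ and $q^w=\prod_{s=i}^{j-1}q_s$ (products taken counterclockwise from $i$ to $j$, indices modulo $n$; so $q^w$ is the product of the weights of the edges traversed). The weight matrix $W_{\mathcal{D}}(x;q)=(v_{i,j})_{1\le i,j\le n}$ has entries $v_{i,j}=\sum_w x^wq^w$, the sum over all walks $w$ from $i$ to $j$ (so $v_{i,i}=0$, $v_{i,i+1}=q_i$). For boundary edges $e=e_i=(i,i+1)$ and $f=e_j=(j,j+1)$ (indices modulo $n$), the associated $2\times 2$-minor is $$d(e,f)=\det\begin{pmatrix}v_{i,j}&v_{i,j+1}\\ v_{i+1,j}&v_{i+1,j+1}\end{pmatrix}.$$ Two edges/diagonals are incident if they share an endpoint; an edge or diagonal belongs to a piece if it is one of the sides of that piece. The counterclockwise route from $j+1$ to $i$ consists of the vertices $j+1,j+2,\ldots,i$ (modulo $n$), both endpoints included (a single vertex if $i=j+1$). -}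

module Defs where

open import Data.Nat using (ℕ; zero; suc; _+_; _∸_; _%_; _<_; _≤_; _<?_; _≤?_; NonZero)
import Data.Nat.Properties as ℕₚ
open import Data.Nat.DivMod using (_mod_)
open import Data.Integer as ℤ using (ℤ; 0ℤ; 1ℤ)
open import Data.Fin using (Fin; zero; suc; toℕ; fromℕ; inject₁; _↑ˡ_; _↑ʳ_)
open import Data.Fin.Properties using (_≟_; all?)
open import Data.Fin.Subset using (Subset; _∈_; ∣_∣)
open import Data.Fin.Subset.Properties using (_∈?_)
open import Data.Vec as Vec using (Vec; []; _∷_)
import Data.Vec.Properties as Vecₚ
open import Data.List as List
  using (List; []; _∷_; _++_; map; foldr; filter; length; upTo; allFin; cartesianProductWith)
import Data.List.Membership.Propositional as L
open import Data.List.Relation.Unary.All using (All)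
open import Data.List.Relation.Unary.AllPairs using (AllPairs)
open import Data.List.Relation.Unary.Unique.Propositional using (Unique)
open import Data.Product using (_×_; _,_; ∃)
open import Data.Sum using (_⊎_)
open import Data.Bool using (if_then_else_)
open import Function.Definitions using (Injective)
open import Relation.Nullary using (¬_; Dec; does)
open import Relation.Nullary.Decidable using (_×-dec_; ¬?)
open import Relation.Binary.PropositionalEquality using (_≡_; _≢_)

------------------------------------------------------------------------
-- The polynomial ring ℤ[X₀,…,X₍ₖ₋₁₎].
--
-- A polynomial is a finite formal sum of terms a·X^μ, with μ an exponent
-- vector; a monomial may occur in several terms.  Equality of polynomials
-- is therefore _≈_ (equal coefficients), not _≡_.

Poly : ℕ → Set
Poly k = List (ℤ × Vec ℕ k)

module _ {k : ℕ} where

  infix  4 _≈_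
  infixl 6 _⊞_ _⊟_
  infixl 7 _⊠_
  infixr 8 _^ᴾ_
  infix  8 -ᴾ_

  coeff : Poly k → Vec ℕ k → ℤ
  coeff []            μ = 0ℤ
  coeff ((a , ν) ∷ p) μ =
    (if does (Vecₚ.≡-dec ℕₚ._≟_ ν μ) then a else 0ℤ) ℤ.+ coeff p μ

  _≈_ : Poly k → Poly k → Set
  p ≈ r = ∀ μ → coeff p μ ≡ coeff r μ

  0ᴾ 1ᴾ : Poly k
  0ᴾ = []
  1ᴾ = (1ℤ , Vec.replicate k 0) ∷ []

  var : Fin k → Poly k
  var i = (1ℤ , Vec.tabulate (λ j → if does (i ≟ j) then 1 else 0)) ∷ []

  _⊞_ _⊟_ _⊠_ : Poly k → Poly k → Poly k
  -ᴾ_ : Poly k → Poly k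

  p ⊞ r = p ++ r
  -ᴾ p  = map (λ (a , μ) → ℤ.- a , μ) p
  p ⊟ r = p ⊞ (-ᴾ r)
  p ⊠ r = cartesianProductWith (λ (a , μ) (b , ν) → a ℤ.* b , Vec.zipWith _+_ μ ν) p r

  _^ᴾ_ : Poly k → ℕ → Poly k
  p ^ᴾ zero  = 1ᴾ
  p ^ᴾ suc e = p ⊠ p ^ᴾ e

  ∑ ∏ : List (Poly k) → Poly k
  ∑ = foldr _⊞_ 0ᴾ
  ∏ = foldr _⊠_ 1ᴾ

  det₂ : (a b c d : Poly k) → Poly k
  det₂ a b c d = a ⊠ d ⊟ b ⊠ c

------------------------------------------------------------------------
-- The convex n-gon: its vertices are Fin n, counterclockwise, with the
-- label n represented by 0.

module _ {n : ℕ} .{{_ : NonZero n}} where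

  infixl 6 _⊕_

  _⊕_ : Fin n → ℕ → Fin n
  i ⊕ k = (toℕ i + k) mod n

  -- The number of counterclockwise steps from i to j, between 0 and n ∸ 1.
  dist : Fin n → Fin n → ℕ
  dist i j = (toℕ j + (n ∸ toℕ i)) % n

  -- k lies strictly between i and j on the way counterclockwise from i to j.
  Between : Fin n → Fin n → Fin n → Set
  Between i j k = 0 < dist i k × dist i k < dist i j

  -- The vertices i , i ⊕ 1 , … , j.
  route : Fin n → Fin n → List (Fin n)
  route i j = map (i ⊕_) (upTo (suc (dist i j)))

-- A segment given by its two endpoints.  The notions below that apply to
-- arbitrary segments do not depend on the order of the endpoints.
Segment : ℕ → Set
Segment n = Fin n × Fin n

Incident : ∀ {n} → Segment n → Segment n → Set
Incident (a , b) (c , d) = (a ≡ c ⊎ a ≡ d) ⊎ (b ≡ c ⊎ b ≡ d)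

module _ {n : ℕ} .{{_ : NonZero n}} where

  edge : Fin n → Segment n
  edge i = i , i ⊕ 1

  -- Diagonals are stored with the smaller endpoint first, so that distinct
  -- pairs are distinct diagonals.
  IsDiagonal : Segment n → Set
  IsDiagonal (a , b) = toℕ a < toℕ b × b ≢ a ⊕ 1 × a ≢ b ⊕ 1

  Crossing : Segment n → Segment n → Set
  Crossing (a , b) (c , d) =
      (toℕ a < toℕ c × toℕ c < toℕ b × toℕ b < toℕ d)
    ⊎ (toℕ c < toℕ a × toℕ a < toℕ d × toℕ d < toℕ b)

  -- A convex polygon with vertices among those of the n-gon is given by its
  -- vertex set; its sides join cyclically consecutive vertices.

  Consecutive : Subset n → Fin n → Fin n → Set
  Consecutive S a b =
    a ∈ S × b ∈ S × a ≢ b × (∀ k → k ∈ S → ¬ Between a b k)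

  SideOf : Subset n → Segment n → Set
  SideOf S (a , b) = Consecutive S a b ⊎ Consecutive S b a

  -- The regions cut out by a set of noncrossing diagonals: polygons bounded
  -- by boundary edges and drawn diagonals, with no drawn diagonal running
  -- through the interior.  A drawn diagonal meeting the interior of S
  -- without crossing a side of S joins two nonconsecutive vertices of S.
  record IsPiece (ds : List (Segment n)) (S : Subset n) : Set where
    field
      isPolygon : 3 ≤ ∣ S ∣
      bounded   : ∀ a b → Consecutive S a b →
                  b ≡ a ⊕ 1 ⊎ ((a , b) L.∈ ds ⊎ (b , a) L.∈ ds)
      uncut     : ∀ a b → (a , b) L.∈ ds → a ∈ S → b ∈ S → SideOf S (a , b)

-- Dissections of the n-gon into m labelled pieces.
record Dissection (n : ℕ) .{{_ : NonZero n}} (m : ℕ) : Set where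
  field
    diagonals       : List (Segment n)
    areDiagonals    : All IsDiagonal diagonals
    distinct        : Unique diagonals
    noncrossing     : AllPairs (λ c d → ¬ Crossing c d) diagonals
    size            : suc (length diagonals) ≡ m
    -- The pieces, each listed exactly once.
    piece           : Fin m → Subset n
    piece-isPiece   : ∀ l → IsPiece diagonals (piece l)
    piece-injective : Injective _≡_ _≡_ piece
    piece-complete  : ∀ S → IsPiece diagonals S → ∃ λ l → piece l ≡ S

  degree : Fin m → ℕ
  degree l = ∣ piece l ∣

module _ {n : ℕ} .{{_ : NonZero n}} {m : ℕ} (D : Dissection n m) where

  open Dissection D

  -- The indeterminates of ℤ[x₀,…,x₍ₘ₋₁₎,q₀,…,q₍ₙ₋₁₎].

  x : Fin m → Poly (m + n)
  x l = var (l ↑ˡ n)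

  q : Fin n → Poly (m + n)
  q i = var (m ↑ʳ i)

  -- The t-th entry (t = 0, 1, …) of a walk from i is the piece p at the
  -- vertex i ⊕ suc t.
  PieceSeq : Fin n → Fin n → Set
  PieceSeq i j = Vec (Fin m) (dist i j ∸ 1)

  IsWalk : (i j : Fin n) → PieceSeq i j → Set
  IsWalk i j w =
      i ≢ j
    × (∀ t → i ⊕ suc (toℕ t) ∈ piece (Vec.lookup w t))
    × (∀ l → Vec.count (l ≟_) w ≤ degree l ∸ 2)

  isWalk? : ∀ i j w → Dec (IsWalk i j w)
  isWalk? i j w =
          ¬? (i ≟ j)
    ×-dec all? (λ t → i ⊕ suc (toℕ t) ∈? piece (Vec.lookup w t))
    ×-dec all? (λ l → Vec.count (l ≟_) w ≤? degree l ∸ 2)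

  allSeqs : ∀ k → List (Vec (Fin m) k)
  allSeqs zero    = [] ∷ []
  allSeqs (suc k) = cartesianProductWith _∷_ (allFin m) (allSeqs k)

  walks : (i j : Fin n) → List (PieceSeq i j)
  walks i j = filter (isWalk? i j) (allSeqs (dist i j ∸ 1))

  weight : (i j : Fin n) → PieceSeq i j → Poly (m + n)
  weight i j w =
      ∏ (map x (Vec.toList w))
    ⊠ ∏ (map (λ s → q (i ⊕ s)) (upTo (dist i j)))

  weightMatrix : Fin n → Fin n → Poly (m + n)
  weightMatrix i j = ∑ (map (weight i j) (walks i j))

  -- The minor d(e,f) for the edges e = edge i and f = edge j.
  minor : Fin n → Fin n → Poly (m + n)
  minor i j = det₂ (v i j)       (v i (j ⊕ 1))
                   (v (i ⊕ 1) j) (v (i ⊕ 1) (j ⊕ 1))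
    where v = weightMatrix

  ε : Poly (m + n)
  ε = ∏ (map q (allFin n))

  c : Poly (m + n)
  c = ∏ (map (λ l → x l ^ᴾ (degree l ∸ 2)) (allFin m))

  record ZigZag (e f : Segment n) : Set where
    field
      s           : ℕ
      z           : Fin (suc s) → Segment n
      p           : Fin s → Fin m
      starts      : z zero ≡ e
      ends        : z (fromℕ s) ≡ f
      inner       : ∀ k → 0 < toℕ k → toℕ k < s → z k L.∈ diagonals
      common      : ∀ k → SideOf (piece (p k)) (z (inject₁ k))
                        × SideOf (piece (p k)) (z (suc k))
      p-different : Injective _≡_ _≡_ p
      incident    : ∀ k → Incident (z (inject₁ k)) (z (suc k))

  -- Zig pieces for (edge i , edge j): at most one vertex on the
  -- counterclockwise route from j ⊕ 1 to i.

  ZigPiece : Fin n → Fin n → Fin m → Set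
  ZigPiece i j l = length (filter (_∈? piece l) (route (j ⊕ 1) i)) ≤ 1

  zigPiece? : ∀ i j l → Dec (ZigPiece i j l)
  zigPiece? i j l = length (filter (_∈? piece l) (route (j ⊕ 1) i)) ≤? 1

  zigPieces : Fin n → Fin n → List (Fin m)
  zigPieces i j = filter (zigPiece? i j) (allFin m)

-- Modulo the relations x_l ^ (d_l − 1) = 0, the walks from i to j sum up to
-- the product of s_k over the vertices k strictly between i and j, where s_k is
-- the sum of the x_l over the pieces at k, and v_{i,j} is the representative of
-- this product (times q's) with exponents at most d_l − 2.  Root the dissection
-- at e = (i , i + 1), as a tree of pieces.  For a subtree with the vertices
-- a, …, c the product of s_k over a < k < c is the product C of all
-- x_l ^ (d_l − 2) in the subtree, and C annihilates each of these x_l.  So the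
-- pairs (v_{i,·} , v_{i+1,·}) at j and j + 1 are computed along the path from e
-- down to f = (j , j + 1) by one 2 × 2 matrix for each piece.  Its determinant
-- is 1 if the path leaves the piece through the first side after the entry
-- side, 0 if through a middle side, and the square of the product of C over the
-- piece and the subtrees on the left of the path if through the last side.  A
-- zig-zag sequence is a path without middle sides, and its zig pieces are the
-- ones contributing to the determinants.

module Submission where

open import Defs
open import Algebra.Bundles using (CommutativeSemiring)
import Algebra.Solver.Ring.NaturalCoefficients.Default
open import Algebra.Structures using (IsCommutativeSemiring)
open import Algebra.Structures.Biased using (isCommutativeSemiringˡ)
open import Data.Bool using (Bool; true; false; if_then_else_)
open import Data.Empty using (⊥; ⊥-elim)
open import Data.Fin using (Fin; zero; suc; toℕ; fromℕ; inject₁; splitAt; _↑ˡ_; _↑ʳ_)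
import Data.Fin.Properties as Finₚ
open Finₚ using (_≟_)
open import Data.Fin.Subset as Subset using (Subset; _∈_; ∣_∣; inside; outside; ⁅_⁆; _∪_)
import Data.Fin.Subset.Properties as Subsetₚ
open Subsetₚ using (_∈?_)
open import Data.Integer as ℤ using (ℤ; 0ℤ; 1ℤ)
import Data.Integer.Properties as ℤₚ
import Data.Integer.Tactic.RingSolver as ℤ-Ring
open import Data.List using (List; []; _∷_; _++_; map; foldr; filter; allFin; length; upTo; applyUpTo; cartesianProductWith)
import Data.List.Membership.DecPropositional as DecL
import Data.List.Membership.Propositional as L
import Data.List.Membership.Propositional.Properties as Lₚ
open import Data.List.Membership.Propositional.Properties.WithK using (unique∧set⇒bag)
import Data.List.Properties as Listₚ
open import Data.List.Relation.Binary.BagAndSetEquality using (∼bag⇒↭)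
open import Data.List.Relation.Binary.Permutation.Propositional as Perm using (_↭_; prep; swap; ↭-sym)
open import Data.List.Relation.Binary.Permutation.Propositional.Properties using (↭-length; filter-↭)
open import Data.List.Relation.Unary.All as All using (All; []; _∷_)
import Data.List.Relation.Unary.All.Properties as Allₚ
open import Data.List.Relation.Unary.AllPairs as AllPairs using (AllPairs; []; _∷_)
import Data.List.Relation.Unary.AllPairs.Properties as AllPairsₚ
open import Data.List.Relation.Unary.Any using (here; there)
open import Data.List.Relation.Unary.Unique.Propositional using (Unique)
import Data.List.Relation.Unary.Unique.Propositional.Properties as Uniqueₚ
open import Data.Nat as ℕ using (ℕ; zero; suc; _∸_; _≤_; _<_; _≥_; _%_; z≤n; s≤s; NonZero)
open import Data.Nat.DivMod using (_mod_; _/_; %-distribˡ-+; m%n%n≡m%n; m≡m%n+[m/n]*n; [m+kn]%n≡m%n; m<n⇒m%n≡m; m%n<n; m%n≤n; [m+n]%n≡m%n)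
import Data.Nat.Properties as ℕₚ
open ℕₚ using (≤-trans; <-trans; ≤-<-trans; <-≤-trans; ≤-refl; <⇒≤; <⇒≱; ≤-antisym; ≤-reflexive; ≤-pred; n<1+n; <-irrefl; ≤∧≢⇒<; m≤n⇒m<n∨m≡n; ≮⇒≥; +-comm; +-suc; +-identityʳ; m+[n∸m]≡n; m<n⇒m<1+n; m≤n⇒m≤1+n; +-assoc; m≤n+m; m≤m+n; m≤n⇒∃[o]m+o≡n; <⇒≢; ≰⇒>; +-monoʳ-≤; <-cmp)
import Data.Nat.Tactic.RingSolver as ℕ-Ring
open import Data.Product using (_×_; _,_; ∃; ∃₂; Σ; proj₁; proj₂)
import Data.Product.Properties as ×ₚ
open import Data.Sum as Sum using (_⊎_; inj₁; inj₂)
open import Data.Unit using (⊤; tt)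
open import Data.Vec as Vec using (Vec; []; _∷_; here; there)
import Data.Vec.Properties as Vecₚ
open import Function using (_∘_; case_of_)
open import Function.Bundles using (_⇔_; Equivalence; mk⇔)
open import Function.Definitions using (Injective)
open import Level using (0ℓ)
open import Relation.Binary.Definitions using (tri<; tri≈; tri>)
open import Relation.Binary.PropositionalEquality hiding (isEquivalence)
import Relation.Binary.Reasoning.Setoid
open import Relation.Binary.Structures using (IsEquivalence)
open import Relation.Nullary using (¬_; Dec; does; yes; no)
open import Relation.Nullary.Decidable using (_×-dec_; _⊎-dec_; ¬?; dec-true; dec-false)

-- Linear functionals on formal sums

-- A minor has exponents up to 2 (d_l - 2), so it cannot be computed in the truncated ring, where
-- such powers vanish. Hence two equalities are kept side by side: the truncated one evaluates the
-- single entries, the exact one carries the determinant. The bridge is an exponent bound. Walks use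
-- each x_l at most d_l - 2 times by definition, and the recursively defined `E` and `F` obey the
-- same bound, so an equality modulo the relations between an entry and its closed form is already
-- exact.
--
-- Both equalities are treated as commutative semirings, which lets the same identities serve for
-- both. A determinant v is therefore stated as e′ f = v + e f′ and becomes a difference only at the
-- end.
--
-- A dissection comes as a bare list of diagonals and vertex sets, not as a tree. The tree is found
-- greedily: under a chord, go from each vertex along the farthest drawn diagonal, or along the
-- boundary edge if there is none. The resulting polygon is a region of the dissection, and
-- completeness of the list of pieces supplies its label.

+ᵐ-cancelʳ : ∀ {k} (μ ν : Vec ℕ k) → Vec.zipWith _∸_ (Vec.zipWith ℕ._+_ μ ν) ν ≡ μ
+ᵐ-cancelʳ []      []      = refl
+ᵐ-cancelʳ (a ∷ μ) (b ∷ ν) = cong₂ _∷_ (ℕₚ.m+n∸n≡m a b) (+ᵐ-cancelʳ μ ν)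

module _ {k : ℕ} where

  infixl 6 _+ᵐ_

  _+ᵐ_ : Vec ℕ k → Vec ℕ k → Vec ℕ k
  _+ᵐ_ = Vec.zipWith ℕ._+_

  +ᵐ-comm : ∀ μ ν → μ +ᵐ ν ≡ ν +ᵐ μ
  +ᵐ-comm = Vecₚ.zipWith-comm +-comm

  +ᵐ-assoc : ∀ μ ν ρ → (μ +ᵐ ν) +ᵐ ρ ≡ μ +ᵐ (ν +ᵐ ρ)
  +ᵐ-assoc = Vecₚ.zipWith-assoc +-assoc

  δ : Vec ℕ k → Vec ℕ k → ℤ
  δ μ ν = if does (Vecₚ.≡-dec ℕₚ._≟_ ν μ) then 1ℤ else 0ℤ

  δ-≢ : ∀ {μ ν} → ν ≢ μ → δ μ ν ≡ 0ℤ
  δ-≢ {μ} {ν} ν≢μ rewrite dec-false (Vecₚ.≡-dec ℕₚ._≟_ ν μ) ν≢μ = refl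

  -- Against functionals a product of polynomials becomes an iterated sum, so the ring axioms reduce
  -- to linearity and exchange of finite sums. Coefficients are recovered from the functionals
  -- `δ μ`.
  pair : Poly k → (Vec ℕ k → ℤ) → ℤ
  pair []            f = 0ℤ
  pair ((a , ν) ∷ p) f = a ℤ.* f ν ℤ.+ pair p f

  coeff-pair : ∀ p μ → coeff p μ ≡ pair p (δ μ)
  coeff-pair []            μ = refl
  coeff-pair ((a , ν) ∷ p) μ with does (Vecₚ.≡-dec ℕₚ._≟_ ν μ)
  ... | true = cong₂ ℤ._+_ (sym (ℤₚ.*-identityʳ a)) (coeff-pair p μ)
  ... | false = cong₂ ℤ._+_ (sym (ℤₚ.*-zeroʳ a)) (coeff-pair p μ)

  pair-cong : ∀ p {f g} → (∀ ν → f ν ≡ g ν) → pair p f ≡ pair p g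
  pair-cong []            f≗g = refl
  pair-cong ((a , ν) ∷ p) f≗g = cong₂ ℤ._+_ (cong (a ℤ.*_) (f≗g ν)) (pair-cong p f≗g)

  pair-0 : ∀ p → pair p (λ _ → 0ℤ) ≡ 0ℤ
  pair-0 []            = refl
  pair-0 ((a , ν) ∷ p) = cong₂ ℤ._+_ (ℤₚ.*-zeroʳ a) (pair-0 p)

  pair-++ : ∀ p r f → pair (p ++ r) f ≡ pair p f ℤ.+ pair r f
  pair-++ []            r f = sym (ℤₚ.+-identityˡ _)
  pair-++ ((a , ν) ∷ p) r f =
    trans (cong (λ z → a ℤ.* f ν ℤ.+ z) (pair-++ p r f)) (sym (ℤₚ.+-assoc (a ℤ.* f ν) _ _))

  pair-+ : ∀ p f g → pair p (λ ν → f ν ℤ.+ g ν) ≡ pair p f ℤ.+ pair p g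
  pair-+ []            f g = refl
  pair-+ ((a , ν) ∷ p) f g rewrite pair-+ p f g = lem a (f ν) (g ν) (pair p f) (pair p g)
    where
    lem : ∀ a b c d e → a ℤ.* (b ℤ.+ c) ℤ.+ (d ℤ.+ e) ≡ (a ℤ.* b ℤ.+ d) ℤ.+ (a ℤ.* c ℤ.+ e)
    lem = ℤ-Ring.solve-∀

  pair-* : ∀ p b f → pair p (λ ν → b ℤ.* f ν) ≡ b ℤ.* pair p f
  pair-* []            b f = sym (ℤₚ.*-zeroʳ b)
  pair-* ((a , ν) ∷ p) b f rewrite pair-* p b f = lem a b (f ν) (pair p f)
    where
    lem : ∀ a b c d → a ℤ.* (b ℤ.* c) ℤ.+ b ℤ.* d ≡ b ℤ.* (a ℤ.* c ℤ.+ d)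
    lem = ℤ-Ring.solve-∀

  pair-swap : ∀ p r (f : Vec ℕ k → Vec ℕ k → ℤ) →
              pair p (λ ν → pair r (f ν)) ≡ pair r (λ ρ → pair p (λ ν → f ν ρ))
  pair-swap []            r f = sym (pair-0 r)
  pair-swap ((a , ν) ∷ p) r f = begin
    a ℤ.* pair r (f ν) ℤ.+ pair p (λ ν → pair r (f ν))
      ≡⟨ cong₂ ℤ._+_ (sym (pair-* r a (f ν))) (pair-swap p r f) ⟩
    pair r (λ ρ → a ℤ.* f ν ρ) ℤ.+ pair r (λ ρ → pair p (λ ν → f ν ρ))
      ≡⟨ pair-+ r _ _ ⟨
    pair r (λ ρ → a ℤ.* f ν ρ ℤ.+ pair p (λ ν → f ν ρ)) ∎
    where open ≡-Reasoning

  pair-⊠ : ∀ p r f → pair (p ⊠ r) f ≡ pair p (λ ν → pair r (λ ρ → f (ν +ᵐ ρ)))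
  pair-⊠ []            r f = refl
  pair-⊠ ((a , ν) ∷ p) r f =
    trans (pair-++ (map _ r) (p ⊠ r) f) (cong₂ ℤ._+_ (scaled r) (pair-⊠ p r f))
    where
    scaled : ∀ r → pair (map (λ (b , ρ) → a ℤ.* b , ν +ᵐ ρ) r) f
                 ≡ a ℤ.* pair r (λ ρ → f (ν +ᵐ ρ))
    scaled []            = sym (ℤₚ.*-zeroʳ a)
    scaled ((b , ρ) ∷ r) rewrite scaled r = lem a b (f (ν +ᵐ ρ)) (pair r (λ ρ → f (ν +ᵐ ρ)))
      where
      lem : ∀ a b c d → a ℤ.* b ℤ.* c ℤ.+ a ℤ.* d ≡ a ℤ.* (b ℤ.* c ℤ.+ d)
      lem = ℤ-Ring.solve-∀

  pair-neg : ∀ p f → pair (-ᴾ p) f ≡ ℤ.- pair p f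
  pair-neg []            f = refl
  pair-neg ((a , ν) ∷ p) f rewrite pair-neg p f = lem a (f ν) (pair p f)
    where
    lem : ∀ a b c → (ℤ.- a) ℤ.* b ℤ.+ (ℤ.- c) ≡ ℤ.- (a ℤ.* b ℤ.+ c)
    lem = ℤ-Ring.solve-∀

  coeff-⊞ : ∀ p r μ → coeff (p ⊞ r) μ ≡ coeff p μ ℤ.+ coeff r μ
  coeff-⊞ p r μ = trans (coeff-pair (p ++ r) μ)
    (trans (pair-++ p r (δ μ)) (cong₂ ℤ._+_ (sym (coeff-pair p μ)) (sym (coeff-pair r μ))))

  coeff-neg : ∀ p μ → coeff (-ᴾ p) μ ≡ ℤ.- coeff p μ
  coeff-neg p μ = trans (coeff-pair (-ᴾ p) μ) (trans (pair-neg p (δ μ)) (cong ℤ.-_ (sym (coeff-pair p μ))))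

  coeff-⊟ : ∀ p r μ → coeff (p ⊟ r) μ ≡ coeff p μ ℤ.- coeff r μ
  coeff-⊟ p r μ = trans (coeff-⊞ p (-ᴾ r) μ) (cong (λ z → coeff p μ ℤ.+ z) (coeff-neg r μ))

-- Polynomials up to the coefficients of the monomials in a set P closed
-- under divisors form a commutative semiring: P = everything gives _≈_ and
-- P = bounded exponents gives a truncated polynomial ring.

module Truncated {k : ℕ} (P : Vec ℕ k → Set)
  (P-divisor : (μ ν : Vec ℕ k) → P (μ +ᵐ ν) → P μ) where

  infix 4 _≃_

  record _≃_ (p r : Poly k) : Set where
    constructor coeffwise
    field at : ∀ μ → P μ → coeff p μ ≡ coeff r μ

  open _≃_ public

  -- The ring axioms hold against every functional, whatever the set P. Closure of P under divisors
  -- matters only for the congruence of `_⊠_`.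
  pair⇒≃ : ∀ {p r} → (∀ f → pair p f ≡ pair r f) → p ≃ r
  pair⇒≃ {p} {r} h .at μ _ = trans (coeff-pair p μ) (trans (h (δ μ)) (sym (coeff-pair r μ)))

  ≃⇒pair : ∀ {p r} → p ≃ r → ∀ μ → P μ → pair p (δ μ) ≡ pair r (δ μ)
  ≃⇒pair {p} {r} h μ Pμ = trans (sym (coeff-pair p μ)) (trans (h .at μ Pμ) (coeff-pair r μ))

  ⊞-cong : ∀ {p p′ r r′} → p ≃ p′ → r ≃ r′ → p ⊞ r ≃ p′ ⊞ r′
  ⊞-cong {p} {p′} {r} {r′} hp hr .at μ Pμ =
    trans (coeff-⊞ p r μ) (trans (cong₂ ℤ._+_ (hp .at μ Pμ) (hr .at μ Pμ)) (sym (coeff-⊞ p′ r′ μ)))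

  ⊞-comm : ∀ p r → p ⊞ r ≃ r ⊞ p
  ⊞-comm p r = pair⇒≃ {p ⊞ r} {r ⊞ p} λ f →
    trans (pair-++ p r f) (trans (ℤₚ.+-comm (pair p f) _) (sym (pair-++ r p f)))

  ⊠-comm : ∀ p r → p ⊠ r ≃ r ⊠ p
  ⊠-comm p r = pair⇒≃ {p ⊠ r} {r ⊠ p} λ f → begin
    pair (p ⊠ r) f                              ≡⟨ pair-⊠ p r f ⟩
    pair p (λ ν → pair r (λ ρ → f (ν +ᵐ ρ)))    ≡⟨ pair-swap p r _ ⟩
    pair r (λ ρ → pair p (λ ν → f (ν +ᵐ ρ)))
      ≡⟨ pair-cong r (λ ρ → pair-cong p (λ ν → cong f (+ᵐ-comm ν ρ))) ⟩
    pair r (λ ρ → pair p (λ ν → f (ρ +ᵐ ν)))    ≡⟨ pair-⊠ r p f ⟨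
    pair (r ⊠ p) f                              ∎
    where open ≡-Reasoning

  -- The functional δ μ (· + ρ) is δ (μ - ρ), or 0 when ρ does not divide μ.
  pair-shift-cong : ∀ {p p′} → p ≃ p′ → ∀ μ → P μ → ∀ ρ →
                    pair p (λ ν → δ μ (ν +ᵐ ρ)) ≡ pair p′ (λ ν → δ μ (ν +ᵐ ρ))
  pair-shift-cong {p} {p′} h μ Pμ ρ
    -- Truncated subtraction followed by addition gives back μ exactly when ρ divides it.
    with Vecₚ.≡-dec ℕₚ._≟_ (Vec.zipWith _∸_ μ ρ +ᵐ ρ) μ
  ... | no ¬div = trans (vanish p) (sym (vanish p′))
    where
    vanish : ∀ p → pair p (λ ν → δ μ (ν +ᵐ ρ)) ≡ 0ℤ
    vanish p = trans
      (pair-cong p (λ ν → δ-≢ {μ = μ} {ν +ᵐ ρ} λ eq → ¬div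
        (trans (cong (λ κ → Vec.zipWith _∸_ κ ρ +ᵐ ρ) (sym eq))
               (trans (cong (_+ᵐ ρ) (+ᵐ-cancelʳ ν ρ)) eq))))
      (pair-0 p)
  -- The quotient σ divides μ and so stays in P; the hypothesis applies to its coefficient.
  ... | yes div = trans (shift p) (trans (≃⇒pair {p} {p′} h σ (P-divisor σ ρ (subst P (sym div) Pμ))) (sym (shift p′)))
    where
    σ = Vec.zipWith _∸_ μ ρ
    δ-shift : ∀ ν → δ μ (ν +ᵐ ρ) ≡ δ σ ν
    δ-shift ν with Vecₚ.≡-dec ℕₚ._≟_ (ν +ᵐ ρ) μ | Vecₚ.≡-dec ℕₚ._≟_ ν σ
    ... | yes _  | yes _   = refl
    ... | no _   | no _    = refl
    ... | yes eq | no ν≢σ  = ⊥-elim (ν≢σ (trans (sym (+ᵐ-cancelʳ ν ρ)) (cong (λ κ → Vec.zipWith _∸_ κ ρ) eq)))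
    ... | no neq | yes ν≡σ = ⊥-elim (neq (trans (cong (_+ᵐ ρ) ν≡σ) div))
    shift : ∀ p → pair p (λ ν → δ μ (ν +ᵐ ρ)) ≡ pair p (δ σ)
    shift p = pair-cong p δ-shift

  ⊠-congʳ : ∀ p {r r′} → r ≃ r′ → p ⊠ r ≃ p ⊠ r′
  ⊠-congʳ p {r} {r′} h .at μ Pμ = begin
    coeff (p ⊠ r) μ                              ≡⟨ coeff-pair (p ⊠ r) μ ⟩
    pair (p ⊠ r) (δ μ)                           ≡⟨ pair-⊠ p r (δ μ) ⟩
    pair p (λ ν → pair r (λ ρ → δ μ (ν +ᵐ ρ)))   ≡⟨ pair-cong p (λ ν → flipped ν) ⟩
    pair p (λ ν → pair r′ (λ ρ → δ μ (ν +ᵐ ρ)))  ≡⟨ pair-⊠ p r′ (δ μ) ⟨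
    pair (p ⊠ r′) (δ μ)                          ≡⟨ coeff-pair (p ⊠ r′) μ ⟨
    coeff (p ⊠ r′) μ                             ∎
    where
    open ≡-Reasoning
    flipped : ∀ ν → pair r (λ ρ → δ μ (ν +ᵐ ρ)) ≡ pair r′ (λ ρ → δ μ (ν +ᵐ ρ))
    flipped ν = trans (pair-cong r (λ ρ → cong (δ μ) (+ᵐ-comm ν ρ)))
      (trans (pair-shift-cong {r} {r′} h μ Pμ ν) (pair-cong r′ (λ ρ → cong (δ μ) (+ᵐ-comm ρ ν))))

  ⊠-cong : ∀ {p p′ r r′} → p ≃ p′ → r ≃ r′ → p ⊠ r ≃ p′ ⊠ r′
  ≃-isEquivalence : IsEquivalence _≃_
  ≃-isEquivalence = record
    { refl = coeffwise λ μ _ → refl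
    ; sym = λ h → coeffwise λ μ Pμ → sym (h .at μ Pμ)
    ; trans = λ h h′ → coeffwise λ μ Pμ → trans (h .at μ Pμ) (h′ .at μ Pμ) }

  module ≃ = IsEquivalence ≃-isEquivalence

  ⊠-cong {p} {p′} {r} {r′} hp hr = ≃.trans (⊠-congʳ p hr)
    (≃.trans (⊠-comm p r′) (≃.trans (⊠-congʳ r′ hp) (⊠-comm r′ p′)))

  ⊠-assoc : ∀ p r s → (p ⊠ r) ⊠ s ≃ p ⊠ (r ⊠ s)
  ⊠-assoc p r s = pair⇒≃ {(p ⊠ r) ⊠ s} {p ⊠ (r ⊠ s)} λ f → begin
    pair ((p ⊠ r) ⊠ s) f
      ≡⟨ trans (pair-⊠ (p ⊠ r) s f) (pair-⊠ p r _) ⟩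
    pair p (λ ν → pair r (λ ρ → pair s (λ σ → f ((ν +ᵐ ρ) +ᵐ σ))))
      ≡⟨ pair-cong p (λ ν → trans
           (pair-cong r (λ ρ → pair-cong s (λ σ → cong f (+ᵐ-assoc ν ρ σ))))
           (sym (pair-⊠ r s _))) ⟩
    pair p (λ ν → pair (r ⊠ s) (λ ρ → f (ν +ᵐ ρ)))
      ≡⟨ pair-⊠ p (r ⊠ s) f ⟨
    pair (p ⊠ (r ⊠ s)) f ∎
    where open ≡-Reasoning

  ⊠-identityˡ : ∀ p → 1ᴾ ⊠ p ≃ p
  ⊠-identityˡ p = pair⇒≃ {1ᴾ ⊠ p} {p} λ f → begin
    pair (1ᴾ ⊠ p) f                                            ≡⟨ pair-⊠ 1ᴾ p f ⟩
    1ℤ ℤ.* pair p (λ ρ → f (Vec.replicate k 0 +ᵐ ρ)) ℤ.+ 0ℤ    ≡⟨ ℤₚ.+-identityʳ _ ⟩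
    1ℤ ℤ.* pair p (λ ρ → f (Vec.replicate k 0 +ᵐ ρ))           ≡⟨ ℤₚ.*-identityˡ _ ⟩
    pair p (λ ρ → f (Vec.replicate k 0 +ᵐ ρ))
      ≡⟨ pair-cong p (λ ρ → cong f (Vecₚ.zipWith-identityˡ ℕₚ.+-identityˡ ρ)) ⟩
    pair p f                                                   ∎
    where open ≡-Reasoning

  isCommutativeSemiring : IsCommutativeSemiring _≃_ _⊞_ _⊠_ 0ᴾ 1ᴾ
  isCommutativeSemiring = isCommutativeSemiringˡ (record
      { +-isCommutativeMonoid = record
        { isMonoid = record
          { isSemigroup = record
            { isMagma = record
              { isEquivalence = ≃-isEquivalence
              ; ∙-cong = λ {p} {p′} {r} {r′} → ⊞-cong {p} {p′} {r} {r′} }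
            ; assoc = λ p r s → ≃.reflexive (Listₚ.++-assoc p r s) }
          ; identity = (λ p → ≃.reflexive refl) , (λ p → ≃.reflexive (Listₚ.++-identityʳ p)) }
        ; comm = ⊞-comm }
      ; *-isCommutativeMonoid = record
        { isMonoid = record
          { isSemigroup = record
            { isMagma = record
              { isEquivalence = ≃-isEquivalence
              ; ∙-cong = λ {p} {p′} {r} {r′} → ⊠-cong {p} {p′} {r} {r′} }
            ; assoc = ⊠-assoc }
          ; identity = ⊠-identityˡ
                     , (λ p → ≃.trans (⊠-comm p 1ᴾ) (⊠-identityˡ p)) }
        ; comm = ⊠-comm }
      ; distribʳ = λ s p r → ≃.reflexive (Listₚ.cartesianProductWith-distribʳ-++ _ p r s)
      ; zeroˡ = λ p → ≃.refl })

-- Algebras with an exact and a truncated equality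

module _ {m : ℕ} where

  unit : Fin m → Fin m → ℕ
  unit l l′ = if does (l ≟ l′) then 1 else 0

  unit-refl : ∀ l → unit l l ≡ 1
  unit-refl l rewrite dec-true (l ≟ l) refl = refl

  unit-≢ : ∀ {l l′} → l ≢ l′ → unit l l′ ≡ 0
  unit-≢ {l} {l′} l≢l′ rewrite dec-false (l ≟ l′) l≢l′ = refl

power : {A : Set} → (A → A → A) → A → A → ℕ → A
power _·_ u p zero    = u
power _·_ u p (suc e) = p · power _·_ u p e

-- Polynomials with two equalities: _≋_, and _≃_ modulo the relations
-- ξ l ^ suc (κ l) = 0.
record TruncatedAlgebra (m : ℕ) : Set₁ where
  infix  4 _≋_ _≃_
  infixl 6 _+_
  infixl 7 _*_
  field
    Carrier : Set
    _+_ _*_ : Carrier → Carrier → Carrier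
    0# 1#   : Carrier
    _≋_ _≃_ : Carrier → Carrier → Set
    ≈-isCommutativeSemiring : IsCommutativeSemiring _≋_ _+_ _*_ 0# 1#
    ≃-isCommutativeSemiring : IsCommutativeSemiring _≃_ _+_ _*_ 0# 1#
    ≈⇒≃     : ∀ {p r} → p ≋ r → p ≃ r
    ξ       : Fin m → Carrier
    κ       : Fin m → ℕ

    nilpotent : ∀ l → power _*_ 1# (ξ l) (suc (κ l)) ≃ 0#
    -- Bounded β p: every exponent of ξ l in p is at most β l.
    Bounded   : (Fin m → ℕ) → Carrier → Set
    bounded-0 : ∀ {β} → Bounded β 0#
    bounded-1 : ∀ {β} → Bounded β 1#
    bounded-x : ∀ l → Bounded (unit l) (ξ l)
    bounded-+ : ∀ {β p r} → Bounded β p → Bounded β r → Bounded β (p + r)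
    bounded-* : ∀ {β γ p r} → Bounded β p → Bounded γ r → Bounded (λ l → β l ℕ.+ γ l) (p * r)
    bounded-≤ : ∀ {β γ p} → (∀ l → β l ≤ γ l) → Bounded β p → Bounded γ p

  pow : Carrier → ℕ → Carrier
  pow = power _*_ 1#

  prod sum : List Carrier → Carrier
  prod = foldr _*_ 1#
  sum  = foldr _+_ 0#

module SemiringIdentities (R : CommutativeSemiring 0ℓ 0ℓ) where
  open CommutativeSemiring R renaming (_≈_ to _≋_; refl to ≈-refl; trans to ≈-trans; sym to ≈-sym)
  open Algebra.Solver.Ring.NaturalCoefficients.Default R

  closed-node : ∀ c k x d → c * (k * (x * d)) ≋ x * k * (c * d)
  closed-node = solve 4 (λ c k x d → c :* (k :* (x :* d)) := x :* k :* (c :* d)) ≈-refl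

  -- The second component is x times the first in both columns, so the rows are proportional.
  mid-det : ∀ e e′ x → e′ * (x * e) ≋ 0# + e * (x * e′)
  mid-det = solve 3 (λ e e′ x → e′ :* (x :* e) := con 0 :+ e :* (x :* e′)) ≈-refl

  -- The map e ↦ e, f ↦ f + x e is unipotent.
  first-det : ∀ {v} e e′ f f′ x → e′ * f ≋ v + e * f′ →
              e′ * (f + x * e) ≋ v + e * (f′ + x * e′)
  first-det {v} e e′ f f′ x h = ≈-trans
    (solve 4 (λ e e′ f x → e′ :* (f :+ x :* e) := e′ :* f :+ x :* e :* e′) ≈-refl e e′ f x)
    (≈-trans (+-congʳ h)
      (solve 5 (λ v e e′ f′ x → (v :+ e :* f′) :+ x :* e :* e′ := v :+ e :* (f′ :+ x :* e′)) ≈-refl v e e′ f′ x))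

  -- The map e ↦ c k (f + x e), f ↦ c k x f is triangular with x c k twice on the diagonal.
  last-det : ∀ {v} c k e e′ f f′ x → e′ * f ≋ v + e * f′ →
             c * (k * (f′ + x * e′)) * (c * (k * (x * f)))
             ≋ x * c * k * (x * c * k) * v + c * (k * (f + x * e)) * (c * (k * (x * f′)))
  last-det {v} c k e e′ f f′ x h = ≈-trans
    (solve 6 (λ c k e′ f f′ x → c :* (k :* (f′ :+ x :* e′)) :* (c :* (k :* (x :* f)))
        := c :* c :* k :* k :* x :* f :* f′ :+ c :* c :* k :* k :* x :* x :* (e′ :* f)) ≈-refl c k e′ f f′ x)
    (≈-trans (+-congˡ (*-congˡ h))
      (solve 7 (λ v c k e f f′ x → c :* c :* k :* k :* x :* f :* f′ :+ c :* c :* k :* k :* x :* x :* (v :+ e :* f′)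
          := x :* c :* k :* (x :* c :* k) :* v :+ c :* (k :* (f :+ x :* e)) :* (c :* (k :* (x :* f′)))) ≈-refl v c k e f f′ x))

  swap-head : ∀ a b c → a * (b * c) ≋ b * (a * c)
  swap-head = solve 3 (λ a b c → a :* (b :* c) := b :* (a :* c)) ≈-refl

  interchange : ∀ a b c d → a * b * (c * d) ≋ a * c * (b * d)
  interchange = solve 4 (λ a b c d → a :* b :* (c :* d) := a :* c :* (b :* d)) ≈-refl

  hd-+ : ∀ x g s → (x + g) * s ≋ g * s + x * s
  hd-+ = solve 3 (λ x g s → (x :+ g) :* s := g :* s :+ x :* s) ≈-refl

  last-F : ∀ x c k f e → x * (c * (k * (f + x * e))) ≋ c * (k * (x * f)) + x * (x * k) * (c * e)
  last-F = solve 5 (λ x c k f e → x :* (c :* (k :* (f :+ x :* e)))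
                      := c :* (k :* (x :* f)) :+ x :* (x :* k) :* (c :* e)) ≈-refl

  minor-det : ∀ {v₀₀ v₀₁ v₁₀ v₁₁ F₀ F₁ E₀ E₁} a qᵢ qⱼ v →
              v₀₀ ≋ F₀ * (qᵢ * a) → v₁₁ ≋ E₁ * (a * qⱼ) → v₀₁ ≋ F₁ * (qᵢ * (a * qⱼ)) → v₁₀ ≋ E₀ * a →
              E₁ * F₀ ≋ v + E₀ * F₁ → v₀₀ * v₁₁ ≋ qᵢ * qⱼ * (a * a) * v + v₀₁ * v₁₀
  minor-det {F₀ = F₀} {F₁} {E₀} {E₁} a qᵢ qⱼ v h₀₀ h₁₁ h₀₁ h₁₀ det = ≈-trans (*-cong h₀₀ h₁₁) (≈-trans
    (solve 5 (λ F₀ E₁ a qᵢ qⱼ → F₀ :* (qᵢ :* a) :* (E₁ :* (a :* qⱼ)) := qᵢ :* qⱼ :* (a :* a) :* (E₁ :* F₀)) ≈-refl F₀ E₁ a qᵢ qⱼ)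
    (≈-trans (*-congˡ det) (≈-trans
      (solve 6 (λ F₁ E₀ a qᵢ qⱼ v → qᵢ :* qⱼ :* (a :* a) :* (v :+ E₀ :* F₁)
          := qᵢ :* qⱼ :* (a :* a) :* v :+ F₁ :* (qᵢ :* (a :* qⱼ)) :* (E₀ :* a)) ≈-refl F₁ E₀ a qᵢ qⱼ v)
      (+-congˡ (*-cong (≈-sym h₀₁) (≈-sym h₁₀))))))

  diagonal-minor : ∀ {v₀₁ v₁₀} qᵢ c a → v₀₁ ≋ 1# * (qᵢ * 1#) → v₁₀ ≋ c * a → v₀₁ * v₁₀ ≋ qᵢ * a * c
  diagonal-minor qᵢ c a h₀₁ h₁₀ = ≈-trans (*-cong h₀₁ h₁₀)
    (solve 3 (λ qᵢ c a → con 1 :* (qᵢ :* con 1) :* (c :* a) := qᵢ :* a :* c) ≈-refl qᵢ c a)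

  absorb-id : ∀ x g c h → (x + g) * (c * h) ≋ x * (c * h) + c * g * h
  absorb-id = solve 4 (λ x g c h → (x :+ g) :* (c :* h) := x :* (c :* h) :+ c :* g :* h) ≈-refl

  regroup : ∀ p k c d → p * k * (c * d) ≋ p * (c * (k * d))
  regroup = solve 4 (λ p k c d → p :* k :* (c :* d) := p :* (c :* (k :* d))) ≈-refl

  step-id : ∀ c x g₀ g s → c * ((x + (g₀ + g)) * s) ≋ c * ((x + g) * s) + c * g₀ * s
  step-id = solve 5 (λ c x g₀ g s → c :* ((x :+ (g₀ :+ g)) :* s) := c :* ((x :+ g) :* s) :+ c :* g₀ :* s) ≈-refl

-- Trees of pieces and paths to their leaves

module Trees {m : ℕ} (κ : Fin m → ℕ) (In : Fin m → ℕ → Set) where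

  record Side (l : Fin m) (a b : ℕ) : Set where
    constructor side
    field
      inˡ     : In l a
      inʳ     : In l b
      between : ∀ {k} → a < k → k < b → ¬ In l k

  Within : ℕ → ℕ → Fin m → Set
  Within a c l = ∀ k → In l k → a ≤ k × k ≤ c

  -- Tree a c is a dissection of the polygon with the vertices a, …, c, rooted
  -- at its side (a , c): the root piece l has a first child, a number k of
  -- middle children, and a last child.
  data Tree : ℕ → ℕ → Set
  data Mids (l : Fin m) : ℕ → ℕ → ℕ → Set

  data Tree where
    leaf : ∀ {a} → Tree a (suc a)
    node : ∀ {a b c d k} l → κ l ≡ suc k → Within a d l →
           Side l a b → Tree a b → Mids l k b c → Side l c d → Tree c d → Tree a d

  data Mids l where
    []   : ∀ {b} → Mids l 0 b b
    cons : ∀ {a b c k} → Side l a b → Tree a b → Mids l k b c → Mids l (suc k) a c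

  tree-< : ∀ {a c} → Tree a c → a < c
  mids-≤ : ∀ {l k a c} → Mids l k a c → a ≤ c

  tree-< leaf                    = n<1+n _
  tree-< (node _ _ _ _ t ms _ u) = <-trans (tree-< t) (≤-<-trans (mids-≤ ms) (tree-< u))

  mids-≤ []            = ≤-refl
  mids-≤ (cons _ t ms) = ≤-trans (<⇒≤ (tree-< t)) (mids-≤ ms)

  suffix-< : ∀ {l k b c d} → Mids l k b c → Tree c d → b < d
  suffix-< ms u = ≤-<-trans (mids-≤ ms) (tree-< u)

  labels  : ∀ {a c} → Tree a c → List (Fin m)
  mlabels : ∀ {l k a c} → Mids l k a c → List (Fin m)

  labels leaf                    = []
  labels (node l _ _ _ t ms _ u) = l ∷ labels t ++ mlabels ms ++ labels u

  mlabels []            = []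
  mlabels (cons _ t ms) = labels t ++ mlabels ms

  weaken : ∀ {a a′ c c′ ls} → a′ ≤ a → c ≤ c′ → All (Within a c) ls → All (Within a′ c′) ls
  weaken a′≤a c≤c′ = All.map λ w k l∋k →
    ≤-trans a′≤a (proj₁ (w k l∋k)) , ≤-trans (proj₂ (w k l∋k)) c≤c′

  labels-within  : ∀ {a c} (t : Tree a c) → All (Within a c) (labels t)
  mlabels-within : ∀ {l k a c} (ms : Mids l k a c) → All (Within a c) (mlabels ms)
  suffix-within  : ∀ {l k b c d} (ms : Mids l k b c) (u : Tree c d) → All (Within b d) (mlabels ms ++ labels u)

  labels-within leaf = []
  labels-within (node l _ w _ t ms _ u) = w ∷ Allₚ.++⁺
    (weaken ≤-refl (<⇒≤ (suffix-< ms u)) (labels-within t))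
    (weaken (<⇒≤ (tree-< t)) ≤-refl (suffix-within ms u))

  mlabels-within [] = []
  mlabels-within (cons _ t ms) = Allₚ.++⁺
    (weaken ≤-refl (mids-≤ ms) (labels-within t))
    (weaken (<⇒≤ (tree-< t)) ≤-refl (mlabels-within ms))

  suffix-within ms u = Allₚ.++⁺
    (weaken ≤-refl (<⇒≤ (tree-< u)) (mlabels-within ms))
    (weaken (mids-≤ ms) ≤-refl (labels-within u))

  data Path  : ∀ {a c} → Tree a c → ℕ → Set
  data MPath {l} : ∀ {k a c} → Mids l k a c → ℕ → Set

  data Path where
    here  : ∀ {a} → Path (leaf {a}) a
    first : ∀ {a b c d k l e w s} {t : Tree a b} {ms : Mids l k b c} {s′} {u : Tree c d} {p} →
            Path t p → Path (node l e w s t ms s′ u) p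
    mid   : ∀ {a b c d k l e w s} {t : Tree a b} {ms : Mids l k b c} {s′} {u : Tree c d} {p} →
            MPath ms p → Path (node l e w s t ms s′ u) p
    last  : ∀ {a b c d k l e w s} {t : Tree a b} {ms : Mids l k b c} {s′} {u : Tree c d} {p} →
            Path u p → Path (node l e w s t ms s′ u) p

  data MPath {l} where
    here  : ∀ {a b c k s} {t : Tree a b} {ms : Mids l k b c} {p} → Path t p → MPath (cons s t ms) p
    there : ∀ {a b c k s} {t : Tree a b} {ms : Mids l k b c} {p} → MPath ms p → MPath (cons s t ms) p

  path-range  : ∀ {a c p} {t : Tree a c} → Path t p → a ≤ p × p < c
  mpath-range : ∀ {l k a c p} {ms : Mids l k a c} → MPath ms p → a ≤ p × p < c

  path-range here = ≤-refl , n<1+n _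
  path-range (first {ms = ms} {u = u} π) with path-range π
  ... | a≤p , p<b = a≤p , <-≤-trans p<b (<⇒≤ (suffix-< ms u))
  path-range (mid {t = t} {u = u} π) with mpath-range π
  ... | b≤p , p<c = ≤-trans (<⇒≤ (tree-< t)) b≤p , <-trans p<c (tree-< u)
  path-range (last {t = t} {ms = ms} π) with path-range π
  ... | c≤p , p<d = ≤-trans (<⇒≤ (tree-< t)) (≤-trans (mids-≤ ms) c≤p) , p<d

  mpath-range (here {ms = ms} π) with path-range π
  ... | a≤p , p<b = a≤p , <-≤-trans p<b (mids-≤ ms)
  mpath-range (there {t = t} π) with mpath-range π
  ... | b≤p , p<c = ≤-trans (<⇒≤ (tree-< t)) b≤p , p<c

  path  : ∀ {a c} (t : Tree a c) {p} → a ≤ p → p < c → Path t p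
  mpath : ∀ {l k a c} (ms : Mids l k a c) {p} → a ≤ p → p < c → MPath ms p

  path leaf a≤p p<c with ≤-antisym a≤p (≤-pred p<c)
  ... | refl = here
  path (node {b = b} {c} l _ _ _ t ms _ u) {p} a≤p p<d with p ℕ.<? b | p ℕ.<? c
  ... | yes p<b | _       = first (path t a≤p p<b)
  ... | no p≮b  | yes p<c = mid (mpath ms (≮⇒≥ p≮b) p<c)
  ... | no _    | no p≮c  = last (path u (≮⇒≥ p≮c) p<d)

  mpath [] a≤p p<a = ⊥-elim (<-irrefl refl (≤-<-trans a≤p p<a))
  mpath (cons {b = b} _ t ms) {p} a≤p p<c with p ℕ.<? b
  ... | yes p<b = here (path t a≤p p<b)
  ... | no p≮b  = there (mpath ms (≮⇒≥ p≮b) p<c)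

  -- The paths leaving every piece through a side incident to the entry side.
  data Ends : ∀ {a c} {t : Tree a c} {p} → Path t p → Set where
    here  : ∀ {a} → Ends (here {a})
    first : ∀ {a b c d k l e w s} {t : Tree a b} {ms : Mids l k b c} {s′} {u : Tree c d} {p} {π : Path t p} →
            Ends π → Ends (first {e = e} {w} {s} {t} {ms} {s′} {u} π)
    last  : ∀ {a b c d k l e w s} {t : Tree a b} {ms : Mids l k b c} {s′} {u : Tree c d} {p} {π : Path u p} →
            Ends π → Ends (last {e = e} {w} {s} {t} {ms} {s′} {u} π)

  ends? : ∀ {a c} {t : Tree a c} {p} (π : Path t p) → Dec (Ends π)
  ends? here = yes here
  ends? (first π) with ends? π
  ... | yes e = yes (first e)
  ... | no ¬e = no λ { (first e) → ¬e e }
  ends? (mid π) = no λ ()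
  ends? (last π) with ends? π
  ... | yes e = yes (last e)
  ... | no ¬e = no λ { (last e) → ¬e e }

  -- After an exit through the first side the root piece and its other subtrees lie to the right of
  -- the leaf; after an exit through the last side they lie to its left and are collected.
  zigs : ∀ {a c} {t : Tree a c} {p} {π : Path t p} → Ends π → List (Fin m)
  zigs here = []
  zigs (first e) = zigs e
  zigs (last {l = l} {t = t} {ms} e) = (l ∷ labels t ++ mlabels ms) ++ zigs e

-- Products of stars along a tree and their determinants

module TreeAlgebra {m : ℕ} (A : TruncatedAlgebra m) (In : Fin m → ℕ → Set)
  (In? : (l : Fin m) (k : ℕ) → Dec (In l k)) where

  open TruncatedAlgebra A
  open Trees κ In

  ≈-semiring ≃-semiring : CommutativeSemiring 0ℓ 0ℓ
  ≈-semiring = record { isCommutativeSemiring = ≈-isCommutativeSemiring }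
  ≃-semiring = record { isCommutativeSemiring = ≃-isCommutativeSemiring }

  module Full  = CommutativeSemiring ≈-semiring
  module FullL = SemiringIdentities ≈-semiring
  module Trun  = CommutativeSemiring ≃-semiring
  module TrunL = SemiringIdentities ≃-semiring
  module ≈-Reasoning = Relation.Binary.Reasoning.Setoid Full.setoid
  module ≃-Reasoning = Relation.Binary.Reasoning.Setoid Trun.setoid

  incident : List (Fin m) → ℕ → Carrier
  incident ls k = sum (map ξ (filter (λ l → In? l k) ls))

  monomial : List (Fin m) → Carrier
  monomial ls = prod (map (λ l → pow (ξ l) (κ l)) ls)

  incident-∷-in : ∀ {l k} ls → In l k → incident (l ∷ ls) k ≡ ξ l + incident ls k
  incident-∷-in {l} {k} ls l∋k with In? l k
  ... | yes _   = refl
  ... | no l∌k = ⊥-elim (l∌k l∋k)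

  incident-∷-out : ∀ {l k} ls → ¬ In l k → incident (l ∷ ls) k ≡ incident ls k
  incident-∷-out {l} {k} ls l∌k with In? l k
  ... | yes l∋k = ⊥-elim (l∌k l∋k)
  ... | no _    = refl

  incident-none : ∀ {ls k} → All (λ l → ¬ In l k) ls → incident ls k ≡ 0#
  incident-none []                        = refl
  incident-none {l ∷ ls} (l∌k ∷ none) = trans (incident-∷-out ls l∌k) (incident-none none)

  incident-++ : ∀ ls ls′ k → incident (ls ++ ls′) k ≃ incident ls k + incident ls′ k
  incident-++ []       ls′ k = Trun.sym (Trun.+-identityˡ _)
  incident-++ (l ∷ ls) ls′ k with In? l k
  ... | yes _ = Trun.trans (Trun.+-congˡ (incident-++ ls ls′ k)) (Trun.sym (Trun.+-assoc _ _ _))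
  ... | no _  = incident-++ ls ls′ k

  not-incident : ∀ {a c ls k} → All (Within a c) ls → (a ≤ k → k ≤ c → ⊥) → All (λ l → ¬ In l k) ls
  not-incident {k = k} w k∉ = All.map (λ wl l∋k → k∉ (proj₁ (wl k l∋k)) (proj₂ (wl k l∋k))) w

  monomial-++ : ∀ ls ls′ → monomial (ls ++ ls′) ≋ monomial ls * monomial ls′
  monomial-++ []       ls′ = Full.sym (Full.*-identityˡ _)
  monomial-++ (l ∷ ls) ls′ = Full.trans (Full.*-congˡ (monomial-++ ls ls′)) (Full.sym (Full.*-assoc _ _ _))

  kill-x : ∀ {l ls} → l L.∈ ls → monomial ls * ξ l ≃ 0#
  kill-x {l} {_ ∷ ls} (here refl) = begin
    pow (ξ l) (κ l) * monomial ls * ξ l   ≈⟨ Trun.*-comm _ _ ⟩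
    ξ l * (pow (ξ l) (κ l) * monomial ls) ≈⟨ Trun.*-assoc _ _ _ ⟨
    pow (ξ l) (suc (κ l)) * monomial ls   ≈⟨ Trun.*-congʳ (nilpotent l) ⟩
    0# * monomial ls                      ≈⟨ Trun.zeroˡ _ ⟩
    0#                                    ∎
    where open ≃-Reasoning
  kill-x {l} {l′ ∷ ls} (there l∈ls) = begin
    pow (ξ l′) (κ l′) * monomial ls * ξ l   ≈⟨ Trun.*-assoc _ _ _ ⟩
    pow (ξ l′) (κ l′) * (monomial ls * ξ l) ≈⟨ Trun.*-congˡ (kill-x l∈ls) ⟩
    pow (ξ l′) (κ l′) * 0#                  ≈⟨ Trun.zeroʳ _ ⟩
    0#                                      ∎
    where open ≃-Reasoning

  kill : ∀ ls k → monomial ls * incident ls k ≃ 0#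
  kill ls k = go ls (λ l∈ → l∈)
    where
    -- The monomial of the full list stays fixed while the sum shrinks to its tails.
    go : ∀ ls′ → (∀ {l} → l L.∈ ls′ → l L.∈ ls) → monomial ls * incident ls′ k ≃ 0#
    go []        _  = Trun.zeroʳ _
    go (l ∷ ls′) ⊆ with In? l k
    ... | no _  = go ls′ (λ l∈ → ⊆ (there l∈))
    ... | yes _ = Trun.trans (Trun.distribˡ _ _ _)
      (Trun.trans (Trun.+-cong (kill-x (⊆ (here refl))) (go ls′ (λ l∈ → ⊆ (there l∈)))) (Trun.+-identityˡ _))

  -- Next to the monomial of a subtree, only the part of a star outside that subtree counts.
  absorb : ∀ {y k h} ls → (y + incident ls k) * (monomial ls * h) ≃ y * (monomial ls * h)
  absorb {y} {k} {h} ls = begin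
    (y + incident ls k) * (monomial ls * h)                 ≈⟨ TrunL.absorb-id _ _ _ _ ⟩
    y * (monomial ls * h) + monomial ls * incident ls k * h ≈⟨ Trun.+-congˡ (Trun.*-congʳ (kill ls k)) ⟩
    y * (monomial ls * h) + 0# * h                          ≈⟨ Trun.+-congˡ (Trun.zeroˡ h) ⟩
    y * (monomial ls * h) + 0#                              ≈⟨ Trun.+-identityʳ _ ⟩
    y * (monomial ls * h)                                   ∎
    where open ≃-Reasoning

  module Spans (s : ℕ → Carrier) where

    ∏s : ℕ → ℕ → Carrier
    ∏s a zero    = 1#
    ∏s a (suc y) = s a * ∏s (suc a) y

    -- hd g a p is ∏s over a ≤ k < p with the first factor replaced by g.
    hdL : Carrier → ℕ → ℕ → Carrier
    hdL g a zero    = 1#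
    hdL g a (suc y) = g * ∏s (suc a) y

    -- The value 0 at length zero is the entry from a vertex to itself. `hdL` has 1 there instead,
    -- because the row it describes starts one vertex earlier and meets the empty walk.
    spanL : ℕ → ℕ → Carrier
    spanL a zero    = 0#
    spanL a (suc y) = ∏s (suc a) y

    hd : Carrier → ℕ → ℕ → Carrier
    hd g a p = hdL g a (p ∸ a)

    -- The product over a < k < p, but 0 if p ≤ a.
    span : ℕ → ℕ → Carrier
    span a p = spanL a (p ∸ a)

    hd-s : ∀ a y → hdL (s a) a y ≡ ∏s a y
    hd-s a zero    = refl
    hd-s a (suc y) = refl

    ∏s-split : ∀ a y z → ∏s a (y ℕ.+ z) ≃ ∏s a y * ∏s (y ℕ.+ a) z
    ∏s-split a zero    z = Trun.sym (Trun.*-identityˡ _)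
    ∏s-split a (suc y) z = Trun.trans (Trun.*-congˡ (∏s-split (suc a) y z))
      (Trun.trans (Trun.sym (Trun.*-assoc _ _ _))
        (Trun.*-congˡ (Trun.reflexive (cong (λ b → ∏s b z) (+-suc y a)))))

    span-split : ∀ {a b p} → a < b → b ≤ p → span a p ≃ span a b * hd (s b) b p
    span-split {a} {b} {p} a<b b≤p with m≤n⇒∃[o]m+o≡n a<b | m≤n⇒∃[o]m+o≡n b≤p
    ... | y , refl | z , refl
      rewrite ℕₚ.m+n∸m≡n (suc a ℕ.+ y) z | hd-s (suc a ℕ.+ y) z
            | trans (cong (_∸ a) (sym (+-suc a y))) (ℕₚ.m+n∸m≡n a (suc y))
            | trans (cong (_∸ a) (trans (cong (ℕ._+ z) (sym (+-suc a y))) (+-assoc a (suc y) z)))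
                    (ℕₚ.m+n∸m≡n a (suc y ℕ.+ z))
      = Trun.trans (∏s-split (suc a) y z)
          (Trun.*-congˡ (Trun.reflexive (cong (λ b → ∏s b z) (trans (+-suc y a) (cong suc (+-comm y a))))))

    hd-self : ∀ g a → hd g a a ≡ 1#
    hd-self g a = cong (hdL g a) (ℕₚ.n∸n≡0 a)

    span-self : ∀ a → span a a ≡ 0#
    span-self a = cong (spanL a) (ℕₚ.n∸n≡0 a)

    span-next : ∀ a → span a (suc a) ≡ 1#
    span-next a = cong (spanL a) (trans (ℕₚ.+-∸-assoc 1 (≤-refl {a})) (cong suc (ℕₚ.n∸n≡0 a)))

    hd-> : ∀ g {a p} → a < p → hd g a p ≡ g * span a p
    hd-> g {a} {p} a<p with m≤n⇒∃[o]m+o≡n a<p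
    ... | y , refl rewrite trans (cong (_∸ a) (sym (+-suc a y))) (ℕₚ.m+n∸m≡n a (suc y)) = refl

    hd-cong : ∀ {g g′} a p → g ≃ g′ → hd g a p ≃ hd g′ a p
    hd-cong a p g≃g′ with p ∸ a
    ... | zero  = Trun.refl
    ... | suc y = Trun.*-congʳ g≃g′

    -- Linearity in the first factor. It survives at p ≤ a because `hd` is 1 and `span` is 0 there.
    hd-+ : ∀ g h a p → hd (g + h) a p ≃ hd h a p + g * span a p
    hd-+ g h a p with p ∸ a
    ... | zero  = Trun.sym (Trun.trans (Trun.+-congˡ (Trun.zeroʳ g)) (Trun.+-identityʳ _))
    ... | suc y = TrunL.hd-+ g h _

    -- Crossing a closed subtree: the star at its right end b splits into the enclosing piece ξ, the
    -- part g₀ inside the subtree and the part g beyond it, and C kills g₀.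
    step : ∀ {a b p C g₀ g ξ} → a < b → b ≤ p → span a b ≃ C → C * g₀ ≃ 0# →
           s b ≃ ξ + (g₀ + g) → span a p ≃ C * hd (ξ + g) b p
    step {a} {b} {p} {C} {g₀} {g} {ξ} a<b b≤p closed killed s-b = begin
      span a p                      ≈⟨ span-split a<b b≤p ⟩
      span a b * hd (s b) b p       ≈⟨ Trun.*-cong closed (hd-cong b p s-b) ⟩
      C * hd (ξ + (g₀ + g)) b p     ≈⟨ drop (p ∸ b) ⟩
      C * hd (ξ + g) b p            ∎
      where
      open ≃-Reasoning
      drop : ∀ y → C * hdL (ξ + (g₀ + g)) b y ≃ C * hdL (ξ + g) b y
      drop zero    = Trun.refl
      drop (suc y) = begin
        C * ((ξ + (g₀ + g)) * ∏s (suc b) y)                    ≈⟨ TrunL.step-id _ _ _ _ _ ⟩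
        C * ((ξ + g) * ∏s (suc b) y) + C * g₀ * ∏s (suc b) y    ≈⟨ Trun.+-congˡ (Trun.*-congʳ killed) ⟩
        C * ((ξ + g) * ∏s (suc b) y) + 0# * ∏s (suc b) y        ≈⟨ Trun.+-congˡ (Trun.zeroˡ _) ⟩
        C * ((ξ + g) * ∏s (suc b) y) + 0#                       ≈⟨ Trun.+-identityʳ _ ⟩
        C * ((ξ + g) * ∏s (suc b) y)                            ∎

    -- Interior vertices only: at a and c pieces outside the subtree may contribute to `s` as well.
    Covers : ∀ {a c} → Tree a c → Set
    Covers {a} {c} t = ∀ {k} → a < k → k < c → s k ≃ incident (labels t) k

    suffix : ∀ {l k b c d} → Mids l k b c → Tree c d → List (Fin m)
    suffix ms u = mlabels ms ++ labels u

    -- The enclosing piece l has vertices at the joints of the remaining children, hence its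
    -- separate summand.
    CoversSuffix : ∀ {l k b c d} → Mids l k b c → Tree c d → Set
    CoversSuffix {l} {b = b} {d = d} ms u =
      ∀ {k} → b < k → k < d → s k ≃ incident (l ∷ []) k + incident (suffix ms u) k

    covers-first : ∀ {a b c d k l e w σ} {t : Tree a b} {ms : Mids l k b c} {σ′} {u : Tree c d} →
                   Covers (node l e w σ t ms σ′ u) → Covers t
    covers-first {l = l} {σ = σ} {t} {ms} {σ′} {u} H {k} a<k k<b = begin
      s k ≈⟨ H a<k (<-≤-trans k<b (<⇒≤ (suffix-< ms u))) ⟩
      incident (l ∷ labels t ++ suffix ms u) k ≡⟨ incident-∷-out _ (Side.between σ a<k k<b) ⟩
      incident (labels t ++ suffix ms u) k ≈⟨ incident-++ (labels t) _ k ⟩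
      incident (labels t) k + incident (suffix ms u) k
        ≡⟨ cong (incident (labels t) k +_) (incident-none (not-incident (suffix-within ms u) λ b≤k _ → <⇒≱ k<b b≤k)) ⟩
      incident (labels t) k + 0# ≈⟨ Trun.+-identityʳ _ ⟩
      incident (labels t) k ∎
      where open ≃-Reasoning

    covers-suffix : ∀ {a b c d k l e w σ} {t : Tree a b} {ms : Mids l k b c} {σ′} {u : Tree c d} →
                    Covers (node l e w σ t ms σ′ u) → CoversSuffix ms u
    covers-suffix {l = l} {t = t} {ms} {u = u} H {k} b<k k<d = begin
      s k ≈⟨ H (<-trans (tree-< t) b<k) k<d ⟩
      incident ((l ∷ []) ++ (labels t ++ suffix ms u)) k ≈⟨ incident-++ (l ∷ []) _ k ⟩
      incident (l ∷ []) k + incident (labels t ++ suffix ms u) k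
        ≈⟨ Trun.+-congˡ (Trun.trans (incident-++ (labels t) _ k) (Trun.+-congʳ (Trun.reflexive
             (incident-none (not-incident (labels-within t) λ _ k≤b → <⇒≱ b<k k≤b))))) ⟩
      incident (l ∷ []) k + (0# + incident (suffix ms u) k) ≈⟨ Trun.+-congˡ (Trun.+-identityˡ _) ⟩
      incident (l ∷ []) k + incident (suffix ms u) k ∎
      where open ≃-Reasoning

    covers-joint : ∀ {a b c d k l e w σ} {t : Tree a b} {ms : Mids l k b c} {σ′} {u : Tree c d} →
                   Covers (node l e w σ t ms σ′ u) →
                   s b ≃ ξ l + (incident (labels t) b + incident (suffix ms u) b)
    covers-joint {b = b} {σ = σ} {t} {ms} {u = u} H =
      Trun.trans (H (tree-< t) (suffix-< ms u))
        (Trun.trans (Trun.reflexive (incident-∷-in _ (Side.inʳ σ))) (Trun.+-congˡ (incident-++ (labels t) _ b)))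

    incident-single : ∀ {l k} → In l k → incident (l ∷ []) k ≃ ξ l
    incident-single l∋k = Trun.trans (Trun.reflexive (incident-∷-in [] l∋k)) (Trun.+-identityʳ _)

    module _ {l : Fin m} {a b c d k : ℕ} {σ : Side l a b} {t : Tree a b} {ms : Mids l k b c} {u : Tree c d} where

      suffix-cons : ∀ j → incident (suffix (cons σ t ms) u) j ≃ incident (labels t) j + incident (suffix ms u) j
      suffix-cons j = Trun.trans
        (Trun.reflexive (cong (λ ls → incident ls j) (Listₚ.++-assoc (labels t) (mlabels ms) (labels u))))
        (incident-++ (labels t) (suffix ms u) j)

      suffix-cons-< : ∀ {j} → j < b → incident (suffix (cons σ t ms) u) j ≃ incident (labels t) j
      suffix-cons-< {j} j<b = Trun.trans (suffix-cons j) (Trun.trans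
        (Trun.+-congˡ (Trun.reflexive (incident-none (not-incident (suffix-within ms u) λ b≤j _ → <⇒≱ j<b b≤j))))
        (Trun.+-identityʳ _))

      suffix-cons-> : ∀ {j} → b < j → incident (suffix (cons σ t ms) u) j ≃ incident (suffix ms u) j
      suffix-cons-> {j} b<j = Trun.trans (suffix-cons j) (Trun.trans
        (Trun.+-congʳ (Trun.reflexive (incident-none (not-incident (labels-within t) λ _ j≤b → <⇒≱ b<j j≤b))))
        (Trun.+-identityˡ _))

      mids-covers-first : CoversSuffix (cons σ t ms) u → Covers t
      mids-covers-first H {j} a<j j<b =
        Trun.trans (H a<j (<-≤-trans j<b (<⇒≤ (suffix-< ms u))))
          (Trun.trans (Trun.+-cong (Trun.reflexive (incident-∷-out [] (Side.between σ a<j j<b))) (suffix-cons-< j<b))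
            (Trun.+-identityˡ _))

      mids-covers-suffix : CoversSuffix (cons σ t ms) u → CoversSuffix ms u
      mids-covers-suffix H b<j j<d =
        Trun.trans (H (<-trans (tree-< t) b<j) j<d) (Trun.+-congˡ (suffix-cons-> b<j))

      mids-covers-joint : CoversSuffix (cons σ t ms) u →
                          s b ≃ ξ l + (incident (labels t) b + incident (suffix ms u) b)
      mids-covers-joint H = Trun.trans (H (tree-< t) (suffix-< ms u))
        (Trun.+-cong (incident-single (Side.inʳ σ)) (suffix-cons b))

      incident-root : incident (l ∷ labels t ++ suffix ms u) a ≃ ξ l + incident (labels t) a
      incident-root = Trun.trans (Trun.reflexive (incident-∷-in _ (Side.inˡ σ))) (Trun.+-congˡ
        (Trun.trans (incident-++ (labels t) _ a) (Trun.trans (Trun.+-congˡ (Trun.reflexive (incident-none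
          (not-incident (suffix-within ms u) λ b≤a _ → <⇒≱ (tree-< t) b≤a)))) (Trun.+-identityʳ _))))

    -- The effect of passing over all middle children: each is closed by its monomial, and ξ l is
    -- picked at its left end.
    midFactor : ∀ {l k b c} → Mids l k b c → Carrier
    midFactor []                    = 1#
    midFactor {l} (cons _ t ms) = ξ l * monomial (labels t) * midFactor ms

    last-covers : ∀ {l c d} {u : Tree c d} → Side l c d → CoversSuffix {l} [] u → Covers u
    last-covers σ H c<k k<d = Trun.trans (H c<k k<d)
      (Trun.trans (Trun.+-congʳ (Trun.reflexive (incident-∷-out [] (Side.between σ c<k k<d)))) (Trun.+-identityˡ _))

    mids-factor : ∀ {l k b c} (ms : Mids l k b c) → midFactor ms ≋ pow (ξ l) k * monomial (mlabels ms)
    mids-factor [] = Full.sym (Full.*-identityˡ _)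
    mids-factor {l} {suc k} (cons _ t ms) = begin
      ξ l * monomial (labels t) * midFactor ms
        ≈⟨ Full.*-congˡ (mids-factor ms) ⟩
      ξ l * monomial (labels t) * (pow (ξ l) k * monomial (mlabels ms))
        ≈⟨ FullL.interchange _ _ _ _ ⟩
      ξ l * pow (ξ l) k * (monomial (labels t) * monomial (mlabels ms))
        ≈⟨ Full.*-congˡ (monomial-++ (labels t) _) ⟨
      ξ l * pow (ξ l) k * monomial (labels t ++ mlabels ms) ∎
      where open ≈-Reasoning

    -- The k middle children supply k factors ξ l; one more completes the full power κ l.
    root-factor : ∀ {l k b c} → κ l ≡ suc k → (ms : Mids l k b c) →
                  ξ l * midFactor ms ≋ pow (ξ l) (κ l) * monomial (mlabels ms)
    root-factor {l} κl ms = Full.trans (Full.*-congˡ (mids-factor ms))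
      (Full.trans (Full.sym (Full.*-assoc _ _ _)) (Full.*-congʳ (Full.reflexive (cong (pow (ξ l)) (sym κl)))))

    root-factor-nilpotent : ∀ {l k b c} → κ l ≡ suc k → (ms : Mids l k b c) → ξ l * (ξ l * midFactor ms) ≃ 0#
    root-factor-nilpotent {l} κl ms = begin
      ξ l * (ξ l * midFactor ms)                         ≈⟨ Trun.*-congˡ (≈⇒≃ (root-factor κl ms)) ⟩
      ξ l * (pow (ξ l) (κ l) * monomial (mlabels ms))    ≈⟨ Trun.*-assoc _ _ _ ⟨
      pow (ξ l) (suc (κ l)) * monomial (mlabels ms)      ≈⟨ Trun.*-congʳ (nilpotent l) ⟩
      0# * monomial (mlabels ms)                         ≈⟨ Trun.zeroˡ _ ⟩
      0#                                                 ∎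
      where open ≃-Reasoning

    private
      -- At the left end of the child its own pieces are killed by its monomial and ξ l remains; at
      -- the right end `step` hands over to the remaining children.
      mids-hd : ∀ {l k a b c d p} {σ : Side l a b} {t : Tree a b} {ms : Mids l k b c} {u : Tree c d} {h} →
                CoversSuffix (cons σ t ms) u → span a b ≃ monomial (labels t) →
                b ≤ p → hd (ξ l + incident (suffix ms u) b) b p ≃ h →
                hd (ξ l + incident (suffix (cons σ t ms) u) a) a p ≃ ξ l * monomial (labels t) * h
      mids-hd {l} {a = a} {b} {p = p} {σ} {t} {ms} {u} {h} H closed b≤p hd≃h = begin
        hd (ξ l + incident (suffix (cons σ t ms) u) a) a p
          ≡⟨ hd-> _ (<-≤-trans (tree-< t) b≤p) ⟩
        (ξ l + incident (suffix (cons σ t ms) u) a) * span a p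
          ≈⟨ Trun.*-cong (Trun.+-congˡ (suffix-cons-< {σ = σ} {t} {ms} {u} (tree-< t)))
               (Trun.trans (step (tree-< t) b≤p closed (kill (labels t) b) (mids-covers-joint {σ = σ} {t} {ms} {u} H))
                           (Trun.*-congˡ hd≃h)) ⟩
        (ξ l + incident (labels t) a) * (monomial (labels t) * h)
          ≈⟨ absorb (labels t) ⟩
        ξ l * (monomial (labels t) * h)
          ≈⟨ Trun.*-assoc _ _ _ ⟨
        ξ l * monomial (labels t) * h ∎
        where open ≃-Reasoning

    hd-closed : ∀ {l c d} (t : Tree c d) → span c d ≃ monomial (labels t) →
                hd (ξ l + incident (labels t) c) c d ≃ ξ l * monomial (labels t)
    hd-closed {l} {c} {d} t closed = begin
      hd (ξ l + incident (labels t) c) c d        ≡⟨ hd-> _ (tree-< t) ⟩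
      (ξ l + incident (labels t) c) * span c d    ≈⟨ Trun.*-congˡ closed ⟩
      (ξ l + incident (labels t) c) * monomial (labels t) ≈⟨ TrunL.hd-+ _ _ _ ⟩
      incident (labels t) c * monomial (labels t) + ξ l * monomial (labels t)
        ≈⟨ Trun.+-congʳ (Trun.trans (Trun.*-comm _ _) (kill (labels t) c)) ⟩
      0# + ξ l * monomial (labels t) ≈⟨ Trun.+-identityˡ _ ⟩
      ξ l * monomial (labels t) ∎
      where open ≃-Reasoning

    -- The root piece has κ l vertices strictly between a and d, the joints of its children. At each
    -- joint every other piece is killed by the monomial of a neighbouring subtree, so each joint
    -- contributes one factor ξ l.
    span-closed : ∀ {a c} (t : Tree a c) → Covers t → span a c ≃ monomial (labels t)
    mids-closed : ∀ {l k b c d} (ms : Mids l k b c) → Side l c d → (u : Tree c d) → CoversSuffix ms u →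
                  hd (ξ l + incident (suffix ms u) b) b d ≃ midFactor ms * (ξ l * monomial (labels u))

    span-closed {a} leaf H = Trun.reflexive (span-next a)
    span-closed {a} {d} T@(node {b = b} l κl w σ t ms σ′ u) H = begin
      span a d
        ≈⟨ step (tree-< t) (<⇒≤ (suffix-< ms u)) (span-closed t (covers-first {e = κl} {w} {σ} {t} {ms} {σ′} {u} H))
             (kill (labels t) b) (covers-joint {e = κl} {w} {σ} {t} {ms} {σ′} {u} H) ⟩
      monomial (labels t) * hd (ξ l + incident (suffix ms u) b) b d
        ≈⟨ Trun.*-congˡ (mids-closed ms σ′ u (covers-suffix {e = κl} {w} {σ} {t} {ms} {σ′} {u} H)) ⟩
      monomial (labels t) * (midFactor ms * (ξ l * monomial (labels u)))
        ≈⟨ TrunL.closed-node _ _ _ _ ⟩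
      ξ l * midFactor ms * (monomial (labels t) * monomial (labels u))
        ≈⟨ Trun.*-congʳ (≈⇒≃ (root-factor κl ms)) ⟩
      pow (ξ l) (κ l) * monomial (mlabels ms) * (monomial (labels t) * monomial (labels u))
        ≈⟨ TrunL.regroup _ _ _ _ ⟩
      pow (ξ l) (κ l) * (monomial (labels t) * (monomial (mlabels ms) * monomial (labels u)))
        ≈⟨ ≈⇒≃ (Full.*-congˡ (Full.trans (monomial-++ (labels t) _) (Full.*-congˡ (monomial-++ (mlabels ms) _)))) ⟨
      monomial (labels T) ∎
      where open ≃-Reasoning

    mids-closed [] σ′ u H = Trun.trans (hd-closed u (span-closed u (last-covers {u = u} σ′ H))) (Trun.sym (Trun.*-identityˡ _))
    mids-closed (cons σ t ms) σ′ u H = Trun.trans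
      (mids-hd {σ = σ} {t} {ms} {u} H (span-closed t (mids-covers-first {σ = σ} {t} {ms} {u} H))
        (<⇒≤ (suffix-< ms u))
        (mids-closed ms σ′ u (mids-covers-suffix {σ = σ} {t} {ms} {u} H)))
      (Trun.sym (Trun.*-assoc _ _ _))

    -- For a path π from the root to the leaf (p , p + 1), the polynomials
    -- E π r and F π r without exponents beyond κ are equal to span a (p + r)
    -- and hd g a (p + r), where g sums the pieces of the tree at a.
    E F : ∀ {a c p} {t : Tree a c} → Path t p → Bool → Carrier
    H   : ∀ {l k a c p} {ms : Mids l k a c} → MPath ms p → Bool → Carrier

    E here r              = if r then 1# else 0#
    E (first π) r         = E π r
    E (mid {t = t} π) r   = monomial (labels t) * H π r
    E (last {l = l} {t = t} {ms} π) r = monomial (labels t) * (midFactor ms * (F π r + ξ l * E π r))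

    F here r              = if r then 0# else 1#
    F (first {l = l} π) r = F π r + ξ l * E π r
    F (mid {l = l} {t = t} π) r = ξ l * (monomial (labels t) * H π r)
    -- The product of ξ l with the corresponding `E` has a further term, with ξ l twice besides
    -- `midFactor ms`. It is zero modulo the relations and is left out because its exponent of ξ l
    -- exceeds κ l.
    F (last {l = l} {t = t} {ms} π) r = monomial (labels t) * (midFactor ms * (ξ l * F π r))

    H {l} (here π) r          = F π r + ξ l * E π r
    H {l} (there {t = t} π) r = ξ l * monomial (labels t) * H π r

    -- The Boolean selects the column of the minor: `false` for the start of the edge at p, `true`
    -- for its end.
    end : ℕ → Bool → ℕ
    end p r = if r then suc p else p

    end-≥ : ∀ {a p} r → a ≤ p → a ≤ end p r
    end-≥ false a≤p = a≤p
    end-≥ true  a≤p = m≤n⇒m≤1+n a≤p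

    private
      -- The monomial of the first child kills its pieces at a, so the second component is ξ l times
      -- the first. This proportionality makes a middle exit degenerate.
      root-hd : ∀ {a b c d k l e w σ} {t : Tree a b} {ms : Mids l k b c} {σ′} {u : Tree c d} {p h} →
                let T = node l e w σ t ms σ′ u in Covers T → b ≤ p →
                hd (ξ l + incident (suffix ms u) b) b p ≃ h →
                span a p ≃ monomial (labels t) * h × hd (incident (labels T) a) a p ≃ ξ l * (monomial (labels t) * h)
      root-hd {a} {b} {l = l} {e} {w} {σ} {t} {ms} {σ′} {u} {p} {h} cov b≤p hd≃h = spanned , (begin
        hd (incident (labels (node l e w σ t ms σ′ u)) a) a p
          ≡⟨ hd-> _ (<-≤-trans (tree-< t) b≤p) ⟩
        incident (labels (node l e w σ t ms σ′ u)) a * span a p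
          ≈⟨ Trun.*-cong (incident-root {σ = σ} {t} {ms} {u}) spanned ⟩
        (ξ l + incident (labels t) a) * (monomial (labels t) * h)
          ≈⟨ absorb (labels t) ⟩
        ξ l * (monomial (labels t) * h) ∎)
        where
        open ≃-Reasoning
        spanned : span a p ≃ monomial (labels t) * h
        spanned = Trun.trans
          (step (tree-< t) b≤p (span-closed t (covers-first {e = e} {w} {σ} {t} {ms} {σ′} {u} cov))
            (kill (labels t) b) (covers-joint {e = e} {w} {σ} {t} {ms} {σ′} {u} cov))
          (Trun.*-congˡ hd≃h)

    span-path : ∀ {a c p} {t : Tree a c} (π : Path t p) r → Covers t →
                span a (end p r) ≃ E π r × hd (incident (labels t) a) a (end p r) ≃ F π r
    mids-path : ∀ {l k b c d p} {ms : Mids l k b c} {u : Tree c d} (π : MPath ms p) r → CoversSuffix ms u →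
                hd (ξ l + incident (suffix ms u) b) b (end p r) ≃ H π r
    last-path : ∀ {l k b c d p} (ms : Mids l k b c) {u : Tree c d} (π : Path u p) r → Side l c d → CoversSuffix ms u →
                hd (ξ l + incident (suffix ms u) b) b (end p r) ≃ midFactor ms * (F π r + ξ l * E π r)

    span-path {a} here false cov = Trun.reflexive (span-self a) , Trun.reflexive (hd-self _ a)
    -- A leaf has no pieces, so the first factor is an empty sum and the product is 0.
    span-path {a} here true  cov = Trun.reflexive (span-next a) , Trun.trans (Trun.reflexive (hd-> _ (n<1+n a))) (Trun.zeroˡ _)
    span-path {a} {p = p} (first {l = l} {e} {w} {σ} {t} {ms} {σ′} {u} π) r cov
      with span-path π r (covers-first {e = e} {w} {σ} {t} {ms} {σ′} {u} cov)
    ... | hE , hF = hE , (begin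
      hd (incident (l ∷ labels t ++ suffix ms u) a) a (end p r)
        ≈⟨ hd-cong a (end p r) (incident-root {σ = σ} {t} {ms} {u}) ⟩
      hd (ξ l + incident (labels t) a) a (end p r)
        ≈⟨ hd-+ (ξ l) _ a (end p r) ⟩
      hd (incident (labels t) a) a (end p r) + ξ l * span a (end p r)
        ≈⟨ Trun.+-cong hF (Trun.*-congˡ hE) ⟩
      F π r + ξ l * E π r ∎)
      where open ≃-Reasoning
    span-path (mid {e = e} {w} {σ} {t} {ms} {σ′} {u} π) r cov =
      root-hd {e = e} {w} {σ} {t} {ms} {σ′} {u} cov (end-≥ r (proj₁ (mpath-range π)))
        (mids-path {u = u} π r (covers-suffix {e = e} {w} {σ} {t} {ms} {σ′} {u} cov))
    span-path (last {l = l} {e} {w} {σ} {t} {ms} {σ′} {u} π) r cov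
      with root-hd {e = e} {w} {σ} {t} {ms} {σ′} {u} cov (end-≥ r (≤-trans (mids-≤ ms) (proj₁ (path-range π))))
             (last-path ms π r σ′ (covers-suffix {e = e} {w} {σ} {t} {ms} {σ′} {u} cov))
    ... | hE , hF = hE , Trun.trans hF (begin
      ξ l * (monomial (labels t) * (midFactor ms * (F π r + ξ l * E π r)))
        ≈⟨ TrunL.last-F _ _ _ _ _ ⟩
      monomial (labels t) * (midFactor ms * (ξ l * F π r)) + ξ l * (ξ l * midFactor ms) * (monomial (labels t) * E π r)
        ≈⟨ Trun.+-congˡ (Trun.trans (Trun.*-congʳ (root-factor-nilpotent e ms)) (Trun.zeroˡ _)) ⟩
      monomial (labels t) * (midFactor ms * (ξ l * F π r)) + 0#
        ≈⟨ Trun.+-identityʳ _ ⟩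
      monomial (labels t) * (midFactor ms * (ξ l * F π r)) ∎)
      where open ≃-Reasoning

    mids-path {l} {b = b} {p = p} {u = u} (here {s = σ} {t} {ms} π) r cov = begin
      hd (ξ l + incident (suffix (cons σ t ms) u) b) b (end p r)
        ≈⟨ hd-cong b (end p r) (Trun.+-congˡ (suffix-cons-< {σ = σ} {t} {ms} {u} (tree-< t))) ⟩
      hd (ξ l + incident (labels t) b) b (end p r)
        ≈⟨ hd-+ (ξ l) _ b (end p r) ⟩
      hd (incident (labels t) b) b (end p r) + ξ l * span b (end p r)
        ≈⟨ (let (hE , hF) = span-path π r (mids-covers-first {σ = σ} {t} {ms} {u} cov) in Trun.+-cong hF (Trun.*-congˡ hE)) ⟩
      F π r + ξ l * E π r ∎
      where open ≃-Reasoning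
    mids-path {u = u} (there {s = σ} {t} {ms} π) r cov =
      mids-hd {σ = σ} {t} {ms} {u} cov (span-closed t (mids-covers-first {σ = σ} {t} {ms} {u} cov))
        (end-≥ r (proj₁ (mpath-range π)))
        (mids-path {u = u} π r (mids-covers-suffix {σ = σ} {t} {ms} {u} cov))

    last-path {l} {b = b} {p = p} [] {u} π r σ′ cov = begin
      hd (ξ l + incident (labels u) b) b (end p r)
        ≈⟨ hd-+ (ξ l) _ b (end p r) ⟩
      hd (incident (labels u) b) b (end p r) + ξ l * span b (end p r)
        ≈⟨ (let (hE , hF) = span-path π r (last-covers {u = u} σ′ cov) in Trun.+-cong hF (Trun.*-congˡ hE)) ⟩
      F π r + ξ l * E π r
        ≈⟨ Trun.*-identityˡ _ ⟨
      1# * (F π r + ξ l * E π r) ∎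
      where open ≃-Reasoning
    last-path (cons σ t ms) {u} π r σ′ cov = Trun.trans
      (mids-hd {σ = σ} {t} {ms} {u} cov (span-closed t (mids-covers-first {σ = σ} {t} {ms} {u} cov))
        (end-≥ r (≤-trans (mids-≤ ms) (proj₁ (path-range π))))
        (last-path ms π r σ′ (mids-covers-suffix {σ = σ} {t} {ms} {u} cov)))
      (Trun.sym (Trun.*-assoc _ _ _))

    square : Carrier → Carrier
    square p = p * p

    -- A last side multiplies by the square of ξ l * C * `midFactor`. Since ξ l * `midFactor`
    -- carries the full power of ξ l, this is the square of the monomial of the root piece with its
    -- first and middle subtrees, just what `zigs` adds.
    det-ends : ∀ {a c p} {t : Tree a c} {π : Path t p} (e : Ends π) →
               E π true * F π false ≋ square (monomial (zigs e)) + E π false * F π true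
    det-ends here = Full.trans (Full.*-identityˡ _)
      (Full.sym (Full.trans (Full.+-congˡ (Full.zeroˡ _)) (Full.trans (Full.+-identityʳ _) (Full.*-identityˡ _))))
    det-ends (first {π = π} e) = FullL.first-det _ _ _ _ _ (det-ends e)
    det-ends (last {l = l} {e = κl} {t = t} {ms} {π = π} e) =
      Full.trans (FullL.last-det _ _ _ _ _ _ _ (det-ends e)) (Full.+-congʳ (begin
        square (ξ l * monomial (labels t) * midFactor ms) * square (monomial (zigs e))
          ≈⟨ FullL.interchange _ _ _ _ ⟩
        square (ξ l * monomial (labels t) * midFactor ms * monomial (zigs e))
          ≈⟨ Full.*-cong same same ⟩
        square (monomial ((l ∷ labels t ++ mlabels ms) ++ zigs e)) ∎))
      where
      open ≈-Reasoning
      same : ξ l * monomial (labels t) * midFactor ms * monomial (zigs e)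
             ≋ monomial ((l ∷ labels t ++ mlabels ms) ++ zigs e)
      same = Full.sym (Full.trans (monomial-++ (l ∷ labels t ++ mlabels ms) (zigs e)) (Full.*-congʳ (begin
        pow (ξ l) (κ l) * monomial (labels t ++ mlabels ms)
          ≈⟨ Full.*-congˡ (monomial-++ (labels t) (mlabels ms)) ⟩
        pow (ξ l) (κ l) * (monomial (labels t) * monomial (mlabels ms))
          ≈⟨ FullL.swap-head _ _ _ ⟩
        monomial (labels t) * (pow (ξ l) (κ l) * monomial (mlabels ms))
          ≈⟨ Full.*-congˡ (root-factor κl ms) ⟨
        monomial (labels t) * (ξ l * midFactor ms)
          ≈⟨ FullL.swap-head _ _ _ ⟩
        ξ l * (monomial (labels t) * midFactor ms)
          ≈⟨ Full.*-assoc _ _ _ ⟨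
        ξ l * monomial (labels t) * midFactor ms ∎)))

    -- A middle side gives 0 whatever lies below it, and the steps above it only scale this 0.
    det-mid : ∀ {a c p} {t : Tree a c} (π : Path t p) → ¬ Ends π →
              E π true * F π false ≋ 0# + E π false * F π true
    det-mid here      ¬e = ⊥-elim (¬e here)
    det-mid (first π) ¬e = FullL.first-det _ _ _ _ _ (det-mid π λ e → ¬e (first e))
    det-mid (mid π)   ¬e = FullL.mid-det _ _ _
    det-mid (last π)  ¬e = Full.trans (FullL.last-det _ _ _ _ _ _ _ (det-mid π λ e → ¬e (last e)))
      (Full.+-congʳ (Full.zeroʳ _))

  exponents : List (Fin m) → Fin m → ℕ
  exponents []       l′ = 0
  exponents (l ∷ ls) l′ = κ l ℕ.* unit l l′ ℕ.+ exponents ls l′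

  exponents-++ : ∀ ls ls′ l → exponents (ls ++ ls′) l ≡ exponents ls l ℕ.+ exponents ls′ l
  exponents-++ []        ls′ l = refl
  exponents-++ (l′ ∷ ls) ls′ l =
    trans (cong (κ l′ ℕ.* unit l′ l ℕ.+_) (exponents-++ ls ls′ l)) (sym (+-assoc (κ l′ ℕ.* unit l′ l) _ _))

  exponents-∉ : ∀ {ls l} → All (l ≢_) ls → exponents ls l ≡ 0
  exponents-∉ []                        = refl
  exponents-∉ {l′ ∷ ls} (l≢l′ ∷ l≢) =
    cong₂ ℕ._+_ (trans (cong (κ l′ ℕ.*_) (unit-≢ (λ l′≡l → l≢l′ (sym l′≡l)))) (ℕₚ.*-zeroʳ (κ l′))) (exponents-∉ l≢)

  exponents-unique : ∀ {ls} → Unique ls → ∀ l → exponents ls l ≤ κ l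
  exponents-unique []                  l = z≤n
  exponents-unique {l′ ∷ ls} (l′∉ ∷ !) l with l′ ≟ l
  ... | yes refl = ≤-reflexive (trans (cong₂ ℕ._+_ (ℕₚ.*-identityʳ (κ l)) (exponents-∉ l′∉)) (+-identityʳ (κ l)))
  ... | no _     = subst (λ z → z ℕ.+ exponents ls l ≤ κ l) (sym (ℕₚ.*-zeroʳ (κ l′))) (exponents-unique ! l)

  bounded-pow : ∀ l e → Bounded (λ l′ → e ℕ.* unit l l′) (pow (ξ l) e)
  bounded-pow l zero    = bounded-1
  bounded-pow l (suc e) = bounded-* (bounded-x l) (bounded-pow l e)

  bounded-monomial : ∀ ls → Bounded (exponents ls) (monomial ls)
  bounded-monomial []       = bounded-1
  bounded-monomial (l ∷ ls) = bounded-* (bounded-pow l (κ l)) (bounded-monomial ls)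

  module Bounds (s : ℕ → Carrier) where
    open Spans s

    bounded-node : ∀ {a b c d k} (l : Fin m) → κ l ≡ suc k → (t : Tree a b) (ms : Mids l k b c) (u : Tree c d) {p : Carrier} →
      let node-exponents : Fin m → ℕ
          node-exponents l′ = suc k ℕ.* unit l l′ ℕ.+ (exponents (labels t) l′ ℕ.+ (exponents (mlabels ms) l′ ℕ.+ exponents (labels u) l′)) in
      Bounded node-exponents p → Bounded (exponents (l ∷ labels t ++ suffix ms u)) p
    bounded-node {k = k} l κl t ms u = bounded-≤ λ l′ → ≤-reflexive (cong₂ ℕ._+_
      (cong (ℕ._* unit l l′) (sym κl))
      (trans (cong (exponents (labels t) l′ ℕ.+_) (sym (exponents-++ (mlabels ms) (labels u) l′)))
             (sym (exponents-++ (labels t) _ l′))))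

    private
      head-arith : ∀ u k A R → u ℕ.+ A ℕ.+ (k ℕ.* u ℕ.+ R) ≡ suc k ℕ.* u ℕ.+ (A ℕ.+ R)
      head-arith = ℕ-Ring.solve-∀

      node-arith : ∀ u k A M B → A ℕ.+ ((k ℕ.* u ℕ.+ M) ℕ.+ (u ℕ.+ B)) ≡ suc k ℕ.* u ℕ.+ (A ℕ.+ (M ℕ.+ B))
      node-arith = ℕ-Ring.solve-∀

      slack : ∀ {X Y} Z → X ℕ.+ Z ≡ Y → X ≤ Y
      slack {X} Z eq = ≤-trans (m≤m+n X Z) (≤-reflexive eq)

    bounded-mids : ∀ {l k b c} (ms : Mids l k b c) →
                   Bounded (λ l′ → k ℕ.* unit l l′ ℕ.+ exponents (mlabels ms) l′) (midFactor ms)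
    bounded-mids [] = bounded-1
    bounded-mids {l} {suc k} (cons _ t ms) =
      bounded-≤ (λ l′ → ≤-reflexive (trans
          (head-arith (unit l l′) k (exponents (labels t) l′) (exponents (mlabels ms) l′))
          (cong (suc k ℕ.* unit l l′ ℕ.+_) (sym (exponents-++ (labels t) _ l′)))))
        (bounded-* (bounded-* (bounded-x l) (bounded-monomial (labels t))) (bounded-mids ms))

    -- The allowance for the root piece is κ l = k + 1. Passing the middle children, or entering one
    -- of them, spends at most k factors ξ l, and at most one more is picked, at the left end of the
    -- first child or of the last one.
    bounded-E : ∀ {a c p} {t : Tree a c} (π : Path t p) r → Bounded (exponents (labels t)) (E π r)
    bounded-F : ∀ {a c p} {t : Tree a c} (π : Path t p) r → Bounded (exponents (labels t)) (F π r)
    bounded-H : ∀ {l k a c p} {ms : Mids l k a c} (π : MPath ms p) r →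
                Bounded (λ l′ → k ℕ.* unit l l′ ℕ.+ exponents (mlabels ms) l′) (H π r)

    bounded-E here false = bounded-0
    bounded-E here true  = bounded-1
    bounded-E (first {k = k} {l = l} {e} {t = t} {ms} {u = u} π) r = bounded-node l e t ms u (bounded-≤
      (λ l′ → slack _ (arith (exponents (labels t) l′) (suc k ℕ.* unit l l′) (exponents (mlabels ms) l′ ℕ.+ exponents (labels u) l′)))
      (bounded-E π r))
      where
      arith : ∀ A K R → A ℕ.+ (K ℕ.+ R) ≡ K ℕ.+ (A ℕ.+ R)
      arith = ℕ-Ring.solve-∀
    bounded-E (mid {k = k} {l = l} {e} {t = t} {ms} {u = u} π) r = bounded-node l e t ms u (bounded-≤
      (λ l′ → slack _ (arith (unit l l′) k (exponents (labels t) l′) (exponents (mlabels ms) l′) (exponents (labels u) l′)))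
      (bounded-* (bounded-monomial (labels t)) (bounded-H π r)))
      where
      arith : ∀ u k A M B → A ℕ.+ (k ℕ.* u ℕ.+ M) ℕ.+ (u ℕ.+ B) ≡ suc k ℕ.* u ℕ.+ (A ℕ.+ (M ℕ.+ B))
      arith = ℕ-Ring.solve-∀
    bounded-E (last {k = k} {l = l} {e} {t = t} {ms} {u = u} π) r = bounded-node l e t ms u (bounded-≤
      (λ l′ → ≤-reflexive (node-arith (unit l l′) k (exponents (labels t) l′) (exponents (mlabels ms) l′) (exponents (labels u) l′)))
      (bounded-* (bounded-monomial (labels t)) (bounded-* (bounded-mids ms)
        (bounded-+ (bounded-≤ (λ l′ → m≤n+m _ (unit l l′)) (bounded-F π r))
                   (bounded-* (bounded-x l) (bounded-E π r))))))

    bounded-F here false = bounded-1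
    bounded-F here true  = bounded-0
    bounded-F (first {k = k} {l = l} {e} {t = t} {ms} {u = u} π) r = bounded-node l e t ms u (bounded-≤
      (λ l′ → slack _ (head-arith (unit l l′) k (exponents (labels t) l′) (exponents (mlabels ms) l′ ℕ.+ exponents (labels u) l′)))
      (bounded-+ (bounded-≤ (λ l′ → m≤n+m _ (unit l l′)) (bounded-F π r))
                 (bounded-* (bounded-x l) (bounded-E π r))))
    bounded-F (mid {k = k} {l = l} {e} {t = t} {ms} {u = u} π) r = bounded-node l e t ms u (bounded-≤
      (λ l′ → slack _ (arith (unit l l′) k (exponents (labels t) l′) (exponents (mlabels ms) l′) (exponents (labels u) l′)))
      (bounded-* (bounded-x l) (bounded-* (bounded-monomial (labels t)) (bounded-H π r))))
      where
      arith : ∀ u k A M B → u ℕ.+ (A ℕ.+ (k ℕ.* u ℕ.+ M)) ℕ.+ B ≡ suc k ℕ.* u ℕ.+ (A ℕ.+ (M ℕ.+ B))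
      arith = ℕ-Ring.solve-∀
    bounded-F (last {k = k} {l = l} {e} {t = t} {ms} {u = u} π) r = bounded-node l e t ms u (bounded-≤
      (λ l′ → ≤-reflexive (node-arith (unit l l′) k (exponents (labels t) l′) (exponents (mlabels ms) l′) (exponents (labels u) l′)))
      (bounded-* (bounded-monomial (labels t)) (bounded-* (bounded-mids ms) (bounded-* (bounded-x l) (bounded-F π r)))))

    bounded-H {l} {suc k} (here {t = t} {ms} π) r = bounded-≤
      (λ l′ → slack _ (trans (head-arith (unit l l′) k (exponents (labels t) l′) (exponents (mlabels ms) l′))
        (cong (suc k ℕ.* unit l l′ ℕ.+_) (sym (exponents-++ (labels t) _ l′)))))
      (bounded-+ (bounded-≤ (λ l′ → m≤n+m _ (unit l l′)) (bounded-F π r))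
                 (bounded-* (bounded-x l) (bounded-E π r)))
    bounded-H {l} {suc k} (there {t = t} {ms} π) r = bounded-≤
      (λ l′ → ≤-reflexive (trans (head-arith (unit l l′) k (exponents (labels t) l′) (exponents (mlabels ms) l′))
        (cong (suc k ℕ.* unit l l′ ℕ.+_) (sym (exponents-++ (labels t) _ l′)))))
      (bounded-* (bounded-* (bounded-x l) (bounded-monomial (labels t))) (bounded-H π r))

-- Monic monomials and the polynomial instance

module _ {k : ℕ} where

  -- The exponents are given as a function too, since single exponents decide whether a monomial
  -- vanishes modulo the relations. Monic monomials are also nonzero, which serves the nonvanishing
  -- of the minors.
  record Monic (p : Poly k) (e : Fin k → ℕ) : Set where
    constructor monic
    field
      exponent    : Vec ℕ k
      isMonic     : p ≡ (1ℤ , exponent) ∷ []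
      exponent-at : ∀ i → Vec.lookup exponent i ≡ e i

  monic-1 : Monic 1ᴾ (λ _ → 0)
  monic-1 = monic _ refl (λ i → Vecₚ.lookup-replicate i 0)

  monic-var : ∀ i → Monic (var i) (unit i)
  monic-var i = monic _ refl (λ j → Vecₚ.lookup∘tabulate (unit i) j)

  monic-⊠ : ∀ {p r e f} → Monic p e → Monic r f → Monic (p ⊠ r) (λ i → e i ℕ.+ f i)
  monic-⊠ (monic μ refl hμ) (monic ν refl hν) = monic (μ +ᵐ ν) refl
    λ i → trans (Vecₚ.lookup-zipWith ℕ._+_ i μ ν) (cong₂ ℕ._+_ (hμ i) (hν i))

  monic-^ : ∀ {p e} → Monic p e → ∀ j → Monic (p ^ᴾ j) (λ i → j ℕ.* e i)
  monic-^ h zero    = monic-1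
  monic-^ h (suc j) = monic-⊠ h (monic-^ h j)

  monic-∏ : ∀ {A : Set} (f : A → Poly k) (e : A → Fin k → ℕ) → (∀ a → Monic (f a) (e a)) → ∀ as →
            ∃ (Monic (∏ (map f as)))
  monic-∏ f e h []       = _ , monic-1
  monic-∏ f e h (a ∷ as) = _ , monic-⊠ (h a) (proj₂ (monic-∏ f e h as))

  monic-≉0 : ∀ {p e} → Monic p e → ¬ (p ≈ 0ᴾ)
  monic-≉0 (monic μ refl _) p≈0 with p≈0 μ
  ... | eq rewrite dec-true (Vecₚ.≡-dec ℕₚ._≟_ μ μ) refl with eq
  ... | ()

module PolyAlgebra (m n : ℕ) (κ : Fin m → ℕ) where

  -- Only the x are truncated; the exponents of the q stay free.
  Low : Vec ℕ (m ℕ.+ n) → Set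
  Low μ = ∀ l → Vec.lookup μ (l ↑ˡ n) ≤ κ l

  low? : ∀ μ → Dec (Low μ)
  low? μ = Finₚ.all? λ l → Vec.lookup μ (l ↑ˡ n) ℕ.≤? κ l

  low-divisor : ∀ μ ν → Low (μ +ᵐ ν) → Low μ
  low-divisor μ ν low l = ≤-trans (m≤m+n _ _)
    (subst (_≤ κ l) (Vecₚ.lookup-zipWith ℕ._+_ (l ↑ˡ n) μ ν) (low l))

  module Low = Truncated Low low-divisor
  module All′ = Truncated {m ℕ.+ n} (λ _ → ⊤) (λ _ _ _ → tt)

  Bounded : (Fin m → ℕ) → Poly (m ℕ.+ n) → Set
  Bounded β = All λ (_ , μ) → ∀ l → Vec.lookup μ (l ↑ˡ n) ≤ β l

  monic-bounded : ∀ {β p e} → Monic p e → (∀ l → e (l ↑ˡ n) ≤ β l) → Bounded β p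
  monic-bounded (monic μ refl hμ) e≤β = (λ l → subst (_≤ _) (sym (hμ (l ↑ˡ n))) (e≤β l)) ∷ []

  bounded-⊠ : ∀ {β γ p r} → Bounded β p → Bounded γ r → Bounded (λ l → β l ℕ.+ γ l) (p ⊠ r)
  bounded-⊠ []       hr = []
  bounded-⊠ {β} {γ} {(a , μ) ∷ p} {r} (hμ ∷ hp) hr = Allₚ.++⁺ (scaled hr) (bounded-⊠ hp hr)
    where
    scaled : ∀ {r} → Bounded γ r → Bounded (λ l → β l ℕ.+ γ l) (map (λ (b , ν) → a ℤ.* b , μ +ᵐ ν) r)
    scaled []        = []
    scaled {(b , ν) ∷ _} (hν ∷ hr) =
      (λ l → subst (_≤ _) (sym (Vecₚ.lookup-zipWith ℕ._+_ (l ↑ˡ n) μ ν)) (ℕₚ.+-mono-≤ (hμ l) (hν l))) ∷ scaled hr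

  unit-↑ˡ : ∀ (l l′ : Fin m) → unit (l ↑ˡ n) (l′ ↑ˡ n) ≡ unit l l′
  unit-↑ˡ l l′ with l ≟ l′
  ... | yes refl = unit-refl (l ↑ˡ n)
  ... | no l≢l′ = unit-≢ (l≢l′ ∘ Finₚ.↑ˡ-injective n l l′)

  unit-↑ʳ : ∀ (i : Fin n) (l : Fin m) → unit (m ↑ʳ i) (l ↑ˡ n) ≡ 0
  unit-↑ʳ i l = unit-≢ λ eq → case-impossible (trans (sym (Finₚ.splitAt-↑ʳ m n i)) (trans (cong (splitAt m) eq) (Finₚ.splitAt-↑ˡ m l n)))
    where
    case-impossible : inj₂ i ≢ inj₁ l
    case-impossible ()

  monic-high : ∀ {p e} l → Monic p e → κ l < e (l ↑ˡ n) → p Low.≃ 0ᴾ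
  monic-high {e = e} l (monic ν refl hν) κ<e = Low.coeffwise λ μ low → vanish μ low
    where
    vanish : ∀ μ → Low μ → coeff ((1ℤ , ν) ∷ []) μ ≡ 0ℤ
    vanish μ low rewrite dec-false (Vecₚ.≡-dec ℕₚ._≟_ ν μ)
      (λ { refl → <⇒≱ κ<e (subst (_≤ κ l) (hν (l ↑ˡ n)) (low l)) }) = refl

  power-^ : ∀ (p : Poly (m ℕ.+ n)) e → power _⊠_ 1ᴾ p e ≡ p ^ᴾ e
  power-^ p zero    = refl
  power-^ p (suc e) = cong (p ⊠_) (power-^ p e)

  algebra : TruncatedAlgebra m
  algebra = record
    { Carrier = Poly (m ℕ.+ n)
    ; _+_ = _⊞_
    ; _*_ = _⊠_
    ; 0# = 0ᴾ
    ; 1# = 1ᴾ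
    ; _≋_ = All′._≃_
    ; _≃_ = Low._≃_
    ; ≈-isCommutativeSemiring = All′.isCommutativeSemiring
    ; ≃-isCommutativeSemiring = Low.isCommutativeSemiring
    ; ≈⇒≃ = λ h → Low.coeffwise λ μ _ → All′.at h μ tt
    ; ξ = λ l → var (l ↑ˡ n)
    ; κ = κ
    ; nilpotent = λ l → Low.≃.trans (Low.≃.reflexive (power-^ (var (l ↑ˡ n)) (suc (κ l))))
        (monic-high l (monic-^ (monic-var (l ↑ˡ n)) (suc (κ l)))
          (subst (κ l <_) (sym (trans (cong (suc (κ l) ℕ.*_) (unit-refl (l ↑ˡ n))) (ℕₚ.*-identityʳ _))) (n<1+n (κ l))))
    ; Bounded = Bounded
    ; bounded-0 = []
    ; bounded-1 = monic-bounded monic-1 (λ _ → z≤n)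
    ; bounded-x = λ l → monic-bounded (monic-var (l ↑ˡ n)) (λ l′ → ≤-reflexive (unit-↑ˡ l l′))
    ; bounded-+ = Allₚ.++⁺
    ; bounded-* = bounded-⊠
    ; bounded-≤ = λ β≤γ → All.map λ h l → ≤-trans (h l) (β≤γ l)
    }

  bounded-coeff : ∀ {p μ} → Bounded κ p → ¬ Low μ → coeff p μ ≡ 0ℤ
  bounded-coeff []       _ = refl
  bounded-coeff {(a , ν) ∷ p} {μ} (hν ∷ hp) ¬low rewrite dec-false (Vecₚ.≡-dec ℕₚ._≟_ ν μ)
    (λ { refl → ¬low hν }) = trans (ℤₚ.+-identityˡ _) (bounded-coeff hp ¬low)

  -- Outside `Low` both coefficients are zero by the bounds; inside they agree by hypothesis.
  ≃⇒≈ : ∀ {p r} → Bounded κ p → Bounded κ r → p Low.≃ r → p All′.≃ r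
  ≃⇒≈ {p} {r} hp hr p≃r = All′.coeffwise λ μ _ → go μ
    where
    go : ∀ μ → coeff p μ ≡ coeff r μ
    go μ with low? μ
    ... | yes low = Low.at p≃r μ low
    ... | no ¬low = trans (bounded-coeff hp ¬low) (sym (bounded-coeff hr ¬low))

-- Entries of the weight matrix

module Entries {n : ℕ} .{{_ : NonZero n}} {m : ℕ} (D : Dissection n m) where

  open Dissection D

  κ : Fin m → ℕ
  κ l = degree l ∸ 2

  open PolyAlgebra m n κ public
  open TreeAlgebra algebra (λ _ (_ : ℕ) → ⊤) (λ _ _ → yes tt) using (module Trun; module TrunL; module ≃-Reasoning)

  X : Fin m → Poly (m ℕ.+ n)
  X = x D

  sumIf : ∀ {A : Set} {P : A → Set} → (∀ a → Dec (P a)) → (A → Poly (m ℕ.+ n)) → List A → Poly (m ℕ.+ n)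
  sumIf P? f as = ∑ (map f (filter P? as))

  sumIf-++ : ∀ {A : Set} {P : A → Set} (P? : ∀ a → Dec (P a)) f (as bs : List A) →
             sumIf P? f (as ++ bs) Low.≃ sumIf P? f as ⊞ sumIf P? f bs
  sumIf-++ P? f []       bs = Trun.sym (Trun.+-identityˡ _)
  sumIf-++ P? f (a ∷ as) bs with P? a
  ... | yes _ = Trun.trans (Trun.+-congˡ {f a} (sumIf-++ P? f as bs)) (Trun.sym (Trun.+-assoc (f a) _ _))
  ... | no _  = sumIf-++ P? f as bs

  -- Distributivity: the condition on a word splits into one on its first letter and one on the
  -- rest, so the sum factors.
  sumIf-product : ∀ {k} {P : Vec (Fin m) (suc k) → Set} {Q : Fin m → Set} {R : Vec (Fin m) k → Set}
             (P? : ∀ w → Dec (P w)) (Q? : ∀ l → Dec (Q l)) (R? : ∀ w → Dec (R w)) →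
             (∀ l w → P (l ∷ w) ⇔ (Q l × R w)) → (f : ∀ {k} → Vec (Fin m) k → Poly (m ℕ.+ n)) →
             (∀ l w → f {suc k} (l ∷ w) ≡ X l ⊠ f w) → ∀ ls ws →
             sumIf P? f (cartesianProductWith _∷_ ls ws) Low.≃ sumIf Q? X ls ⊠ sumIf R? f ws
  sumIf-product P? Q? R? P⇔ f f-∷ []       ws = Trun.refl
  sumIf-product {k} {P} {Q} {R} P? Q? R? P⇔ f f-∷ (l ∷ ls) ws = Trun.trans
    (sumIf-++ P? f (map (l ∷_) ws) _)
    (Trun.trans (Trun.+-cong (row ws) (sumIf-product P? Q? R? P⇔ f f-∷ ls ws)) collect)
    where
    row : ∀ ws → sumIf P? f (map (l ∷_) ws) Low.≃ sumIf Q? X (l ∷ []) ⊠ sumIf R? f ws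
    row [] = Trun.sym (Trun.zeroʳ (sumIf Q? X (l ∷ [])))
    row (w ∷ ws) with Q? l | P? (l ∷ w) | R? w | row ws
    ... | yes q | yes _ | yes _ | ih = Trun.trans
          (Trun.+-cong (Trun.trans (Trun.reflexive (f-∷ l w)) (Trun.*-congʳ {f w} (Trun.sym (Trun.+-identityʳ (X l))))) ih)
          (Trun.sym (Trun.distribˡ (X l ⊞ 0ᴾ) (f w) _))
    ... | yes q | yes p | no ¬r | ih = ⊥-elim (¬r (proj₂ (Equivalence.to (P⇔ l w) p)))
    ... | yes q | no ¬p | yes r | ih = ⊥-elim (¬p (Equivalence.from (P⇔ l w) (q , r)))
    ... | yes q | no _  | no _  | ih = ih
    ... | no ¬q | yes p | _     | ih = ⊥-elim (¬q (proj₁ (Equivalence.to (P⇔ l w) p)))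
    ... | no _  | no _  | yes _ | ih = ih
    ... | no _  | no _  | no _  | ih = ih
    collect : sumIf Q? X (l ∷ []) ⊠ sumIf R? f ws ⊞ sumIf Q? X ls ⊠ sumIf R? f ws Low.≃ sumIf Q? X (l ∷ ls) ⊠ sumIf R? f ws
    collect with Q? l
    ... | yes _ = Trun.trans (Trun.+-congʳ {sumIf Q? X ls ⊠ sumIf R? f ws}
          (Trun.*-congʳ {sumIf R? f ws} (Trun.+-identityʳ (X l)))) (Trun.sym (Trun.distribʳ (sumIf R? f ws) (X l) (sumIf Q? X ls)))
    ... | no _  = Trun.refl

  -- This removes condition (ii) from walks: a word violating it is zero modulo the relations, so it
  -- may be added to the sum.
  sumIf-⊆ : ∀ {A : Set} {P Q : A → Set} (P? : ∀ a → Dec (P a)) (Q? : ∀ a → Dec (Q a)) f c →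
            (∀ a → P a → Q a) → (∀ a → ¬ P a → Q a → f a ⊠ c Low.≃ 0ᴾ) → ∀ as →
            sumIf P? (λ a → f a ⊠ c) as Low.≃ sumIf Q? f as ⊠ c
  sumIf-⊆ P? Q? f c P⊆Q vanish [] = Trun.refl
  sumIf-⊆ P? Q? f c P⊆Q vanish (a ∷ as) with P? a | Q? a
  ... | yes _ | yes _ = Trun.trans (Trun.+-congˡ {f a ⊠ c} (sumIf-⊆ P? Q? f c P⊆Q vanish as)) (Trun.sym (Trun.distribʳ c (f a) _))
  ... | yes p | no ¬q = ⊥-elim (¬q (P⊆Q a p))
  ... | no _  | no _  = sumIf-⊆ P? Q? f c P⊆Q vanish as
  ... | no ¬p | yes q = Trun.trans (sumIf-⊆ P? Q? f c P⊆Q vanish as) (Trun.trans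
        (Trun.sym (Trun.trans (Trun.+-congʳ (vanish a ¬p q)) (Trun.+-identityˡ _))) (Trun.sym (Trun.distribʳ c (f a) _)))

  sumIf-bounded : ∀ {A : Set} {P : A → Set} (P? : ∀ a → Dec (P a)) f → (∀ a → P a → Bounded κ (f a)) → ∀ as →
                  Bounded κ (sumIf P? f as)
  sumIf-bounded P? f h [] = []
  sumIf-bounded P? f h (a ∷ as) with P? a
  ... | yes p = Allₚ.++⁺ (h a p) (sumIf-bounded P? f h as)
  ... | no _  = sumIf-bounded P? f h as

  star : Fin n → Poly (m ℕ.+ n)
  star v = sumIf (λ l → v ∈? piece l) X (allFin m)

  stars : (ℕ → Fin n) → ℕ → Poly (m ℕ.+ n)
  stars f zero    = 1ᴾ
  stars f (suc k) = star (f 0) ⊠ stars (f ∘ suc) k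

  Visits : ∀ {k} → (ℕ → Fin n) → Vec (Fin m) k → Set
  Visits f w = ∀ t → f (toℕ t) ∈ piece (Vec.lookup w t)

  visits? : ∀ {k} (f : ℕ → Fin n) (w : Vec (Fin m) k) → Dec (Visits f w)
  visits? f w = Finₚ.all? λ t → f (toℕ t) ∈? piece (Vec.lookup w t)

  word : ∀ {k} → Vec (Fin m) k → Poly (m ℕ.+ n)
  word w = ∏ (map X (Vec.toList w))

  -- Without the cap on repetitions the pieces at different vertices are chosen independently.
  sum-words : ∀ k f → sumIf (visits? f) word (allSeqs D k) Low.≃ stars f k
  sum-words zero    f = Trun.+-identityʳ 1ᴾ
  sum-words (suc k) f = Trun.trans
    (sumIf-product (visits? f) (λ l → f 0 ∈? piece l) (visits? (f ∘ suc))
      (λ l w → mk⇔ (λ h → h zero , λ t → h (suc t)) (λ { (h , h′) zero → h ; (h , h′) (suc t) → h′ t }))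
      word (λ l w → refl) (allFin m) (allSeqs D k))
    (Trun.*-congˡ {star (f 0)} (sum-words k (f ∘ suc)))

  monic-word : ∀ {k} (w : Vec (Fin m) k) → ∃ λ e → Monic (word w) e × (∀ l → e (l ↑ˡ n) ≡ Vec.count (l ≟_) w)
  monic-word []       = _ , monic-1 , λ _ → refl
  monic-word (l′ ∷ w) with monic-word w
  ... | e , h , eq = _ , monic-⊠ (monic-var (l′ ↑ˡ n)) h , counted
    where
    counted : ∀ l → unit (l′ ↑ˡ n) (l ↑ˡ n) ℕ.+ e (l ↑ˡ n) ≡ Vec.count (l ≟_) (l′ ∷ w)
    counted l rewrite unit-↑ˡ l′ l | eq l with l ≟ l′
    ... | yes refl rewrite dec-true (l ≟ l) refl = refl
    ... | no l≢l′ rewrite dec-false (l′ ≟ l) (λ l′≡l → l≢l′ (sym l′≡l)) = refl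

  qs : Fin n → ℕ → Poly (m ℕ.+ n)
  qs i d = ∏ (map (λ s → q D (i ⊕ s)) (upTo d))

  qs-x-free : ∀ (f : ℕ → Fin n) ss → ∃ λ e → Monic (∏ (map (λ s → q D (f s)) ss)) e × (∀ l → e (l ↑ˡ n) ≡ 0)
  qs-x-free f []       = _ , monic-1 , λ _ → refl
  qs-x-free f (s ∷ ss) with qs-x-free f ss
  ... | e , h , eq = _ , monic-⊠ (monic-var (m ↑ʳ f s)) h , λ l → cong₂ ℕ._+_ (unit-↑ʳ (f s) l) (eq l)

  entry-diagonal : ∀ i → weightMatrix D i i ≡ 0ᴾ
  entry-diagonal i = cong (λ ws → ∑ (map (weight D i i) ws))
    (Listₚ.filter-none (isWalk? D i i) (All.universal (λ w walk → proj₁ walk refl) (allSeqs D (dist i i ∸ 1))))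

  entry : ∀ {i j} → i ≢ j → weightMatrix D i j Low.≃ stars (λ t → i ⊕ suc t) (dist i j ∸ 1) ⊠ qs i (dist i j)
  entry {i} {j} i≢j = Trun.trans
    (sumIf-⊆ (isWalk? D i j) (visits? (λ t → i ⊕ suc t)) word Q (λ _ (_ , v , _) → v) high (allSeqs D (dist i j ∸ 1)))
    (Trun.*-congʳ (sum-words (dist i j ∸ 1) _))
    where
    Q = qs i (dist i j)
    high : ∀ w → ¬ IsWalk D i j w → Visits (λ t → i ⊕ suc t) w → word w ⊠ Q Low.≃ 0ᴾ
    high w ¬walk v = vanish
      where
      exceeds : ∃ λ l → ¬ (Vec.count (l ≟_) w ≤ κ l)
      exceeds = Finₚ.¬∀⟶∃¬ m _ (λ l → Vec.count (l ≟_) w ℕ.≤? κ l) (λ cap → ¬walk (i≢j , v , cap))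
      vanish : word w ⊠ Q Low.≃ 0ᴾ
      vanish with monic-word w | exceeds
      ... | e , h , eq | l , count≰κ = Trun.trans
        (Trun.*-congʳ (monic-high l h (subst (κ l <_) (sym (eq l)) (≰⇒> count≰κ)))) (Trun.zeroˡ Q)

  -- Condition (ii) on walks is exactly this bound, and the q bring in no x.
  entry-bounded : ∀ i j → Bounded κ (weightMatrix D i j)
  entry-bounded i j = sumIf-bounded (isWalk? D i j) (weight D i j) (λ w (_ , _ , cap) → bounded w cap) (allSeqs D (dist i j ∸ 1))
    where
    bounded : ∀ w → (∀ l → Vec.count (l ≟_) w ≤ κ l) → Bounded κ (weight D i j w)
    bounded w cap with monic-word w | qs-x-free (i ⊕_) (upTo (dist i j))
    ... | e , h , eq | e′ , h′ , eq′ = monic-bounded (monic-⊠ h h′)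
      (λ l → subst (_≤ κ l) (sym (trans (cong₂ ℕ._+_ (eq l) (eq′ l)) (+-identityʳ _))) (cap l))

-- Enumerations of finite sets and extremal elements

same-elements⇒↭ : ∀ {A : Set} {xs ys : List A} → Unique xs → Unique ys →
                  (∀ {a} → a L.∈ xs → a L.∈ ys) → (∀ {a} → a L.∈ ys → a L.∈ xs) → xs ↭ ys
same-elements⇒↭ !xs !ys ⊆ ⊇ = ∼bag⇒↭ (unique∧set⇒bag !xs !ys (mk⇔ ⊆ ⊇))

elements : ∀ {n} → Subset n → List (Fin n)
elements []            = []
elements (inside  ∷ S) = zero ∷ map suc (elements S)
elements (outside ∷ S) = map suc (elements S)

length-elements : ∀ {n} (S : Subset n) → length (elements S) ≡ ∣ S ∣
length-elements []            = refl
length-elements (inside  ∷ S) = cong suc (trans (Listₚ.length-map suc (elements S)) (length-elements S))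
length-elements (outside ∷ S) = trans (Listₚ.length-map suc (elements S)) (length-elements S)

elements-unique : ∀ {n} (S : Subset n) → Unique (elements S)
elements-unique []            = []
elements-unique (inside  ∷ S) = Allₚ.map⁺ (All.universal (λ _ ()) _) ∷ Uniqueₚ.map⁺ Finₚ.suc-injective (elements-unique S)
elements-unique (outside ∷ S) = Uniqueₚ.map⁺ Finₚ.suc-injective (elements-unique S)

∈-elements⁺ : ∀ {n v} {S : Subset n} → v ∈ S → v L.∈ elements S
∈-elements⁺ here = here refl
∈-elements⁺ {S = inside  ∷ S} (there v∈S) = there (Lₚ.∈-map⁺ suc (∈-elements⁺ v∈S))
∈-elements⁺ {S = outside ∷ S} (there v∈S) = Lₚ.∈-map⁺ suc (∈-elements⁺ v∈S)

∈-elements⁻ : ∀ {n v} (S : Subset n) → v L.∈ elements S → v ∈ S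
∈-elements⁻ (inside ∷ S) (here refl) = here
∈-elements⁻ (inside ∷ S) (there v∈) with Lₚ.∈-map⁻ suc v∈
... | _ , u∈ , refl = there (∈-elements⁻ S u∈)
∈-elements⁻ (outside ∷ S) v∈ with Lₚ.∈-map⁻ suc v∈
... | _ , u∈ , refl = there (∈-elements⁻ S u∈)

cardinality : ∀ {n} {S : Subset n} {vs} → Unique vs → (∀ {v} → v ∈ S → v L.∈ vs) → (∀ {v} → v L.∈ vs → v ∈ S) →
              ∣ S ∣ ≡ length vs
cardinality {S = S} !vs ⊆ ⊇ = trans (sym (length-elements S))
  (↭-length (same-elements⇒↭ (elements-unique S) !vs (⊆ ∘ ∈-elements⁻ S) (∈-elements⁺ ∘ ⊇)))

third-element : ∀ {n} (S : Subset n) {a b} → 3 ≤ ∣ S ∣ → a ≢ b → ∃ λ c → c ∈ S × c ≢ a × c ≢ b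
third-element S {a} {b} 3≤ a≢b with Finₚ.any? (λ c → c ∈? S ×-dec ¬? (c ≟ a) ×-dec ¬? (c ≟ b))
... | yes third = third
... | no ¬third = ⊥-elim (ℕₚ.≤⇒≯ (≤-trans 3≤ (≤-trans (Subsetₚ.p⊆q⇒∣p∣≤∣q∣ S⊆) (≤-reflexive two))) (n<1+n 2))
  where
  S⊆ : S Subset.⊆ ⁅ a ⁆ ∪ ⁅ b ⁆
  S⊆ {c} c∈S with c ≟ a | c ≟ b
  ... | yes refl | _        = Subsetₚ.x∈p∪q⁺ (inj₁ (Subsetₚ.x∈⁅x⁆ c))
  ... | no _     | yes refl = Subsetₚ.x∈p∪q⁺ (inj₂ (Subsetₚ.x∈⁅x⁆ c))
  ... | no c≢a   | no c≢b   = ⊥-elim (¬third (c , c∈S , c≢a , c≢b))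
  two : ∣ ⁅ a ⁆ ∪ ⁅ b ⁆ ∣ ≡ 2
  two = cardinality {vs = a ∷ b ∷ []} ((a≢b ∷ []) ∷ [] ∷ [])
    (λ c∈ → case Subsetₚ.x∈p∪q⁻ ⁅ a ⁆ ⁅ b ⁆ c∈ of λ
      { (inj₁ c∈a) → here (Subsetₚ.x∈⁅y⁆⇒x≡y a c∈a) ; (inj₂ c∈b) → there (here (Subsetₚ.x∈⁅y⁆⇒x≡y b c∈b)) })
    λ { (here refl) → Subsetₚ.x∈p∪q⁺ (inj₁ (Subsetₚ.x∈⁅x⁆ a)) ; (there (here refl)) → Subsetₚ.x∈p∪q⁺ (inj₂ (Subsetₚ.x∈⁅x⁆ b)) }

three-elements : ∀ {n} {S : Subset n} {a b c} → a ∈ S → b ∈ S → c ∈ S → a ≢ b → a ≢ c → b ≢ c → 3 ≤ ∣ S ∣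
three-elements a∈ b∈ c∈ a≢b a≢c b≢c = ≤-trans
  (s≤s (≤-trans (s≤s (≤-trans (s≤s z≤n) (Subsetₚ.x∈p⇒∣p-x∣<∣p∣ c∈′))) (Subsetₚ.x∈p⇒∣p-x∣<∣p∣ b∈′)))
  (Subsetₚ.x∈p⇒∣p-x∣<∣p∣ a∈)
  where
  b∈′ = Subsetₚ.x∈p∧x≢y⇒x∈p-y b∈ (a≢b ∘ sym)
  c∈′ = Subsetₚ.x∈p∧x≢y⇒x∈p-y (Subsetₚ.x∈p∧x≢y⇒x∈p-y c∈ (a≢c ∘ sym)) (b≢c ∘ sym)

greatest-below : ∀ {P : ℕ → Set} → (∀ k → Dec (P k)) → ∀ N →
                 (∃ λ k → k < N × P k × (∀ j → k < j → j < N → ¬ P j)) ⊎ (∀ j → j < N → ¬ P j)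
greatest-below P? zero = inj₂ λ _ ()
greatest-below P? (suc N) with P? N
... | yes p = inj₁ (N , n<1+n N , p , λ j N<j j≤N → ⊥-elim (<⇒≱ N<j (≤-pred j≤N)))
... | no ¬p with greatest-below P? N
...   | inj₁ (k , k<N , p , max) = inj₁ (k , m<n⇒m<1+n k<N , p , λ j k<j j≤N → case ℕₚ.m<1+n⇒m<n∨m≡n j≤N of λ
          { (inj₁ j<N) → max j k<j j<N ; (inj₂ refl) → ¬p })
...   | inj₂ none = inj₂ λ j j≤N → case ℕₚ.m<1+n⇒m<n∨m≡n j≤N of λ { (inj₁ j<N) → none j j<N ; (inj₂ refl) → ¬p }

least-from : ∀ {P : ℕ → Set} → (∀ k → Dec (P k)) → ∀ a y →
             (∃ λ k → a ≤ k × k < y ℕ.+ a × P k × (∀ j → a ≤ j → j < k → ¬ P j)) ⊎ (∀ j → a ≤ j → j < y ℕ.+ a → ¬ P j)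
least-from P? a zero = inj₂ λ j a≤j j<a → ⊥-elim (<⇒≱ j<a a≤j)
least-from P? a (suc y) with least-from P? a y
... | inj₁ (k , a≤k , k< , p , min) = inj₁ (k , a≤k , m<n⇒m<1+n k< , p , min)
... | inj₂ none with P? (y ℕ.+ a)
...   | yes p = inj₁ (y ℕ.+ a , m≤n+m a y , n<1+n _ , p , none)
...   | no ¬p = inj₂ λ j a≤j j≤ → case ℕₚ.m<1+n⇒m<n∨m≡n j≤ of λ { (inj₁ j<) → none j a≤j j< ; (inj₂ refl) → ¬p }

least-in : ∀ {P : ℕ → Set} → (∀ k → Dec (P k)) → ∀ {a w} → a ≤ w → P w →
           ∃ λ k → a ≤ k × k ≤ w × P k × (∀ j → a ≤ j → j < k → ¬ P j)
least-in P? {a} {w} a≤w Pw with least-from P? a (suc (w ∸ a))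
... | inj₁ (k , a≤k , k< , p , min) = k , a≤k , subst (k ≤_) (ℕₚ.m∸n+n≡m a≤w) (≤-pred k<) , p , min
... | inj₂ none = ⊥-elim (none w a≤w (s≤s (≤-reflexive (sym (ℕₚ.m∸n+n≡m a≤w)))) Pw)

greatest-in : ∀ {P : ℕ → Set} → (∀ k → Dec (P k)) → ∀ {w N} → w < N → P w →
              ∃ λ k → w ≤ k × k < N × P k × (∀ j → k < j → j < N → ¬ P j)
greatest-in P? {w} {N} w<N Pw with greatest-below P? N
... | inj₁ (k , k<N , p , max) = k , ≮⇒≥ (λ k<w → max w k<w w<N Pw) , k<N , p , max
... | inj₂ none = ⊥-elim (none w w<N Pw)

-- Positions: counting the vertices from an origin

module Positions {n : ℕ} .{{_ : NonZero n}} where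

  vtx : ℕ → ℕ → Fin n
  vtx o t = (o ℕ.+ t) mod n

  -- The origin is any natural number, reduced only here, so that it can be moved by one step in an
  -- induction without a case distinction at n.
  pos : ℕ → Fin n → ℕ
  pos o v = (toℕ v ℕ.+ (n ∸ o % n)) % n

  toℕ-mod : ∀ a → toℕ (a mod n) ≡ a % n
  toℕ-mod a = Finₚ.toℕ-fromℕ< (m%n<n a n)

  %-absorbˡ : ∀ a b → (a % n ℕ.+ b) % n ≡ (a ℕ.+ b) % n
  %-absorbˡ a b = trans (%-distribˡ-+ (a % n) b n)
    (trans (cong (λ z → (z ℕ.+ b % n) % n) (m%n%n≡m%n a n)) (sym (%-distribˡ-+ a b n)))

  %-absorbʳ : ∀ a b → (a ℕ.+ b % n) % n ≡ (a ℕ.+ b) % n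
  %-absorbʳ a b = trans (cong (_% n) (+-comm a (b % n))) (trans (%-absorbˡ b a) (cong (_% n) (+-comm b a)))

  -- Adding to o the complement of its residue reaches a multiple of n.
  complement : ∀ o t → (t ℕ.+ (o ℕ.+ (n ∸ o % n))) % n ≡ t % n
  complement o t = trans (cong (λ z → (t ℕ.+ z) % n) full) ([m+kn]%n≡m%n t (suc (o / n)) n)
    where
    full : o ℕ.+ (n ∸ o % n) ≡ suc (o / n) ℕ.* n
    full = begin
      o ℕ.+ (n ∸ o % n)                              ≡⟨ cong (ℕ._+ (n ∸ o % n)) (m≡m%n+[m/n]*n o n) ⟩
      o % n ℕ.+ o / n ℕ.* n ℕ.+ (n ∸ o % n)          ≡⟨ arith (o % n) (o / n ℕ.* n) (n ∸ o % n) ⟩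
      (o % n ℕ.+ (n ∸ o % n)) ℕ.+ o / n ℕ.* n        ≡⟨ cong (ℕ._+ o / n ℕ.* n) (m+[n∸m]≡n (m%n≤n o n)) ⟩
      n ℕ.+ o / n ℕ.* n                              ∎
      where
      open ≡-Reasoning
      arith : ∀ a b c → a ℕ.+ b ℕ.+ c ≡ a ℕ.+ c ℕ.+ b
      arith = ℕ-Ring.solve-∀

  pos-vtx : ∀ o {t} → t < n → pos o (vtx o t) ≡ t
  pos-vtx o {t} t<n = begin
    (toℕ (vtx o t) ℕ.+ (n ∸ o % n)) % n    ≡⟨ cong (λ z → (z ℕ.+ (n ∸ o % n)) % n) (toℕ-mod (o ℕ.+ t)) ⟩
    ((o ℕ.+ t) % n ℕ.+ (n ∸ o % n)) % n    ≡⟨ %-absorbˡ (o ℕ.+ t) _ ⟩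
    ((o ℕ.+ t) ℕ.+ (n ∸ o % n)) % n        ≡⟨ cong (_% n) (arith o t (n ∸ o % n)) ⟩
    (t ℕ.+ (o ℕ.+ (n ∸ o % n))) % n        ≡⟨ complement o t ⟩
    t % n                                  ≡⟨ m<n⇒m%n≡m t<n ⟩
    t                                      ∎
    where
    open ≡-Reasoning
    arith : ∀ a b c → a ℕ.+ b ℕ.+ c ≡ b ℕ.+ (a ℕ.+ c)
    arith = ℕ-Ring.solve-∀

  vtx-pos : ∀ o v → vtx o (pos o v) ≡ v
  vtx-pos o v = Finₚ.toℕ-injective (begin
    toℕ (vtx o (pos o v))                        ≡⟨ toℕ-mod (o ℕ.+ pos o v) ⟩
    (o ℕ.+ (toℕ v ℕ.+ (n ∸ o % n)) % n) % n      ≡⟨ %-absorbʳ o _ ⟩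
    (o ℕ.+ (toℕ v ℕ.+ (n ∸ o % n))) % n          ≡⟨ cong (_% n) (arith o (toℕ v) (n ∸ o % n)) ⟩
    (toℕ v ℕ.+ (o ℕ.+ (n ∸ o % n))) % n          ≡⟨ complement o (toℕ v) ⟩
    toℕ v % n                                    ≡⟨ m<n⇒m%n≡m (Finₚ.toℕ<n v) ⟩
    toℕ v                                        ∎)
    where
    open ≡-Reasoning
    arith : ∀ a b c → a ℕ.+ (b ℕ.+ c) ≡ b ℕ.+ (a ℕ.+ c)
    arith = ℕ-Ring.solve-∀

  pos-< : ∀ o v → pos o v < n
  pos-< o v = m%n<n _ n

  vtx-injective : ∀ o {s t} → s < n → t < n → vtx o s ≡ vtx o t → s ≡ t
  vtx-injective o s<n t<n eq = trans (sym (pos-vtx o s<n)) (trans (cong (pos o) eq) (pos-vtx o t<n))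

  vtx-⊕ : ∀ o s u → vtx o s ⊕ u ≡ vtx o (s ℕ.+ u)
  vtx-⊕ o s u = Finₚ.toℕ-injective (begin
    toℕ (vtx o s ⊕ u)               ≡⟨ toℕ-mod (toℕ (vtx o s) ℕ.+ u) ⟩
    (toℕ (vtx o s) ℕ.+ u) % n       ≡⟨ cong (λ z → (z ℕ.+ u) % n) (toℕ-mod (o ℕ.+ s)) ⟩
    ((o ℕ.+ s) % n ℕ.+ u) % n       ≡⟨ %-absorbˡ (o ℕ.+ s) u ⟩
    (o ℕ.+ s ℕ.+ u) % n             ≡⟨ cong (_% n) (+-assoc o s u) ⟩
    (o ℕ.+ (s ℕ.+ u)) % n           ≡⟨ toℕ-mod (o ℕ.+ (s ℕ.+ u)) ⟨
    toℕ (vtx o (s ℕ.+ u))           ∎)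
    where open ≡-Reasoning

  vtx-wrap : ∀ o t → vtx o (t ℕ.+ n) ≡ vtx o t
  vtx-wrap o t = Finₚ.toℕ-injective (begin
    toℕ (vtx o (t ℕ.+ n))  ≡⟨ toℕ-mod (o ℕ.+ (t ℕ.+ n)) ⟩
    (o ℕ.+ (t ℕ.+ n)) % n  ≡⟨ cong (_% n) (+-assoc o t n) ⟨
    (o ℕ.+ t ℕ.+ n) % n    ≡⟨ [m+n]%n≡m%n (o ℕ.+ t) n ⟩
    (o ℕ.+ t) % n          ≡⟨ toℕ-mod (o ℕ.+ t) ⟨
    toℕ (vtx o t)          ∎)
    where open ≡-Reasoning

  vtx-origin : ∀ i → vtx (toℕ i) 0 ≡ i
  vtx-origin i = Finₚ.toℕ-injective (trans (toℕ-mod (toℕ i ℕ.+ 0))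
    (trans (cong (_% n) (+-identityʳ (toℕ i))) (m<n⇒m%n≡m (Finₚ.toℕ<n i))))

  vtx-suc : ∀ o t → vtx (suc o) t ≡ vtx o (suc t)
  vtx-suc o t = cong (_mod n) (sym (+-suc o t))

  dist-⊕ : ∀ i {u} → u < n → dist i (i ⊕ u) ≡ u
  dist-⊕ i {u} u<n = trans (cong (λ z → (toℕ (i ⊕ u) ℕ.+ (n ∸ z)) % n) (sym (m<n⇒m%n≡m (Finₚ.toℕ<n i)))) (pos-vtx (toℕ i) u<n)

  ⊕-dist : ∀ i j → i ⊕ dist i j ≡ j
  ⊕-dist i j = trans (cong (λ z → i ⊕ ((toℕ j ℕ.+ (n ∸ z)) % n)) (sym (m<n⇒m%n≡m (Finₚ.toℕ<n i)))) (vtx-pos (toℕ i) j)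

  dist-forward : ∀ o {s e} → s ℕ.+ e < n → dist (vtx o s) (vtx o (s ℕ.+ e)) ≡ e
  dist-forward o {s} {e} <n = trans (cong (dist (vtx o s)) (sym (vtx-⊕ o s e))) (dist-⊕ (vtx o s) (≤-<-trans (m≤n+m e s) <n))

  -- The case e = 0 is excluded because the distance is then 0 and not n.
  dist-backward : ∀ o s {e} → 0 < e → e ≤ n → dist (vtx o (s ℕ.+ e)) (vtx o s) ≡ n ∸ e
  dist-backward o s {e} 0<e e≤n = trans
    (cong (dist (vtx o (s ℕ.+ e))) (trans (sym (vtx-wrap o s)) (trans (cong (vtx o) around) (sym (vtx-⊕ o (s ℕ.+ e) (n ∸ e))))))
    (dist-⊕ (vtx o (s ℕ.+ e)) (ℕₚ.∸-monoʳ-< 0<e e≤n))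
    where
    around : s ℕ.+ n ≡ s ℕ.+ e ℕ.+ (n ∸ e)
    around = trans (cong (s ℕ.+_) (sym (m+[n∸m]≡n e≤n))) (sym (+-assoc s e _))

  between-forward : ∀ o {u w k} → u < w → w < n → k < n → Between (vtx o u) (vtx o w) (vtx o k) → u < k × k < w
  between-forward o {u} {w} {k} u<w w<n k<n (0<d , d<d′)
    with m≤n⇒∃[o]m+o≡n (<⇒≤ u<w) | <-cmp u k
  ... | e , refl | tri≈ _ refl _ = ⊥-elim (<-irrefl (trans (sym (dist-forward o {u} {0} (subst (_< n) (sym (+-identityʳ u)) k<n)))
                                      (cong (λ z → dist (vtx o u) (vtx o z)) (+-identityʳ u))) 0<d)
  ... | e , refl | tri< u<k _ _ with m≤n⇒∃[o]m+o≡n (<⇒≤ u<k)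
  ...   | f , refl = u<k , ℕₚ.+-monoʳ-< u (subst₂ _<_ (dist-forward o k<n) (dist-forward o w<n) d<d′)
  between-forward o {u} {w} {k} u<w w<n k<n (0<d , d<d′) | e , refl | tri> _ _ k<u with m≤n⇒∃[o]m+o≡n (<⇒≤ k<u)
  ...   | f , refl = ⊥-elim (<⇒≱ (subst₂ _<_ (dist-backward o k (≰⇒> λ f≤0 → <-irrefl (trans (sym (+-identityʳ k)) (cong (k ℕ.+_) (sym (ℕₚ.n≤0⇒n≡0 f≤0)))) k<u) f≤n)
                                     (dist-forward o w<n) d<d′)
            (ℕₚ.m+n≤o⇒m≤o∸n e (<⇒≤ (≤-<-trans (≤-trans (≤-reflexive (+-comm e f)) (ℕₚ.+-monoˡ-≤ e (m≤n+m f k))) w<n))))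
    where
    f≤n : f ≤ n
    f≤n = ≤-trans (m≤n+m f k) (<⇒≤ (<-trans u<w w<n))

  between-forward⁻ : ∀ o {u w k} → u < k → k < w → w < n → Between (vtx o u) (vtx o w) (vtx o k)
  between-forward⁻ o {u} u<k k<w w<n with m≤n⇒∃[o]m+o≡n (<⇒≤ u<k) | m≤n⇒∃[o]m+o≡n (<⇒≤ (<-trans u<k k<w))
  ... | f , refl | e , refl
    rewrite dist-forward o {u} {f} (<-trans k<w w<n) | dist-forward o {u} {e} w<n =
      ℕₚ.+-cancelˡ-< u 0 f (subst (_< u ℕ.+ f) (sym (+-identityʳ u)) u<k) , ℕₚ.+-cancelˡ-< u f e k<w

  -- The way from the higher position w to the lower one u wraps past the origin, so it avoids the
  -- whole interval from u to w.
  between-backward : ∀ o {u w k} → u < w → w < n → k < n → Between (vtx o w) (vtx o u) (vtx o k) → ¬ (u ≤ k × k ≤ w)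
  between-backward o {u} {w} {k} u<w w<n k<n (0<d , d<d′) (u≤k , k≤w)
    with m≤n⇒∃[o]m+o≡n u≤k | m≤n⇒m<n∨m≡n k≤w
  ... | f , refl | inj₂ refl = ⊥-elim (<-irrefl (trans (sym (dist-forward o {u ℕ.+ f} {0} (subst (_< n) (sym (+-identityʳ _)) k<n)))
                                      (cong (λ z → dist (vtx o (u ℕ.+ f)) (vtx o z)) (+-identityʳ _))) 0<d)
  ... | f , refl | inj₁ k<w with m≤n⇒∃[o]m+o≡n k<w
  ...   | g , refl = <⇒≱ (subst₂ _<_
              (trans (cong (λ z → dist (vtx o z) (vtx o (u ℕ.+ f))) (sym (+-suc (u ℕ.+ f) g))) (dist-backward o (u ℕ.+ f) {suc g} (s≤s z≤n) g≤n))
              (trans (cong (λ z → dist (vtx o z) (vtx o u)) shape) (dist-backward o u {f ℕ.+ suc g} (≤-trans (s≤s z≤n) (m≤n+m (suc g) f)) fg≤n)) d<d′)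
            (ℕₚ.∸-monoʳ-≤ n (m≤n+m (suc g) f))
    where
    shape : suc (u ℕ.+ f) ℕ.+ g ≡ u ℕ.+ (f ℕ.+ suc g)
    shape = trans (sym (+-suc (u ℕ.+ f) g)) (+-assoc u f (suc g))
    fg≤n : f ℕ.+ suc g ≤ n
    fg≤n = ≤-trans (m≤n+m _ u) (<⇒≤ (subst (_< n) shape w<n))
    g≤n : suc g ≤ n
    g≤n = ≤-trans (m≤n+m (suc g) f) fg≤n

  between-backward⁻ : ∀ o {u w k} → u < w → w < n → k < n → k < u ⊎ w < k → Between (vtx o w) (vtx o u) (vtx o k)
  between-backward⁻ o {u} {w} {k} u<w w<n k<n (inj₁ k<u) with m≤n⇒∃[o]m+o≡n k<u
  ... | f , refl with m≤n⇒∃[o]m+o≡n u<w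
  ...   | g , refl = subst₂ _<_ refl (sym dk) (ℕₚ.m<n⇒0<n∸m fg<n) ,
                     subst₂ _<_ (sym dk) (sym du) (ℕₚ.∸-monoʳ-< (s≤s (m≤n+m (suc g) f)) (<⇒≤ fg<n))
    where
    shape : suc (suc (k ℕ.+ f)) ℕ.+ g ≡ k ℕ.+ (suc f ℕ.+ suc g)
    shape = arith k f g
      where
      arith : ∀ k f g → suc (suc (k ℕ.+ f)) ℕ.+ g ≡ k ℕ.+ (suc f ℕ.+ suc g)
      arith = ℕ-Ring.solve-∀
    fg<n : suc f ℕ.+ suc g < n
    fg<n = ≤-<-trans (m≤n+m _ k) (subst (_< n) shape w<n)
    dk : dist (vtx o (suc (suc (k ℕ.+ f)) ℕ.+ g)) (vtx o k) ≡ n ∸ (suc f ℕ.+ suc g)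
    dk = trans (cong (λ z → dist (vtx o z) (vtx o k)) shape) (dist-backward o k (s≤s z≤n) (<⇒≤ fg<n))
    du : dist (vtx o (suc (suc (k ℕ.+ f)) ℕ.+ g)) (vtx o (suc (k ℕ.+ f))) ≡ n ∸ suc g
    du = trans (cong (λ z → dist (vtx o z) (vtx o (suc (k ℕ.+ f)))) (sym (+-suc (suc (k ℕ.+ f)) g)))
           (dist-backward o (suc (k ℕ.+ f)) (s≤s z≤n) (≤-trans (m≤n+m (suc g) (suc f)) (<⇒≤ fg<n)))
  between-backward⁻ o {u} {w} {k} u<w w<n k<n (inj₂ w<k) with m≤n⇒∃[o]m+o≡n u<w
  ... | g , refl with m≤n⇒∃[o]m+o≡n w<k
  ...   | f , refl = subst (0 <_) (sym dk) (s≤s z≤n) ,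
                     subst₂ _<_ (sym dk) (sym du) (ℕₚ.m+n≤o⇒m≤o∸n (suc (suc f)) (subst (_≤ n) (sym (arith f g)) 
                       (≤-trans (s≤s (s≤s (s≤s (ℕₚ.+-monoˡ-≤ f (m≤n+m g u))))) k<n)))
    where
    arith : ∀ f g → suc (suc f) ℕ.+ suc g ≡ suc (suc (suc (g ℕ.+ f)))
    arith = ℕ-Ring.solve-∀
    dk : dist (vtx o (suc u ℕ.+ g)) (vtx o (suc (suc u ℕ.+ g) ℕ.+ f)) ≡ suc f
    dk = trans (cong (λ z → dist (vtx o (suc u ℕ.+ g)) (vtx o z)) (sym (+-suc (suc u ℕ.+ g) f)))
           (dist-forward o (subst (_< n) (sym (+-suc (suc u ℕ.+ g) f)) k<n))
    du : dist (vtx o (suc u ℕ.+ g)) (vtx o u) ≡ n ∸ suc g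
    du = trans (cong (λ z → dist (vtx o z) (vtx o u)) (sym (+-suc u g)))
           (dist-backward o u (s≤s z≤n) (<⇒≤ (≤-<-trans (s≤s (m≤n+m g u)) w<n)))

-- Geometry of pieces in linear positions

AllPairs-lookup : ∀ {A : Set} {R : A → A → Set} {xs x y} → AllPairs R xs → x L.∈ xs → y L.∈ xs →
                  x ≡ y ⊎ R x y ⊎ R y x
AllPairs-lookup (_ ∷ _)   (here refl) (here refl) = inj₁ refl
AllPairs-lookup (Rx ∷ _)  (here refl) (there y∈)  = inj₂ (inj₁ (All.lookup Rx y∈))
AllPairs-lookup (Ry ∷ _)  (there x∈)  (here refl) = inj₂ (inj₂ (All.lookup Ry x∈))
AllPairs-lookup (_ ∷ Rxs) (there x∈)  (there y∈)  = AllPairs-lookup Rxs x∈ y∈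

module Geometry {n : ℕ} .{{_ : NonZero n}} {m : ℕ} (D : Dissection n m) where

  open Dissection D
  open Positions {n}

  Drawn : ℕ → ℕ → ℕ → Set
  Drawn o a b = (vtx o a , vtx o b) L.∈ diagonals ⊎ (vtx o b , vtx o a) L.∈ diagonals

  drawn? : ∀ o a b → Dec (Drawn o a b)
  drawn? o a b = (vtx o a , vtx o b) ∈ᴸ? diagonals ⊎-dec (vtx o b , vtx o a) ∈ᴸ? diagonals
    where open DecL (×ₚ.≡-dec (_≟_ {n}) (_≟_ {n})) using () renaming (_∈?_ to _∈ᴸ?_)

  diagonal : ∀ {c} → c L.∈ diagonals → IsDiagonal c
  diagonal = All.lookup areDiagonals

  drawn-sym : ∀ o {a b} → Drawn o a b → Drawn o b a
  drawn-sym o = Sum.swap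

  private
    drawn-shift : ∀ {o a b} → Drawn (suc o) a b → Drawn o (suc a) (suc b)
    drawn-shift {o} {a} {b} = subst₂ (λ u v → (u , v) L.∈ diagonals ⊎ (v , u) L.∈ diagonals) (vtx-suc o a) (vtx-suc o b)

    drawn-wrap : ∀ {o a b} → suc b ≡ n → Drawn (suc o) a b → Drawn o (suc a) 0
    drawn-wrap {o} {a} {b} eq d = subst (λ v → (vtx o (suc a) , v) L.∈ diagonals ⊎ (v , vtx o (suc a)) L.∈ diagonals)
      (trans (cong (vtx o) eq) (vtx-wrap o 0)) (drawn-shift {o} {a} {b} d)

    toℕ-vtx : ∀ {t} → t < n → toℕ (vtx 0 t) ≡ t
    toℕ-vtx {t} t<n = trans (toℕ-mod t) (m<n⇒m%n≡m t<n)

    drawn-ordered : ∀ {a b} → a < b → b < n → Drawn 0 a b → (vtx 0 a , vtx 0 b) L.∈ diagonals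
    drawn-ordered a<b b<n (inj₁ ∈ds) = ∈ds
    drawn-ordered a<b b<n (inj₂ ∈ds) = ⊥-elim (ℕₚ.<-asym a<b
      (subst₂ _<_ (toℕ-vtx b<n) (toℕ-vtx (<-trans a<b b<n)) (proj₁ (diagonal ∈ds))))

  -- Moving the origin by one step sends the last position to the first, which
  -- exchanges the roles of two crossing diagonals.
  drawn-noncrossing : ∀ o {a b c d} → a < c → c < b → b < d → d < n → Drawn o a b → ¬ Drawn o c d
  drawn-noncrossing zero {a} {b} {c} {d} a<c c<b b<d d<n ab cd =
    case AllPairs-lookup noncrossing (drawn-ordered (<-trans a<c c<b) b<n ab) (drawn-ordered (<-trans c<b b<d) d<n cd) of λ
      { (inj₁ eq) → <⇒≢ a<c (vtx-injective 0 (<-trans a<c c<n) c<n (cong proj₁ eq))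
      ; (inj₂ (inj₁ ¬cross)) → ¬cross (inj₁ crossed)
      ; (inj₂ (inj₂ ¬cross)) → ¬cross (inj₂ crossed) }
    where
    b<n = <-trans b<d d<n
    c<n = <-trans c<b b<n
    crossed : toℕ (vtx 0 a) < toℕ (vtx 0 c) × toℕ (vtx 0 c) < toℕ (vtx 0 b) × toℕ (vtx 0 b) < toℕ (vtx 0 d)
    crossed rewrite toℕ-vtx (<-trans a<c c<n) | toℕ-vtx c<n | toℕ-vtx b<n | toℕ-vtx d<n = a<c , c<b , b<d
  drawn-noncrossing (suc o) {a} {b} {c} {d} a<c c<b b<d d<n ab cd with m≤n⇒m<n∨m≡n d<n
  ... | inj₁ 1+d<n = drawn-noncrossing o (s≤s a<c) (s≤s c<b) (s≤s b<d) 1+d<n (drawn-shift {o} {a} {b} ab) (drawn-shift {o} {c} {d} cd)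
  ... | inj₂ 1+d≡n = drawn-noncrossing o (s≤s z≤n) (s≤s a<c) (s≤s c<b) (≤-<-trans b<d d<n)
        (drawn-sym o (drawn-wrap {o} {c} {d} 1+d≡n cd)) (drawn-shift {o} {a} {b} ab)

  module Linear (o : ℕ) where

    private v = vtx o

    At : Subset n → ℕ → Set
    At S k = k < n × v k ∈ S

    at? : ∀ S k → Dec (At S k)
    at? S k = k ℕ.<? n ×-dec v k ∈? S

    at-pos : ∀ {S u} → u ∈ S → At S (pos o u)
    at-pos {S} {u} u∈S = pos-< o u , subst (_∈ S) (sym (vtx-pos o u)) u∈S

    Hull : Subset n → ℕ → ℕ → Set
    Hull S u w = ∀ k → At S k → u ≤ k × k ≤ w

    Empty : Subset n → ℕ → ℕ → Set
    Empty S u w = ∀ k → u < k → k < w → ¬ At S k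

    module _ {S : Subset n} {u w : ℕ} (u<w : u < w) (w<n : w < n) where

      private
        distinct-ends : v u ≢ v w
        distinct-ends eq = <⇒≢ u<w (vtx-injective o (<-trans u<w w<n) w<n eq)

      consecutive-forward⁺ : At S u → At S w → Empty S u w → Consecutive S (v u) (v w)
      consecutive-forward⁺ (_ , u∈) (_ , w∈) none = u∈ , w∈ , distinct-ends , λ k k∈S btw →
        let (u<k , k<w) = between-forward o u<w w<n (pos-< o k) (subst (Between (v u) (v w)) (sym (vtx-pos o k)) btw)
        in none (pos o k) u<k k<w (at-pos k∈S)

      consecutive-forward⁻ : Consecutive S (v u) (v w) → At S u × At S w × Empty S u w
      consecutive-forward⁻ (u∈ , w∈ , _ , none) = (<-trans u<w w<n , u∈) , (w<n , w∈) ,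
        λ k u<k k<w (_ , k∈) → none (v k) k∈ (between-forward⁻ o u<k k<w w<n)

      consecutive-backward⁺ : At S u → At S w → Hull S u w → Consecutive S (v w) (v u)
      consecutive-backward⁺ (_ , u∈) (_ , w∈) hull = w∈ , u∈ , distinct-ends ∘ sym , λ k k∈S btw →
        between-backward o u<w w<n (pos-< o k) (subst (Between (v w) (v u)) (sym (vtx-pos o k)) btw) (hull (pos o k) (at-pos k∈S))

      consecutive-backward⁻ : Consecutive S (v w) (v u) → At S u × At S w × Hull S u w
      consecutive-backward⁻ (w∈ , u∈ , _ , none) = (<-trans u<w w<n , u∈) , (w<n , w∈) ,
        λ k (k<n , k∈) → ≮⇒≥ (λ k<u → none (v k) k∈ (between-backward⁻ o u<w w<n k<n (inj₁ k<u)))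
                       , ≮⇒≥ (λ w<k → none (v k) k∈ (between-backward⁻ o u<w w<n k<n (inj₂ w<k)))

    Root : ℕ → ℕ → Set
    Root u w = (u ≡ 0 × suc w ≡ n) ⊎ Drawn o u w

    -- In linear positions a polygon has one closing side, from its last position back to its first,
    -- and all other sides join successive positions. The closing side becomes the entry side in the
    -- tree; the others lead to children.
    record LinearPiece (S : Subset n) : Set where
      field
        link  : ∀ {u w} → u < w → At S u → At S w → Empty S u w → w ≡ suc u ⊎ Drawn o u w
        root  : ∀ {u w} → u < w → At S u → At S w → Hull S u w → Root u w
        uncut : ∀ {u w} → u < w → Drawn o u w → At S u → At S w → Empty S u w ⊎ Hull S u w
        third : ∀ {u w} → u < w → w < n → ∃ λ k → At S k × k ≢ u × k ≢ w

    linear : ∀ {S} → IsPiece diagonals S → LinearPiece S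
    linear {S} S-piece = record
      { link = λ {u} {w} u<w u∈ w∈ none →
          case IsPiece.bounded S-piece (v u) (v w) (consecutive-forward⁺ u<w (proj₁ w∈) u∈ w∈ none) of λ
          { (inj₁ eq) → inj₁ (vtx-injective o (proj₁ w∈) (≤-<-trans u<w (proj₁ w∈))
                (trans eq (trans (vtx-⊕ o u 1) (cong v (+-comm u 1)))))
          ; (inj₂ drawn) → inj₂ drawn }
      ; root = λ {u} {w} u<w u∈ w∈ hull →
          case IsPiece.bounded S-piece (v w) (v u) (consecutive-backward⁺ u<w (proj₁ w∈) u∈ w∈ hull) of λ
          { (inj₁ eq) → inj₁ (wrapped u<w (proj₁ w∈) (trans eq (trans (vtx-⊕ o w 1) (cong v (+-comm w 1)))))
          ; (inj₂ drawn) → inj₂ (Sum.swap drawn) }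
      ; uncut = λ {u} {w} u<w drawn u∈ w∈ →
          case (case drawn of λ
                 { (inj₁ ∈ds) → IsPiece.uncut S-piece (v u) (v w) ∈ds (proj₂ u∈) (proj₂ w∈)
                 ; (inj₂ ∈ds) → Sum.swap (IsPiece.uncut S-piece (v w) (v u) ∈ds (proj₂ w∈) (proj₂ u∈)) }) of λ
          { (inj₁ forward) → inj₁ (proj₂ (proj₂ (consecutive-forward⁻ u<w (proj₁ w∈) forward)))
          ; (inj₂ backward) → inj₂ (proj₂ (proj₂ (consecutive-backward⁻ u<w (proj₁ w∈) backward))) }
      ; third = λ {u} {w} u<w w<n →
          let (k , k∈ , k≢u , k≢w) = third-element S {v u} {v w} (IsPiece.isPolygon S-piece)
                                       (<⇒≢ u<w ∘ vtx-injective o (<-trans u<w w<n) w<n)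
          in pos o k , at-pos k∈ , (λ eq → k≢u (trans (sym (vtx-pos o k)) (cong v eq)))
                                 , (λ eq → k≢w (trans (sym (vtx-pos o k)) (cong v eq)))
      }
      where
      wrapped : ∀ {u w} → u < w → w < n → v u ≡ v (suc w) → u ≡ 0 × suc w ≡ n
      wrapped {u} {w} u<w w<n eq with m≤n⇒m<n∨m≡n w<n
      ... | inj₁ 1+w<n = ⊥-elim (<⇒≢ (m<n⇒m<1+n u<w) (vtx-injective o (<-trans u<w w<n) 1+w<n eq))
      ... | inj₂ 1+w≡n = vtx-injective o (<-trans u<w w<n) (≤-<-trans z≤n w<n)
                           (trans eq (trans (cong v 1+w≡n) (vtx-wrap o 0))) , 1+w≡n

    gap : ∀ {S e a g} → At S e → At S g → e < a → a < g → ¬ At S a →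
          ∃₂ λ e₀ g₀ → At S e₀ × At S g₀ × e ≤ e₀ × e₀ < a × a < g₀ × g₀ ≤ g × Empty S e₀ g₀
    gap {S} {e} {a} {g} e∈ g∈ e<a a<g a∉ with greatest-in (at? S) e<a e∈ | least-in (at? S) a<g g∈
    ... | e₀ , e≤e₀ , e₀<a , e₀∈ , max | g₀ , a<g₀ , g₀≤g , g₀∈ , min =
      e₀ , g₀ , e₀∈ , g₀∈ , e≤e₀ , e₀<a , a<g₀ , g₀≤g , λ k e₀<k k<g₀ → case <-cmp k a of λ
        { (tri< k<a _ _) → max k e₀<k k<a ; (tri≈ _ refl _) → a∉ ; (tri> _ _ a<k) → min k a<k k<g₀ }

    -- A side that jumps over a position is not a boundary edge.
    drawn-gap : ∀ {S e a g} → LinearPiece S → At S e → At S g → e < a → a < g → Empty S e g → Drawn o e g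
    drawn-gap L e∈ g∈ e<a a<g none with LinearPiece.link L (<-trans e<a a<g) e∈ g∈ none
    ... | inj₁ refl  = ⊥-elim (<⇒≱ e<a (≤-pred a<g))
    ... | inj₂ drawn = drawn

    -- If a were not a vertex of S, the side of S over a would end between a and b and so cross the
    -- drawn chord; likewise for b. Hence the chord joins two vertices of S and must be a side, and
    -- the vertex k under it rules out all but the closing side.
    top-side : ∀ {S a b k e g} → LinearPiece S → Drawn o a b → a < k → k < b → b < n → At S k →
               At S e → e ≤ a → At S g → b ≤ g → Hull S a b
    top-side {S} {a} {b} {k} {e} {g} L drawn a<k k<b b<n k∈ e∈ e≤a g∈ b≤g
      with LinearPiece.uncut L (<-trans a<k k<b) drawn a∈ b∈
      where
      a∈ : At S a
      a∈ with at? S a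
      ... | yes a∈ = a∈
      ... | no a∉ with gap e∈ k∈ (≤∧≢⇒< e≤a (λ { refl → a∉ e∈ })) a<k a∉
      ...   | e₀ , g₀ , e₀∈ , g₀∈ , _ , e₀<a , a<g₀ , g₀≤k , none = ⊥-elim
              (drawn-noncrossing o e₀<a a<g₀ (≤-<-trans g₀≤k k<b) b<n (drawn-gap L e₀∈ g₀∈ e₀<a a<g₀ none) drawn)
      b∈ : At S b
      b∈ with at? S b
      ... | yes b∈ = b∈
      ... | no b∉ with gap k∈ g∈ k<b (≤∧≢⇒< b≤g (λ { refl → b∉ g∈ })) b∉
      ...   | e₀ , g₀ , e₀∈ , g₀∈ , k≤e₀ , e₀<b , b<g₀ , g₀≤g , none = ⊥-elim
              (drawn-noncrossing o (<-≤-trans a<k k≤e₀) e₀<b b<g₀ (≤-<-trans g₀≤g (proj₁ g∈)) drawn (drawn-gap L e₀∈ g₀∈ e₀<b b<g₀ none))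
    ... | inj₁ none = ⊥-elim (none k a<k k<b k∈)
    ... | inj₂ hull = hull

    -- A vertex k of S missing from S′ lies under a side of S′, which is drawn. By `top-side` that
    -- side closes S, so it is the common closing chord, and no room is left for a third vertex of
    -- S′.
    hull-unique : ∀ {S S′ a b} → LinearPiece S → LinearPiece S′ → a < b → At S a → At S b → Hull S a b →
                  At S′ a → At S′ b → Hull S′ a b → ∀ {k} → At S k → At S′ k
    hull-unique {S} {S′} {a} {b} L L′ a<b a∈ b∈ hull a∈′ b∈′ hull′ {k} k∈ with at? S′ k
    ... | yes k∈′ = k∈′
    ... | no k∉′ with gap a∈′ b∈′ (≤∧≢⇒< (proj₁ (hull k k∈)) (λ { refl → k∉′ a∈′ }))
                                  (≤∧≢⇒< (proj₂ (hull k k∈)) (λ { refl → k∉′ b∈′ })) k∉′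
    ...   | c , d , c∈′ , d∈′ , a≤c , c<k , k<d , d≤b , none
      with top-side L (drawn-gap L′ c∈′ d∈′ c<k k<d none) c<k k<d (proj₁ d∈′) k∈ a∈ a≤c b∈ d≤b
    ...     | tight with LinearPiece.third L′ a<b (proj₁ b∈)
    ...       | t , t∈ , t≢a , t≢b = ⊥-elim (none t
                  (≤-<-trans (proj₁ (tight a a∈)) (≤∧≢⇒< (proj₁ (hull′ t t∈)) (t≢a ∘ sym)))
                  (<-≤-trans (≤∧≢⇒< (proj₂ (hull′ t t∈)) t≢b) (proj₂ (tight b b∈))) t∈)

    at⇒≡ : ∀ {S S′} → (∀ {k} → At S k → At S′ k) → (∀ {k} → At S′ k → At S k) → S ≡ S′
    at⇒≡ S⊆ S′⊆ = Subsetₚ.⊆-antisym (λ x∈ → back (S⊆ (at-pos x∈))) (λ x∈ → back (S′⊆ (at-pos x∈)))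
      where
      back : ∀ {S u} → At S (pos o u) → u ∈ S
      back {S} {u} (_ , ∈S) = subst (_∈ S) (vtx-pos o u) ∈S

  -- With the origin at b, the side from a to b becomes the closing side of both pieces.
  same-side⇒≡ : ∀ {S S′ a b} → IsPiece diagonals S → IsPiece diagonals S′ →
                Consecutive S a b → Consecutive S′ a b → S ≡ S′
  same-side⇒≡ {S} {S′} {a} {b} P P′ cons cons′ =
    at⇒≡ (hull-unique (linear P) (linear P′) 0<h z∈ h∈ hull z∈′ h∈′ hull′)
         (hull-unique (linear P′) (linear P) 0<h z∈′ h∈′ hull′ z∈ h∈ hull)
    where
    o = toℕ b
    open Linear o
    h = pos o a
    origin : vtx o 0 ≡ b
    origin = vtx-origin b
    0<h : 0 < h
    0<h = ℕₚ.n≢0⇒n>0 λ h≡0 → proj₁ (proj₂ (proj₂ cons)) (trans (sym (vtx-pos o a)) (trans (cong (vtx o) h≡0) origin))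
    rotated : ∀ {T} → Consecutive T a b → At T 0 × At T h × Hull T 0 h
    rotated {T} c = consecutive-backward⁻ 0<h (pos-< o a) (subst₂ (Consecutive T) (sym (vtx-pos o a)) (sym origin) c)
    z∈ = proj₁ (rotated cons)
    h∈ = proj₁ (proj₂ (rotated cons))
    hull = proj₂ (proj₂ (rotated cons))
    z∈′ = proj₁ (rotated cons′)
    h∈′ = proj₁ (proj₂ (rotated cons′))
    hull′ = proj₂ (proj₂ (rotated cons′))

  -- The tree of a dissection

  module Construction (o : ℕ) where

    open Linear o

    private v = vtx o

    -- `farthest` is the maximality of the greedy choice. The exception is the entry chord from a to
    -- d, which may be drawn but is not to be followed.
    record Successor (P : List ℕ) (a d u : ℕ) : Set where
      field
        next     : ℕ
        next∈    : next L.∈ P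
        u<next   : u < next
        linked   : next ≡ suc u ⊎ Drawn o u next
        none     : ∀ k → u < k → k < next → ¬ (k L.∈ P)
        farthest : ∀ w → Drawn o u w → next < w → w ≤ d → u ≡ a × w ≡ d

    successor-∷ : ∀ {P a d u k} → u < k → Successor P a d k → Successor (u ∷ P) a d k
    successor-∷ u<k s = record
      { next = next ; next∈ = there next∈ ; u<next = u<next ; linked = linked
      ; none = λ { j k<j j<next (here refl) → ℕₚ.<-asym k<j u<k
                 ; j k<j j<next (there j∈) → none j k<j j<next j∈ }
      ; farthest = farthest }
      where open Successor s

    farthest-link : ∀ u hi → u < hi → ∃ λ w → u < w × w ≤ hi × (w ≡ suc u ⊎ Drawn o u w) × (∀ j → w < j → j ≤ hi → ¬ Drawn o u j)
    -- The boundary edge to `suc u` is the fallback that keeps the search from failing.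
    farthest-link u hi u<hi with greatest-in (λ w → w ℕ.≟ suc u ⊎-dec drawn? o u w) {suc u} {suc hi} (s≤s u<hi) (inj₁ refl)
    ... | w , u<w , w≤hi , linked , max = w , u<w , ≤-pred w≤hi , linked , λ j w<j j≤hi drawn → max j w<j (s≤s j≤hi) (inj₂ drawn)

    -- Taking the farthest link at every vertex leaves no drawn diagonal running forward past the
    -- next vertex within reach of d. `f` bounds the remaining distance and makes the recursion
    -- structural.
    polyline : ∀ f u {a d} → d ≤ u ℕ.+ f → u ≤ d →
               ∃ λ P → u L.∈ P × d L.∈ P × (∀ k → k L.∈ P → u ≤ k × k ≤ d) × (∀ k → k L.∈ P → k < d → Successor P a d k)
    polyline f u {a} {d} d≤ u≤d with m≤n⇒m<n∨m≡n u≤d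
    ... | inj₂ refl = d ∷ [] , here refl , here refl , (λ { k (here refl) → ≤-refl , ≤-refl })
                    , λ { k (here refl) k<k → ⊥-elim (<-irrefl refl k<k) }
    polyline zero u {a} {d} d≤ u≤d | inj₁ u<d = ⊥-elim (<⇒≱ u<d (subst (d ≤_) (+-identityʳ u) d≤))
    polyline (suc f) u {a} {d} d≤ u≤d | inj₁ u<d with farthest-link u d u<d
    ... | w , u<w , w≤d , linked , max with polyline f w {a} {d}
            (≤-trans d≤ (≤-trans (≤-reflexive (+-suc u f)) (ℕₚ.+-monoˡ-≤ f u<w))) w≤d
    ...   | P , w∈ , d∈ , range , succ = u ∷ P , here refl , there d∈ , range′ , succ′
      where
      range′ : ∀ k → k L.∈ u ∷ P → u ≤ k × k ≤ d
      range′ k (here refl) = ≤-refl , u≤d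
      range′ k (there k∈)  = <⇒≤ (<-≤-trans u<w (proj₁ (range k k∈))) , proj₂ (range k k∈)
      succ′ : ∀ k → k L.∈ u ∷ P → k < d → Successor (u ∷ P) a d k
      succ′ k (here refl) k<d = record
        { next = w ; next∈ = there w∈ ; u<next = u<w ; linked = linked
        ; none = λ { j u<j j<w (here refl) → <-irrefl refl u<j ; j u<j j<w (there j∈) → <⇒≱ j<w (proj₁ (range j j∈)) }
        ; farthest = λ j drawn w<j j≤d → ⊥-elim (max j w<j j≤d drawn) }
      succ′ k (there k∈) k<d = successor-∷ (<-≤-trans u<w (proj₁ (range k k∈))) (succ k k∈ k<d)

    record RootPiece (a d : ℕ) : Set where
      field
        P    : List ℕ
        a∈   : a L.∈ P
        d∈   : d L.∈ P
        hull : ∀ k → k L.∈ P → a ≤ k × k ≤ d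
        succ : ∀ k → k L.∈ P → k < d → Successor P a d k
        b    : ℕ
        b∈   : b L.∈ P
        a<b  : a < b
        b<d  : b < d

    rootPiece : ∀ {a d} → suc a < d → RootPiece a d
    -- The first link is sought only up to the position before the end; otherwise a drawn entry
    -- chord would itself be chosen.
    rootPiece {a} {suc d} (s≤s a<d) with farthest-link a d a<d
    ... | w , a<w , w≤d , linked , max with polyline (suc d) w {a} {suc d} (m≤n+m (suc d) w) (m≤n⇒m≤1+n w≤d)
    ...   | P , w∈ , d∈ , range , succ = record
      { P = a ∷ P ; a∈ = here refl ; d∈ = there d∈ ; hull = hull ; succ = succ′ ; b = w ; b∈ = there w∈ ; a<b = a<w ; b<d = s≤s w≤d }
      where
      hull : ∀ k → k L.∈ a ∷ P → a ≤ k × k ≤ suc d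
      hull k (here refl) = ≤-refl , m≤n⇒m≤1+n (<⇒≤ a<d)
      hull k (there k∈)  = <⇒≤ (<-≤-trans a<w (proj₁ (range k k∈))) , proj₂ (range k k∈)
      succ′ : ∀ k → k L.∈ a ∷ P → k < suc d → Successor (a ∷ P) a (suc d) k
      succ′ k (here refl) k<d = record
        { next = w ; next∈ = there w∈ ; u<next = a<w ; linked = linked
        ; none = λ { j u<j j<w (here refl) → <-irrefl refl u<j ; j u<j j<w (there j∈) → <⇒≱ j<w (proj₁ (range j j∈)) }
        ; farthest = λ j drawn w<j j≤d → case m≤n⇒m<n∨m≡n j≤d of λ
            { (inj₁ j<d) → ⊥-elim (max j w<j (≤-pred j<d) drawn) ; (inj₂ j≡d) → refl , j≡d } }
      succ′ k (there k∈) k<d = successor-∷ (<-≤-trans a<w (proj₁ (range k k∈))) (succ k k∈ k<d)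

    module _ {a d : ℕ} (d<n : d < n) (isRoot : Root a d) (R : RootPiece a d) where

      open RootPiece R
      open DecL ℕ._≟_ using () renaming (_∈?_ to _∈ℕ?_)

      S : Subset n
      S = Vec.tabulate λ u → does (pos o u ∈ℕ? P)

      private
        S⁺ : ∀ {u} → pos o u L.∈ P → u ∈ S
        S⁺ {u} u∈ = Vecₚ.lookup⇒[]= u S (trans (Vecₚ.lookup∘tabulate _ u) (dec-true (pos o u ∈ℕ? P) u∈))

        S⁻ : ∀ {u} → u ∈ S → pos o u L.∈ P
        S⁻ {u} u∈ with pos o u ∈ℕ? P in eq
        ... | yes u∈P = u∈P
        ... | no _ with trans (sym (Vecₚ.[]=⇒lookup u∈)) (trans (Vecₚ.lookup∘tabulate _ u) (cong does eq))
        ...   | ()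

        <n : ∀ {k} → k L.∈ P → k < n
        <n k∈ = ≤-<-trans (proj₂ (hull _ k∈)) d<n

      at⁺ : ∀ {k} → k L.∈ P → At S k
      at⁺ k∈ = <n k∈ , S⁺ (subst (L._∈ P) (sym (pos-vtx o (<n k∈))) k∈)

      at⁻ : ∀ {k} → At S k → k L.∈ P
      at⁻ (k<n , k∈) = subst (L._∈ P) (pos-vtx o k<n) (S⁻ k∈)

      private
        a<d = <-trans a<b b<d

        -- A drawn diagonal reaching past the next vertex can only be the entry chord, which closes
        -- the polygon; any other one ends at the next vertex.
        uncut-ordered : ∀ {u w} → u < w → Drawn o u w → u L.∈ P → w L.∈ P → Consecutive S (v u) (v w) ⊎ Consecutive S (v w) (v u)
        uncut-ordered {u} {w} u<w drawn u∈ w∈ with succ u u∈ (<-≤-trans u<w (proj₂ (hull w w∈)))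
        ... | s with Successor.next s ℕ.<? w
        ...   | yes next<w with Successor.farthest s w drawn next<w (proj₂ (hull w w∈))
        ...     | refl , refl = inj₂ (consecutive-backward⁺ u<w d<n (at⁺ u∈) (at⁺ w∈) λ k k∈ → hull k (at⁻ k∈))
        uncut-ordered {u} {w} u<w drawn u∈ w∈ | s | no next≮w = inj₁ (consecutive-forward⁺ u<w (<n w∈) (at⁺ u∈) (at⁺ w∈)
          λ k u<k k<w k∈ → Successor.none s k u<k (<-≤-trans k<w (≮⇒≥ next≮w)) (at⁻ k∈))

        closing : Root a d → v a ≡ v d ⊕ 1 ⊎ Drawn o d a
        closing (inj₂ drawn)        = inj₂ (drawn-sym o drawn)
        closing (inj₁ (refl , 1+d≡n)) = inj₁ (sym (trans (vtx-⊕ o d 1) (trans (cong v (trans (+-comm d 1) 1+d≡n)) (vtx-wrap o 0))))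

        bounded : ∀ x y → Consecutive S x y → y ≡ x ⊕ 1 ⊎ ((x , y) L.∈ diagonals ⊎ (y , x) L.∈ diagonals)
        bounded x y c = subst₂ (λ x y → y ≡ x ⊕ 1 ⊎ ((x , y) L.∈ diagonals ⊎ (y , x) L.∈ diagonals)) (vtx-pos o x) (vtx-pos o y)
          (go (S⁻ (proj₁ c)) (S⁻ (proj₁ (proj₂ c))) (subst₂ (Consecutive S) (sym (vtx-pos o x)) (sym (vtx-pos o y)) c))
          where
          go : ∀ {u w} → u L.∈ P → w L.∈ P → Consecutive S (v u) (v w) → v w ≡ v u ⊕ 1 ⊎ Drawn o u w
          go {u} {w} u∈ w∈ c with <-cmp u w
          ... | tri≈ _ refl _ = ⊥-elim (proj₁ (proj₂ (proj₂ c)) refl)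
          ... | tri< u<w _ _ with consecutive-forward⁻ u<w (<n w∈) c | succ u u∈ (<-≤-trans u<w (proj₂ (hull w w∈)))
          ...   | _ , _ , none | s with <-cmp (Successor.next s) w
          ...     | tri< next<w _ _ = ⊥-elim (none _ (Successor.u<next s) next<w (at⁺ (Successor.next∈ s)))
          ...     | tri> _ _ w<next = ⊥-elim (Successor.none s w u<w w<next w∈)
          ...     | tri≈ _ refl _ = Sum.map₁ (λ eq → trans (cong v (trans eq (+-comm 1 u))) (sym (vtx-⊕ o u 1))) (Successor.linked s)
          go {u} {w} u∈ w∈ c | tri> _ _ w<u with consecutive-backward⁻ w<u (<n u∈) c
          ... | _ , _ , within with ≤-antisym (proj₁ (within a (at⁺ a∈))) (proj₁ (hull w w∈))
                                  | ≤-antisym (proj₂ (within d (at⁺ d∈))) (proj₂ (hull u u∈))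
          ...   | refl | refl = closing isRoot

        uncut : ∀ x y → (x , y) L.∈ diagonals → x ∈ S → y ∈ S → SideOf S (x , y)
        uncut x y ∈ds x∈ y∈ = subst₂ (λ x y → SideOf S (x , y)) (vtx-pos o x) (vtx-pos o y) go
          where
          ∈ds′ : (v (pos o x) , v (pos o y)) L.∈ diagonals
          ∈ds′ = subst₂ (λ x y → (x , y) L.∈ diagonals) (sym (vtx-pos o x)) (sym (vtx-pos o y)) ∈ds
          go : SideOf S (v (pos o x) , v (pos o y))
          go with <-cmp (pos o x) (pos o y)
          ... | tri< x<y _ _ = uncut-ordered x<y (inj₁ ∈ds′) (S⁻ x∈) (S⁻ y∈)
          ... | tri> _ _ y<x = Sum.swap (uncut-ordered y<x (inj₂ ∈ds′) (S⁻ y∈) (S⁻ x∈))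
          ... | tri≈ _ x≡y _ = ⊥-elim (<-irrefl (cong toℕ (trans (sym (vtx-pos o x)) (trans (cong v x≡y) (vtx-pos o y))))
                                 (proj₁ (diagonal ∈ds)))

      -- This makes completeness of the pieces applicable, which supplies the label at the root of
      -- the tree.
      S-isPiece : IsPiece diagonals S
      S-isPiece = record
        { isPolygon = three-elements (proj₂ (at⁺ a∈)) (proj₂ (at⁺ b∈)) (proj₂ (at⁺ d∈))
            (apart a<b b∈) (apart a<d d∈) (apart b<d d∈)
        ; bounded = bounded
        ; uncut = uncut }
        where
        apart : ∀ {u w} → u < w → w L.∈ P → v u ≢ v w
        apart u<w w∈ eq = <⇒≢ u<w (vtx-injective o (<-trans u<w (<n w∈)) (<n w∈) eq)

    κ : Fin m → ℕ
    κ l = degree l ∸ 2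

    In : Fin m → ℕ → Set
    In l = At (piece l)

    open Trees κ In public

    points : ∀ {l k b c} → Mids l k b c → List ℕ
    points {b = b} []            = b ∷ []
    points (cons {a = b} _ _ ms) = b ∷ points ms

    length-points : ∀ {l k b c} (ms : Mids l k b c) → length (points ms) ≡ suc k
    length-points []            = refl
    length-points (cons _ _ ms) = cong suc (length-points ms)

    points-range : ∀ {l k b c} (ms : Mids l k b c) → All (λ j → b ≤ j × j ≤ c) (points ms)
    points-range [] = (≤-refl , ≤-refl) ∷ []
    points-range (cons _ t ms) = (≤-refl , ≤-trans (<⇒≤ (tree-< t)) (mids-≤ ms))
      ∷ All.map (λ (b≤j , j≤c) → ≤-trans (<⇒≤ (tree-< t)) b≤j , j≤c) (points-range ms)

    points-increasing : ∀ {l k b c} (ms : Mids l k b c) → AllPairs _<_ (points ms)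
    points-increasing [] = [] ∷ []
    points-increasing (cons _ t ms) = All.map (λ (b≤j , _) → <-≤-trans (tree-< t) b≤j) (points-range ms) ∷ points-increasing ms

    points-in : ∀ {l k b c} → In l b → (ms : Mids l k b c) → All (In l) (points ms)
    points-in l∋b []            = l∋b ∷ []
    points-in l∋b (cons σ _ ms) = l∋b ∷ points-in (Side.inʳ σ) ms

    points-complete : ∀ {l k b c j} (ms : Mids l k b c) → In l j → b ≤ j → j ≤ c → j L.∈ points ms
    points-complete [] l∋j b≤j j≤b = here (≤-antisym j≤b b≤j)
    points-complete {j = j} (cons {b = b} σ t ms) l∋j a≤j j≤c with j ℕ.<? b
    ... | no j≮b = there (points-complete ms l∋j (≮⇒≥ j≮b) j≤c)
    ... | yes j<b with m≤n⇒m<n∨m≡n a≤j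
    ...   | inj₁ a<j  = ⊥-elim (Side.between σ a<j j<b l∋j)
    ...   | inj₂ refl = here refl

    -- The vertices of l are a, the k + 1 joints and d, so its degree is k + 3.
    degree-mids : ∀ {l a b c d k} → Within a d l → Side l a b → a < b → (ms : Mids l k b c) → Side l c d → c < d →
                  κ l ≡ suc k
    degree-mids {l} {a} {b} {c} {d} {k} w σ a<b ms σ′ c<d = cong (_∸ 2) (begin
      degree l                       ≡⟨ cardinality unique ⊆ ⊇ ⟩
      length (map v all)             ≡⟨ Listₚ.length-map v all ⟩
      suc (length (points ms ++ d ∷ [])) ≡⟨ cong suc (trans (Listₚ.length-++ (points ms)) (+-comm _ 1)) ⟩
      suc (suc (length (points ms))) ≡⟨ cong (λ z → suc (suc z)) (length-points ms) ⟩
      suc (suc (suc k))              ∎)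
      where
      open ≡-Reasoning
      all = a ∷ points ms ++ d ∷ []
      increasing : AllPairs _<_ all
      increasing =
        Allₚ.++⁺ (All.map (λ (b≤j , _) → <-≤-trans a<b b≤j) (points-range ms))
                 (<-≤-trans a<b (≤-trans (mids-≤ ms) (<⇒≤ c<d)) ∷ [])
        ∷ AllPairsₚ.++⁺ (points-increasing ms) ([] ∷ []) (All.map (λ (_ , j≤c) → ≤-<-trans j≤c c<d ∷ []) (points-range ms))
      all-in : All (In l) all
      all-in = Side.inˡ σ ∷ Allₚ.++⁺ (points-in (Side.inʳ σ) ms) (Side.inʳ σ′ ∷ [])
      unique-map : ∀ {js} → All (In l) js → AllPairs _<_ js → Unique (map v js)
      unique-map [] [] = []
      unique-map {j ∷ js} ((j<n , _) ∷ ins) (j< ∷ inc) =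
        Allₚ.map⁺ (All.zipWith (λ (j<i , (i<n , _)) eq → <⇒≢ j<i (vtx-injective o j<n i<n eq)) (j< , ins)) ∷ unique-map ins inc
      unique = unique-map all-in increasing
      complete : ∀ {j} → In l j → j L.∈ all
      complete {j} l∋j with m≤n⇒m<n∨m≡n (proj₁ (w j l∋j)) | m≤n⇒m<n∨m≡n (proj₂ (w j l∋j)) | j ℕ.<? b | c ℕ.<? j
      ... | inj₂ refl | _ | _ | _ = here refl
      ... | _ | inj₂ refl | _ | _ = there (Lₚ.∈-++⁺ʳ (points ms) (here refl))
      ... | inj₁ a<j | _ | yes j<b | _ = ⊥-elim (Side.between σ a<j j<b l∋j)
      ... | _ | inj₁ j<d | _ | yes c<j = ⊥-elim (Side.between σ′ c<j j<d l∋j)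
      ... | inj₁ _ | inj₁ _ | no j≮b | no c≮j = there (Lₚ.∈-++⁺ˡ (points-complete ms l∋j (≮⇒≥ j≮b) (≮⇒≥ c≮j)))
      ⊆ : ∀ {u} → u ∈ piece l → u L.∈ map v all
      ⊆ {u} u∈ = subst (L._∈ map v all) (vtx-pos o u) (Lₚ.∈-map⁺ v (complete (at-pos u∈)))
      ⊇ : ∀ {u} → u L.∈ map v all → u ∈ piece l
      ⊇ u∈ with Lₚ.∈-map⁻ v u∈
      ... | j , j∈ , refl = proj₂ (All.lookup all-in j∈)

    -- The sides of the greedy polygon other than the entry chord are boundary edges or drawn
    -- diagonals, and each is the entry chord of a child. `f` bounds the width.
    tree : ∀ f {a d} → d ≤ a ℕ.+ f → a < d → d < n → (suc a < d → Root a d) → Tree a d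
    tree zero {a} {d} d≤ a<d _ _ = ⊥-elim (<⇒≱ a<d (subst (d ≤_) (+-identityʳ a) d≤))
    tree (suc f) {a} {d} d≤ a<d d<n root with m≤n⇒m<n∨m≡n a<d
    ... | inj₂ refl = leaf
    ... | inj₁ 1+a<d = rooted (piece-complete _ (S-isPiece d<n (root 1+a<d) R))
      where
      R = rootPiece 1+a<d
      open RootPiece R
      T = S d<n (root 1+a<d) R
      child : ∀ {u w} → u < w → w ≤ d → w ≤ u ℕ.+ f → w ≡ suc u ⊎ Drawn o u w → Tree u w
      child u<w w≤d w≤ linked = tree f w≤ u<w (≤-<-trans w≤d d<n)
        -- A child wider than one edge cannot be linked by a boundary edge, so its chord is drawn.
        λ 1+u<w → case linked of λ { (inj₁ refl) → ⊥-elim (<-irrefl refl 1+u<w) ; (inj₂ drawn) → inj₂ drawn }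
      later : ∀ {u w} → a < u → w ≤ d → w ≤ u ℕ.+ f
      later {u} a<u w≤d = ≤-trans w≤d (≤-trans d≤ (≤-trans (≤-reflexive (+-suc a f)) (ℕₚ.+-monoˡ-≤ f a<u)))
      rooted : (∃ λ l → piece l ≡ T) → Tree a d
      rooted (l , eq) = assemble (succ a a∈ a<d)
        where
        in⁺ : ∀ {k} → k L.∈ P → In l k
        in⁺ {k} k∈ = subst (λ T → At T k) (sym eq) (at⁺ d<n (root 1+a<d) R k∈)
        in⁻ : ∀ {k} → In l k → k L.∈ P
        in⁻ {k} l∋k = at⁻ d<n (root 1+a<d) R (subst (λ T → At T k) eq l∋k)
        sideTo : ∀ {u} → u L.∈ P → (s : Successor P a d u) → Side l u (Successor.next s)
        sideTo u∈ s = side (in⁺ u∈) (in⁺ (Successor.next∈ s)) λ u<k k<next l∋k → Successor.none s _ u<k k<next (in⁻ l∋k)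
        remaining : ∀ g {u} → d ≤ u ℕ.+ g → u L.∈ P → a < u → u < d →
                    ∃₂ λ k c → Mids l k u c × Side l c d × Tree c d
        remaining zero {u} d≤ u∈ a<u u<d = ⊥-elim (<⇒≱ u<d (subst (d ≤_) (+-identityʳ u) d≤))
        remaining (suc g) {u} d≤ u∈ a<u u<d with succ u u∈ u<d
        ... | s with m≤n⇒m<n∨m≡n (proj₂ (hull _ (Successor.next∈ s)))
        ...   | inj₂ refl = 0 , u , [] , sideTo u∈ s , child (Successor.u<next s) ≤-refl (later a<u ≤-refl) (Successor.linked s)
        ...   | inj₁ next<d with remaining g
                  (≤-trans d≤ (≤-trans (≤-reflexive (+-suc u g)) (ℕₚ.+-monoˡ-≤ g (Successor.u<next s))))
                  (Successor.next∈ s) (<-trans a<u (Successor.u<next s)) next<d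
        ...     | k , c , ms , σ′ , t′ = suc k , c ,
                  cons (sideTo u∈ s) (child (Successor.u<next s) (<⇒≤ next<d) (later a<u (<⇒≤ next<d)) (Successor.linked s)) ms , σ′ , t′
        -- The intermediate vertex b keeps the first child from reaching d, so that the last child
        -- is a different one.
        next<d : (s : Successor P a d a) → Successor.next s < d
        next<d s = ≤-<-trans (≮⇒≥ λ b<next → Successor.none s b a<b b<next b∈) b<d
        assemble : Successor P a d a → Tree a d
        assemble s with remaining d (m≤n+m d _) (Successor.next∈ s) (Successor.u<next s) (next<d s)
        ... | k , c , ms , σ′ , t′ = node l
          (degree-mids (λ j l∋j → hull j (in⁻ l∋j)) (sideTo a∈ s) (Successor.u<next s) ms σ′ (tree-< t′))
          (λ j l∋j → hull j (in⁻ l∋j)) (sideTo a∈ s)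
          (child (Successor.u<next s) (<⇒≤ (next<d s))
            (≤-pred (≤-trans (next<d s) (≤-trans d≤ (≤-reflexive (+-suc a f))))) (Successor.linked s))
          ms σ′ t′

    TwoPoints : Fin m → Set
    TwoPoints l = ∃₂ λ u w → u < w × In l u × In l w

    labels-two  : ∀ {a c} (t : Tree a c) → All TwoPoints (labels t)
    mlabels-two : ∀ {l k a c} (ms : Mids l k a c) → All TwoPoints (mlabels ms)

    labels-two leaf = []
    labels-two (node l _ w σ t ms σ′ u) =
      (_ , _ , tree-< t , Side.inˡ σ , Side.inʳ σ) ∷ Allₚ.++⁺ (labels-two t) (Allₚ.++⁺ (mlabels-two ms) (labels-two u))
    mlabels-two [] = []
    mlabels-two (cons _ t ms) = Allₚ.++⁺ (labels-two t) (mlabels-two ms)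

    -- A piece within both ranges could have only the position b, but each has two.
    separate : ∀ {a b c ls ls′} → Unique ls → Unique ls′ → All (Within a b) ls → All (Within b c) ls′ → All TwoPoints ls →
               Unique (ls ++ ls′)
    separate !ls !ls′ w w′ two = Uniqueₚ.++⁺ !ls !ls′ λ (l∈ , l∈′) →
      let (u , z , u<z , l∋u , l∋z) = All.lookup two l∈
      in <⇒≱ u<z (≤-trans (proj₂ (All.lookup w l∈ z l∋z)) (proj₁ (All.lookup w′ l∈′ u l∋u)))

    labels-unique  : ∀ {a c} (t : Tree a c) → Unique (labels t)
    mlabels-unique : ∀ {l k a c} (ms : Mids l k a c) → Unique (mlabels ms)

    labels-unique leaf = []
    labels-unique (node l _ w σ t ms σ′ u) =
      Allₚ.++⁺ (All.map (λ { wl refl → <⇒≱ b<d (proj₂ (wl _ (Side.inʳ σ′))) }) (labels-within t))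
               (All.map (λ { wl refl → <⇒≱ (tree-< t) (proj₁ (wl _ (Side.inˡ σ))) }) (suffix-within ms u))
      ∷ separate (labels-unique t) (separate (mlabels-unique ms) (labels-unique u) (mlabels-within ms) (labels-within u) (mlabels-two ms))
          (labels-within t) (suffix-within ms u) (labels-two t)
      where b<d = suffix-< ms u
    mlabels-unique [] = []
    mlabels-unique (cons _ t ms) = separate (labels-unique t) (mlabels-unique ms) (labels-within t) (mlabels-within ms) (labels-two t)

    abstract
      linear-piece : ∀ l → LinearPiece (piece l)
      linear-piece l = linear (piece-isPiece l)

    piece-unique : ∀ {l l′ a b} → a < b → In l a → In l b → Within a b l → In l′ a → In l′ b → Within a b l′ → l ≡ l′
    piece-unique {l} {l′} a<b a∈ b∈ w a∈′ b∈′ w′ = piece-injective (at⇒≡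
      (hull-unique (linear-piece l) (linear-piece l′) a<b a∈ b∈ w a∈′ b∈′ w′)
      (hull-unique (linear-piece l′) (linear-piece l) a<b a∈′ b∈′ w′ a∈ b∈ w))

    module _ {l : Fin m} {u w : ℕ} (u<w : u < w) (l∋u : In l u) (l∋w : In l w) (wl : Within u w l) where

      wide : suc u < w
      wide with LinearPiece.third (linear-piece l) u<w (proj₁ l∋w)
      ... | k , k∈ , k≢u , k≢w = ≤-<-trans (≤∧≢⇒< (proj₁ (wl k k∈)) (k≢u ∘ sym)) (≤∧≢⇒< (proj₂ (wl k k∈)) k≢w)

      Skips : Fin m → Set
      Skips l₀ = ∀ {k} → u < k → k < w → ¬ In l₀ k

      -- If the root piece l₀ had a vertex strictly under the closing chord of l, `top-side` would
      -- make that chord close l₀ as well, and then the two pieces coincide.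
      root-or-below : ∀ {l₀ a d} → a < d → In l₀ a → In l₀ d → Within a d l₀ → a ≤ u → w ≤ d →
                      Drawn o u w ⊎ (u ≡ a × w ≡ d) → l ≡ l₀ ⊎ (Skips l₀ × Drawn o u w)
      root-or-below a<d a∈ d∈ w₀ a≤u w≤d (inj₂ (refl , refl)) = inj₁ (piece-unique u<w l∋u l∋w wl a∈ d∈ w₀)
      root-or-below {l₀} {a} {d} a<d a∈ d∈ w₀ a≤u w≤d (inj₁ drawn) with u ℕ.≟ a ×-dec w ℕ.≟ d
      ... | yes (refl , refl) = inj₁ (piece-unique u<w l∋u l∋w wl a∈ d∈ w₀)
      ... | no not-top = inj₂ ((λ u<k k<w k∈ →
        let tight = top-side (linear-piece l₀) drawn u<k k<w (proj₁ l∋w) k∈ a∈ a≤u d∈ w≤d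
        in not-top (≤-antisym (proj₁ (tight a a∈)) a≤u , ≤-antisym w≤d (proj₂ (tight d d∈)))) , drawn)

      which-side : ∀ {l₀ b} → In l₀ b → Skips l₀ → w ≤ b ⊎ b ≤ u
      which-side {b = b} b∈ none with w ℕ.≤? b
      ... | yes w≤b = inj₁ w≤b
      ... | no w≰b  = inj₂ (≮⇒≥ λ u<b → none u<b (≰⇒> w≰b) b∈)

      -- The closing chord of l is followed downwards: as long as l is not the root piece, no vertex
      -- of the root lies strictly under the chord, so the chord lies under a single child.
      find  : ∀ {a c} (t : Tree a c) → c < n → a ≤ u → w ≤ c → Drawn o u w ⊎ (u ≡ a × w ≡ c) → l L.∈ labels t
      mfind : ∀ {l₀ k b c d} (ms : Mids l₀ k b c) (t : Tree c d) → In l₀ b → Skips l₀ →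
              d < n → b ≤ u → w ≤ d → Drawn o u w → l L.∈ mlabels ms ++ labels t

      find leaf c<n a≤u w≤c _ = ⊥-elim (<⇒≱ (<-≤-trans wide w≤c) (s≤s a≤u))
      find (node l₀ _ w₀ σ t ms σ′ t′) d<n a≤u w≤d top = Sum.[ here , (λ (none , drawn) → there (Sum.[
          (λ w≤b → Lₚ.∈-++⁺ˡ (find t (<-trans (suffix-< ms t′) d<n) a≤u w≤b (inj₁ drawn))) ,
          (λ b≤u → Lₚ.∈-++⁺ʳ (labels t) (mfind ms t′ (Side.inʳ σ) none d<n b≤u w≤d drawn)) ]′
            (which-side (Side.inʳ σ) none))) ]′
        (root-or-below (<-trans (tree-< t) (suffix-< ms t′)) (Side.inˡ σ) (Side.inʳ σ′) w₀ a≤u w≤d top)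

      mfind [] t _ none d<n b≤u w≤d drawn = find t d<n b≤u w≤d (inj₁ drawn)
      mfind (cons σ t ms) t′ _ none d<n b≤u w≤d drawn =
        subst (l L.∈_) (sym (Listₚ.++-assoc (labels t) (mlabels ms) (labels t′))) (Sum.[
          (λ w≤b → Lₚ.∈-++⁺ˡ (find t (<-trans (suffix-< ms t′) d<n) b≤u w≤b (inj₁ drawn))) ,
          (λ b≤u → Lₚ.∈-++⁺ʳ (labels t) (mfind ms t′ (Side.inʳ σ) none d<n b≤u w≤d drawn)) ]′
            (which-side (Side.inʳ σ) none))

    -- The extreme positions of a piece carry its closing side, which is drawn or is the root edge;
    -- `find` then locates the piece.
    labels-complete : ∀ {N} → suc N ≡ n → 0 < N → (t : Tree 0 N) → ∀ l → l L.∈ labels t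
    labels-complete {N} refl 0<N t l with LinearPiece.third (linear-piece l) {0} {N} 0<N (n<1+n N)
    ... | k , k∈ , _ with least-in (at? (piece l)) z≤n k∈ | greatest-in (at? (piece l)) (proj₁ k∈) k∈
    ... | u , _ , u≤k , u∈ , min | w , k≤w , w<n , w∈ , max = find u<w u∈ w∈ hull t (n<1+n N) z≤n (≤-pred w<n) top
      where
      hull : Within u w l
      hull j j∈ = ≮⇒≥ (λ j<u → min j z≤n j<u j∈) , ≮⇒≥ (λ w<j → max j w<j (proj₁ j∈) j∈)
      u<w : u < w
      u<w with m≤n⇒m<n∨m≡n (≤-trans u≤k k≤w)
      ... | inj₁ u<w = u<w
      -- Coinciding extremes would leave the piece a single position, contrary to its having at
      -- least three vertices.
      ... | inj₂ refl with LinearPiece.third (linear-piece l) {0} {N} 0<N (n<1+n N) | u ℕ.≟ 0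
      ...   | j , j∈ , j≢0 , _ | yes refl = ⊥-elim (j≢0 (ℕₚ.n≤0⇒n≡0 (proj₂ (hull j j∈))))
      ...   | _ | no u≢0 with LinearPiece.third (linear-piece l) {0} {u} (ℕₚ.n≢0⇒n>0 u≢0) w<n
      ...     | j , j∈ , _ , j≢u = ⊥-elim (j≢u (≤-antisym (proj₂ (hull j j∈)) (proj₁ (hull j j∈))))
      top : Drawn o u w ⊎ (u ≡ 0 × w ≡ N)
      top with LinearPiece.root (linear-piece l) u<w u∈ w∈ hull
      ... | inj₁ (u≡0 , 1+w≡n) = inj₂ (u≡0 , ℕₚ.suc-injective 1+w≡n)
      ... | inj₂ drawn = inj₁ drawn

-- Zig-zag sequences as paths in the tree

module ZigZags {n : ℕ} .{{_ : NonZero n}} {m : ℕ} (D : Dissection n m) where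

  open Dissection D
  open Positions {n}
  open Geometry D

  -- Zig-zag sequences from z to f whose pieces avoid a given list.
  data Zig (f : Segment n) : Segment n → List (Fin m) → Set where
    last : ∀ {z used} l → All (l ≢_) used → SideOf (piece l) z → SideOf (piece l) f → Incident z f → Zig f z used
    step : ∀ {z z′ used} l → All (l ≢_) used → SideOf (piece l) z → SideOf (piece l) z′ → Incident z z′ →
           z′ L.∈ diagonals → Zig f z′ (l ∷ used) → Zig f z used

  zig-head : ∀ {f z used} → Zig f z used → ∃ λ l → All (l ≢_) used × SideOf (piece l) z
  zig-head (last l l∉ z∈ _ _)     = l , l∉ , z∈
  zig-head (step l l∉ z∈ _ _ _ _) = l , l∉ , z∈

  zigzag⇒zig : ∀ {e f} → e ≢ f → ZigZag D e f → Zig f e []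
  zigzag⇒zig e≢f record { s = zero ; starts = refl ; ends = refl } = ⊥-elim (e≢f refl)
  zigzag⇒zig e≢f record { s = suc s ; z = z ; p = p ; starts = refl ; ends = ends ; inner = inner
                        ; common = common ; p-different = p-different ; incident = incident } =
    walk s z p ends inner common p-different incident (λ _ → [])
    where
    walk : ∀ {f used} s (z : Fin (suc (suc s)) → Segment n) (p : Fin (suc s) → Fin m) → z (fromℕ (suc s)) ≡ f →
           (∀ k → 0 < toℕ k → toℕ k < suc s → z k L.∈ diagonals) →
           (∀ k → SideOf (piece (p k)) (z (inject₁ k)) × SideOf (piece (p k)) (z (suc k))) →
           Injective _≡_ _≡_ p → (∀ k → Incident (z (inject₁ k)) (z (suc k))) → (∀ k → All (p k ≢_) used) → Zig f (z zero) used
    walk zero    z p refl inner common p-inj incident fresh =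
      last (p zero) (fresh zero) (proj₁ (common zero)) (proj₂ (common zero)) (incident zero)
    walk (suc s) z p ends inner common p-inj incident fresh =
      step (p zero) (fresh zero) (proj₁ (common zero)) (proj₂ (common zero)) (incident zero) (inner (suc zero) (s≤s z≤n) (s≤s (s≤s z≤n)))
        (walk s (z ∘ suc) (p ∘ suc) ends (λ k 0<k k<s → inner (suc k) (s≤s z≤n) (s≤s k<s)) (λ k → common (suc k))
          (Finₚ.suc-injective ∘ p-inj) (λ k → incident (suc k))
          (λ k → (λ eq → case p-inj eq of λ ()) ∷ fresh (suc k)))

  zig⇒zigzag : ∀ {f z used} → Zig f z used → Σ (ZigZag D z f) λ Z → ∀ k → All (ZigZag.p Z k ≢_) used
  zig⇒zigzag {f} {z} (last l l∉ z∈ f∈ inc) = record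
    { s = 1 ; z = λ { zero → z ; (suc _) → f } ; p = λ _ → l ; starts = refl ; ends = refl
    ; inner = λ { (suc zero) _ (s≤s ()) } ; common = λ { zero → z∈ , f∈ } ; p-different = λ { {zero} {zero} _ → refl }
    ; incident = λ { zero → inc } } , λ _ → l∉
  zig⇒zigzag {f} {z} {used} (step {z′ = z′} l l∉ z∈ z′∈ inc z′∈ds rest) with zig⇒zigzag rest
  ... | Z , fresh = record
    { s = suc s ; z = zs ; p = ps ; starts = refl ; ends = ends
    ; inner = inner′
    ; common = λ { zero → z∈ , subst (SideOf (piece l)) (sym starts) z′∈ ; (suc k) → common k }
    ; p-different = λ { {zero} {zero} _ → refl ; {zero} {suc k} eq → ⊥-elim (All.head (fresh k) (sym eq))
                      ; {suc k} {zero} eq → ⊥-elim (All.head (fresh k) eq) ; {suc j} {suc k} eq → cong suc (p-different eq) }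
    ; incident = λ { zero → subst (Incident z) (sym starts) inc ; (suc k) → incident k } }
    , λ { zero → l∉ ; (suc k) → All.tail (fresh k) }
    where
    open ZigZag Z renaming (z to zs₀)
    zs : Fin (suc (suc s)) → Segment n
    zs zero    = z
    zs (suc k) = zs₀ k
    ps : Fin (suc s) → Fin m
    ps zero    = l
    ps (suc k) = p k
    inner′ : ∀ k → 0 < toℕ k → toℕ k < suc s → zs k L.∈ diagonals
    inner′ (suc zero)    _ _         = subst (L._∈ diagonals) (sym starts) z′∈ds
    inner′ (suc (suc k)) _ (s≤s k<s) = inner (suc k) (s≤s z≤n) k<s

  module Descent (o : ℕ) where

    open Linear o
    open Construction o

    private v = vtx o

    Joins : Segment n → ℕ → ℕ → Set
    Joins z u w = z ≡ (v u , v w) ⊎ z ≡ (v w , v u)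

    joins : ∀ {l z} → SideOf (piece l) z → ∃₂ λ u w → u < w × w < n × Joins z u w
    joins {l} {x , y} isSide with <-cmp (pos o x) (pos o y)
    ... | tri< x<y _ _ = _ , _ , x<y , pos-< o y , inj₁ (sym (cong₂ _,_ (vtx-pos o x) (vtx-pos o y)))
    ... | tri> _ _ y<x = _ , _ , y<x , pos-< o x , inj₂ (sym (cong₂ _,_ (vtx-pos o x) (vtx-pos o y)))
    ... | tri≈ _ x≡y _ = ⊥-elim (proper isSide (trans (sym (vtx-pos o x)) (trans (cong v x≡y) (vtx-pos o y))))
      where
      proper : SideOf (piece l) (x , y) → x ≢ y
      proper (inj₁ c) = proj₁ (proj₂ (proj₂ c))
      proper (inj₂ c) = proj₁ (proj₂ (proj₂ c)) ∘ sym

    sideOf-forward : ∀ {l z u w} → Joins z u w → Consecutive (piece l) (v u) (v w) → SideOf (piece l) z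
    sideOf-forward (inj₁ refl) c = inj₁ c
    sideOf-forward (inj₂ refl) c = inj₂ c

    sideOf-backward : ∀ {l z u w} → Joins z u w → Consecutive (piece l) (v w) (v u) → SideOf (piece l) z
    sideOf-backward (inj₁ refl) c = inj₂ c
    sideOf-backward (inj₂ refl) c = inj₁ c

    sideOf⁻ : ∀ {l z u w} → Joins z u w → SideOf (piece l) z → Consecutive (piece l) (v u) (v w) ⊎ Consecutive (piece l) (v w) (v u)
    sideOf⁻ (inj₁ refl) = λ s → s
    sideOf⁻ (inj₂ refl) = Sum.swap

    incident⁺ : ∀ {z z′ u w u′ w′} → Joins z u w → Joins z′ u′ w′ → v u ≡ v u′ ⊎ v w ≡ v w′ → Incident z z′
    incident⁺ (inj₁ refl) (inj₁ refl) (inj₁ eq) = inj₁ (inj₁ eq)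
    incident⁺ (inj₁ refl) (inj₁ refl) (inj₂ eq) = inj₂ (inj₂ eq)
    incident⁺ (inj₁ refl) (inj₂ refl) (inj₁ eq) = inj₁ (inj₂ eq)
    incident⁺ (inj₁ refl) (inj₂ refl) (inj₂ eq) = inj₂ (inj₁ eq)
    incident⁺ (inj₂ refl) (inj₁ refl) (inj₁ eq) = inj₂ (inj₁ eq)
    incident⁺ (inj₂ refl) (inj₁ refl) (inj₂ eq) = inj₁ (inj₂ eq)
    incident⁺ (inj₂ refl) (inj₂ refl) (inj₁ eq) = inj₂ (inj₂ eq)
    incident⁺ (inj₂ refl) (inj₂ refl) (inj₂ eq) = inj₁ (inj₁ eq)

    Touches : ℕ → ℕ → ℕ → ℕ → Set
    Touches u w u′ w′ = (v u ≡ v u′ ⊎ v w ≡ v w′) ⊎ (v u ≡ v w′ ⊎ v w ≡ v u′)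

    incident⁻ : ∀ {z z′ u w u′ w′} → Joins z u w → Joins z′ u′ w′ → Incident z z′ → Touches u w u′ w′
    incident⁻ (inj₁ refl) (inj₁ refl) = λ
      { (inj₁ (inj₁ eq)) → inj₁ (inj₁ eq) ; (inj₁ (inj₂ eq)) → inj₂ (inj₁ eq) ; (inj₂ (inj₁ eq)) → inj₂ (inj₂ eq) ; (inj₂ (inj₂ eq)) → inj₁ (inj₂ eq) }
    incident⁻ (inj₁ refl) (inj₂ refl) = λ
      { (inj₁ (inj₁ eq)) → inj₂ (inj₁ eq) ; (inj₁ (inj₂ eq)) → inj₁ (inj₁ eq) ; (inj₂ (inj₁ eq)) → inj₁ (inj₂ eq) ; (inj₂ (inj₂ eq)) → inj₂ (inj₂ eq) }
    incident⁻ (inj₂ refl) (inj₁ refl) = λ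
      { (inj₁ (inj₁ eq)) → inj₂ (inj₂ eq) ; (inj₁ (inj₂ eq)) → inj₁ (inj₂ eq) ; (inj₂ (inj₁ eq)) → inj₁ (inj₁ eq) ; (inj₂ (inj₂ eq)) → inj₂ (inj₁ eq) }
    incident⁻ (inj₂ refl) (inj₂ refl) = λ
      { (inj₁ (inj₁ eq)) → inj₁ (inj₂ eq) ; (inj₁ (inj₂ eq)) → inj₂ (inj₂ eq) ; (inj₂ (inj₁ eq)) → inj₂ (inj₁ eq) ; (inj₂ (inj₂ eq)) → inj₁ (inj₁ eq) }

    edge-joins : ∀ p → Joins (edge (v p)) p (suc p)
    edge-joins p = inj₁ (cong (v p ,_) (trans (vtx-⊕ o p 1) (cong v (+-comm p 1))))

    joins-unique : ∀ {z u w u′ w′} → u < w → w < n → u′ < w′ → w′ < n → Joins z u w → Joins z u′ w′ → u ≡ u′ × w ≡ w′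
    joins-unique {u = u} {w} {u′} {w′} u<w w<n u′<w′ w′<n j j′ = go j j′
      where
      u<n = <-trans u<w w<n
      u′<n = <-trans u′<w′ w′<n
      crossed : (v u , v w) ≢ (v w′ , v u′)
      crossed eq with vtx-injective o u<n w′<n (cong proj₁ eq) | vtx-injective o w<n u′<n (cong proj₂ eq)
      ... | refl | refl = ℕₚ.<-asym u<w u′<w′
      straight : (v u , v w) ≡ (v u′ , v w′) → u ≡ u′ × w ≡ w′
      straight eq = vtx-injective o u<n u′<n (cong proj₁ eq) , vtx-injective o w<n w′<n (cong proj₂ eq)
      flip : ∀ {a b c d : Fin n} → (a , b) ≡ (c , d) → (b , a) ≡ (d , c)
      flip refl = refl
      go : ∀ {z} → Joins z u w → Joins z u′ w′ → u ≡ u′ × w ≡ w′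
      go (inj₁ refl) (inj₁ eq) = straight eq
      go (inj₁ refl) (inj₂ eq) = ⊥-elim (crossed eq)
      go (inj₂ refl) (inj₁ eq) = ⊥-elim (crossed (flip eq))
      go (inj₂ refl) (inj₂ eq) = straight (flip eq)

    RootIs : ∀ {a c} → Tree a c → Fin m → Set
    RootIs leaf                   l′ = ⊥
    RootIs (node l _ _ _ _ _ _ _) l′ = l′ ≡ l

    hull-root : ∀ {a c} (t : Tree a c) {l} → In l a → In l c → Within a c l → RootIs t l
    hull-root leaf l∋a l∋c w = <-irrefl refl (wide (n<1+n _) l∋a l∋c w)
    hull-root (node l₀ _ w₀ σ t ms σ′ u) l∋a l∋c w =
      piece-unique (<-trans (tree-< t) (suffix-< ms u)) l∋a l∋c w (Side.inˡ σ) (Side.inʳ σ′) w₀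

    -- The piece having this chord as a forward side is l, by uniqueness. Any other piece with the
    -- chord has it as its closing side and is the root of the subtree below.
    child-root : ∀ {l a b} → Side l a b → b < n → (t : Tree a b) → ∀ {z used} → Joins z a b →
                 ∀ l′ → SideOf (piece l′) z → All (l′ ≢_) (l ∷ used) → RootIs t l′
    child-root {l} {a} {b} σ b<n t j l′ z∈ (l′≢l ∷ _) with sideOf⁻ {l′} j z∈
    ... | inj₁ forward = ⊥-elim (l′≢l (piece-injective (same-side⇒≡ (piece-isPiece l′) (piece-isPiece l) forward
            (consecutive-forward⁺ (tree-< t) b<n (Side.inˡ σ) (Side.inʳ σ) λ k → Side.between σ))))
    ... | inj₂ backward = let (a∈ , b∈ , hull) = consecutive-backward⁻ (tree-< t) b<n backward in hull-root t a∈ b∈ hull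

    narrow-ends : ∀ {a c p} (t : Tree a c) → c ≡ suc a → (π : Path t p) → Ends π
    narrow-ends leaf _ here = here
    narrow-ends (node _ _ _ _ t ms _ u) refl _ =
      ⊥-elim (<⇒≱ (≤-<-trans (≤-trans (tree-< t) (mids-≤ ms)) (tree-< u)) ≤-refl)

    -- Among the sides of l that touch its entry side are only that side itself, the first side at a
    -- and the last side at d. A forward side beginning at d or ending at a would leave the range of
    -- l.
    next-side : ∀ {a b c d k l} → Within a d l → Side l a b → a < b → Mids l k b c → Side l c d → c < d → d < n →
                ∀ {z z′} → Joins z a d → SideOf (piece l) z′ → Incident z z′ →
                Joins z′ a d ⊎ (Joins z′ a b ⊎ Joins z′ c d)
    next-side {a} {b} {c} {d} {l = l} wl σ a<b ms σ′ c<d d<n {z} {z′} j z′∈ inc = go (joins {l} {z′} z′∈)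
      where
      b<d = ≤-<-trans (mids-≤ ms) c<d
      forward-case : ∀ {u w} → u < w → w < n → Joins z′ u w → At (piece l) u → At (piece l) w → Empty (piece l) u w →
                     Touches a d u w → Joins z′ a b ⊎ Joins z′ c d
      forward-case u<w w<n j′ u∈ w∈ none (inj₁ (inj₁ eq))
        with vtx-injective o (<-trans a<b (<-trans b<d d<n)) (<-trans u<w w<n) eq
      ... | refl = inj₁ (subst (Joins z′ a) (≤-antisym (≮⇒≥ λ b<w → none b a<b b<w (Side.inʳ σ))
                                                         (≮⇒≥ λ w<b → Side.between σ u<w w<b w∈)) j′)
      forward-case u<w w<n j′ u∈ w∈ none (inj₁ (inj₂ eq)) with vtx-injective o d<n w<n eq
      ... | refl = inj₂ (subst (λ u → Joins z′ u d) (≤-antisym (≮⇒≥ λ c<u → Side.between σ′ c<u u<w u∈)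
                                                                (≮⇒≥ λ u<c → none c u<c c<d (Side.inˡ σ′))) j′)
      forward-case u<w w<n j′ u∈ w∈ none (inj₂ (inj₁ eq))
        with vtx-injective o (<-trans a<b (<-trans b<d d<n)) w<n eq
      ... | refl = ⊥-elim (<⇒≱ u<w (proj₁ (wl _ u∈)))
      forward-case u<w w<n j′ u∈ w∈ none (inj₂ (inj₂ eq)) with vtx-injective o d<n (<-trans u<w w<n) eq
      ... | refl = ⊥-elim (<⇒≱ u<w (proj₂ (wl _ w∈)))
      go : (∃₂ λ u w → u < w × w < n × Joins z′ u w) → Joins z′ a d ⊎ (Joins z′ a b ⊎ Joins z′ c d)
      go (u , w , u<w , w<n , j′) with sideOf⁻ {l} j′ z′∈
      ... | inj₁ forward = let (u∈ , w∈ , none) = consecutive-forward⁻ u<w w<n forward in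
              inj₂ (forward-case u<w w<n j′ u∈ w∈ none (incident⁻ j j′ inc))
      ... | inj₂ backward = let (u∈ , w∈ , hull) = consecutive-backward⁻ u<w w<n backward in
              inj₁ (subst₂ (Joins z′) (≤-antisym (proj₁ (hull a (Side.inˡ σ))) (proj₁ (wl u u∈)))
                                      (≤-antisym (proj₂ (wl w w∈)) (proj₂ (hull d (Side.inʳ σ′)))) j′)

    narrow-path : ∀ {a c p} (t : Tree a c) → c < n → suc p < n → Joins (edge (v p)) a c → ∃ λ (π : Path t p) → Ends π
    narrow-path {p = p} t c<n p<n j with joins-unique (n<1+n p) p<n (tree-< t) c<n (edge-joins p) j
    ... | refl , refl = let π = path t ≤-refl (n<1+n p) in π , narrow-ends t refl π

    transport : ∀ {l z z′ u w} → Joins z u w → Joins z′ u w → SideOf (piece l) z′ → SideOf (piece l) z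
    transport {l} j j′ s = Sum.[ sideOf-forward {l} j , sideOf-backward {l} j ]′ (sideOf⁻ {l} j′ s)

    descend : ∀ {a c p} (t : Tree a c) → c < n → suc p < n → ∀ {z used} → Joins z a c →
              (∀ l → SideOf (piece l) z → All (l ≢_) used → RootIs t l) → Zig (edge (v p)) z used →
              ∃ λ (π : Path t p) → Ends π
    descend leaf c<n p<n j H Z = let (l , l∉ , z∈) = zig-head Z in ⊥-elim (H l z∈ l∉)
    descend {p = p} (node l κl wl σ t ms σ′ u) d<n p<n j H (last l′ l′∉ z∈ f∈ inc) with H l′ z∈ l′∉
    ... | refl with next-side wl σ (tree-< t) ms σ′ (tree-< u) d<n j f∈ inc
    ...   | inj₁ j′ = narrow-path (node l κl wl σ t ms σ′ u) d<n p<n j′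
    ...   | inj₂ (inj₁ j′) = let (π , e) = narrow-path t (<-trans (suffix-< ms u) d<n) p<n j′ in first π , first e
    ...   | inj₂ (inj₂ j′) = let (π , e) = narrow-path u d<n p<n j′ in last π , last e
    descend {p = p} (node l κl wl σ t ms σ′ u) d<n p<n {z} j H (step {z′ = z′} l′ l′∉ z∈ z′∈ inc z′∈ds Z) with H l′ z∈ l′∉
    ... | refl with next-side wl σ (tree-< t) ms σ′ (tree-< u) d<n j z′∈ inc
    -- Returning to the entry side is impossible: the only piece available there is the root, which
    -- has just been used.
    ...   | inj₁ j′ = let (l″ , l″∉ , z′∈″) = zig-head Z in
            ⊥-elim (All.head l″∉ (H l″ (transport {l″} j j′ z′∈″) (All.tail l″∉)))
    ...   | inj₂ (inj₁ j′) =
            let b<n = <-trans (suffix-< ms u) d<n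
                (π , e) = descend t b<n p<n j′ (child-root σ b<n t j′) Z in first π , first e
    ...   | inj₂ (inj₂ j′) = let (π , e) = descend u d<n p<n j′ (child-root σ′ d<n u j′) Z in last π , last e

    Fresh : List (Fin m) → Fin m → Set
    Fresh used l = All (l ≢_) used

    -- Each piece is entered by its closing side and left by a side sharing an endpoint with it. The
    -- pieces are pairwise different because the labels of a tree do not repeat.
    ascend : ∀ {a c p} (t : Tree a c) {π : Path t p} → Ends π → suc a < c → c < n → ∀ {z used} → Joins z a c →
             All (Fresh used) (labels t) → Zig (edge (v p)) z used
    -- The side of a child of width one is the final edge itself; the side of a wider child joins
    -- nonadjacent positions and is therefore drawn.
    through : ∀ {a d l u w p} (t : Tree u w) {π : Path t p} → Ends π → Side l u w → w < n → ∀ {z used} → Joins z a d →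
              v a ≡ v u ⊎ v d ≡ v w → SideOf (piece l) z → Fresh used l → All (Fresh (l ∷ used)) (labels t) →
              Zig (edge (v p)) z used

    ascend (node l κl wl σ t ms σ′ u) e 1+a<d d<n {z} {used} j (l∉ ∷ fresh) = go e
      where
      a<d = <-trans (tree-< t) (suffix-< ms u)
      z∈ : SideOf (piece l) z
      z∈ = sideOf-backward {l} j (consecutive-backward⁺ a<d d<n (Side.inˡ σ) (Side.inʳ σ′) wl)
      later : ∀ {ls} → All (l ≢_) ls → All (Fresh used) ls → All (Fresh (l ∷ used)) ls
      later l≢ fr = All.zipWith (λ (l≢l′ , l′∉) → (l≢l′ ∘ sym) ∷ l′∉) (l≢ , fr)
      distinct-labels = later (AllPairs.head (labels-unique (node l κl wl σ t ms σ′ u))) fresh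
      go : ∀ {p} {π : Path (node l κl wl σ t ms σ′ u) p} → Ends π → Zig (edge (v p)) z used
      go (first e) = through t e σ (<-trans (suffix-< ms u) d<n) j (inj₁ refl) z∈ l∉
                       (Allₚ.++⁻ˡ (labels t) distinct-labels)
      go (last e)  = through u e σ′ d<n j (inj₂ refl) z∈ l∉ (Allₚ.++⁻ʳ (mlabels ms) (Allₚ.++⁻ʳ (labels t) distinct-labels))
    ascend leaf e 1+a<1+a _ _ _ = ⊥-elim (<-irrefl refl 1+a<1+a)

    through {l = l} {u} {w} {p} t {π} e σ w<n {z} j share z∈ l∉ fresh with m≤n⇒m<n∨m≡n (tree-< t)
    ... | inj₂ refl with ≤-antisym (proj₁ (path-range π)) (≤-pred (proj₂ (path-range π)))
    ...   | refl = last l l∉ z∈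
            (sideOf-forward {l} (edge-joins p) (consecutive-forward⁺ (tree-< t) w<n (Side.inˡ σ) (Side.inʳ σ) λ k → Side.between σ))
            (incident⁺ j (edge-joins p) share)
    through {l = l} {u} {w} {p} t {π} e σ w<n {z} j share z∈ l∉ fresh | inj₁ 1+u<w
      with LinearPiece.link (linear-piece l) (tree-< t) (Side.inˡ σ) (Side.inʳ σ) (λ k → Side.between σ)
    ... | inj₁ refl = ⊥-elim (<-irrefl refl 1+u<w)
    ... | inj₂ (inj₁ ∈ds) = step l l∉ z∈ (inj₁ forward) (incident⁺ j (inj₁ refl) share) ∈ds (ascend t e 1+u<w w<n (inj₁ refl) fresh)
      where forward = consecutive-forward⁺ (tree-< t) w<n (Side.inˡ σ) (Side.inʳ σ) λ k → Side.between σ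
    ... | inj₂ (inj₂ ∈ds) = step l l∉ z∈ (inj₂ forward) (incident⁺ j (inj₂ refl) share) ∈ds (ascend t e 1+u<w w<n (inj₂ refl) fresh)
      where forward = consecutive-forward⁺ (tree-< t) w<n (Side.inˡ σ) (Side.inʳ σ) λ k → Side.between σ

    zigs-All : ∀ {P : Fin m → Set} {a c p} {t : Tree a c} {π : Path t p} (e : Ends π) → All P (labels t) → All P (zigs e)
    zigs-All here _ = []
    zigs-All (first {t = t} e) (_ ∷ Ps) = zigs-All e (Allₚ.++⁻ˡ (labels t) Ps)
    zigs-All (last {t = t} {ms} e) (P ∷ Ps) = Allₚ.++⁺ (P ∷ Allₚ.++⁺ (Allₚ.++⁻ˡ (labels t) Ps) (Allₚ.++⁻ˡ (mlabels ms) Ps′)) (zigs-All e (Allₚ.++⁻ʳ (mlabels ms) Ps′))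
      where Ps′ = Allₚ.++⁻ʳ (labels t) Ps

    zigs-unique : ∀ {a c p} {t : Tree a c} {π : Path t p} (e : Ends π) → Unique (zigs e)
    zigs-unique here = []
    zigs-unique (first e) = zigs-unique e
    zigs-unique (last {l = l} {w = w} {σ} {t} {ms} {σ′} {u} e) =
      Allₚ.++⁺ (Allₚ.++⁺ (apart-d (suffix-< ms u) (labels-within t)) (apart-d (tree-< u) (mlabels-within ms)))
               (All.map (λ { wl refl → <⇒≱ a<c (proj₁ (wl _ (Side.inˡ σ))) }) zigs-within)
      ∷ separate (separate (labels-unique t) (mlabels-unique ms) (labels-within t) (mlabels-within ms) (labels-two t)) (zigs-unique e)
          (Allₚ.++⁺ (weaken ≤-refl (mids-≤ ms) (labels-within t)) (weaken (<⇒≤ (tree-< t)) ≤-refl (mlabels-within ms)))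
          zigs-within (Allₚ.++⁺ (labels-two t) (mlabels-two ms))
      where
      a<c = <-≤-trans (tree-< t) (mids-≤ ms)
      zigs-within = zigs-All e (labels-within u)
      apart-d : ∀ {a b ls} → b < _ → All (Within a b) ls → All (l ≢_) ls
      apart-d b<d = All.map (λ { wl refl → <⇒≱ b<d (proj₂ (wl _ (Side.inʳ σ′))) })

    -- A piece left through its last side has beyond p only its vertex d, and the subtrees to the
    -- left of the path end by position p.
    zigs-sparse : ∀ {a c p} {t : Tree a c} {π : Path t p} (e : Ends π) →
                  All (λ l → ∀ j k → p < j → p < k → In l j → In l k → j ≡ k) (zigs e)
    zigs-sparse here = []
    zigs-sparse (first e) = zigs-sparse e
    zigs-sparse (last {c = c} {d} {l = l} {w = w} {t = t} {ms} {σ′} {π = π} e) =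
      Allₚ.++⁺ ((λ _ _ p<j p<k j∈ k∈ → trans (top p<j j∈) (sym (top p<k k∈)))
               ∷ Allₚ.++⁺ (All.map (λ wl _ _ p<j _ j∈ _ → ⊥-elim (<⇒≱ p<j (≤-trans (proj₂ (wl _ j∈)) (≤-trans (mids-≤ ms) c≤p)))) (labels-within t))
                          (All.map (λ wl _ _ p<j _ j∈ _ → ⊥-elim (<⇒≱ p<j (≤-trans (proj₂ (wl _ j∈)) c≤p))) (mlabels-within ms)))
        (zigs-sparse e)
      where
      c≤p = proj₁ (path-range π)
      top : ∀ {j} → _ < j → In l j → j ≡ d
      top p<j j∈ = ≤-antisym (proj₂ (w _ j∈)) (≮⇒≥ λ j<d → Side.between σ′ (≤-<-trans c≤p p<j) j<d j∈)

    -- A piece left through its first side has both b and d beyond p, and every piece to the right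
    -- of the path has two positions, all beyond p.
    others-dense : ∀ {a c p} {t : Tree a c} {π : Path t p} (e : Ends π) →
                   All (λ l → l L.∈ zigs e ⊎ ∃₂ λ j k → p < j × j < k × In l j × In l k) (labels t)
    others-dense here = []
    others-dense (first {w = w} {σ} {t} {ms} {σ′} {u} {π = π} e) =
      inj₂ (_ , _ , p<b , suffix-< ms u , Side.inʳ σ , Side.inʳ σ′)
      ∷ Allₚ.++⁺ (others-dense e) (All.zipWith (λ (wl , (j , k , j<k , j∈ , k∈)) →
          inj₂ (j , k , <-≤-trans p<b (proj₁ (wl j j∈)) , j<k , j∈ , k∈)) (suffix-within ms u , Allₚ.++⁺ (mlabels-two ms) (labels-two u)))
      where p<b = proj₂ (path-range π)
    others-dense (last {l = l} {t = t} {ms} {u = u} e) =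
      inj₁ (here refl) ∷ Allₚ.++⁺ {xs = labels t} (All.tabulate λ l∈ → inj₁ (there (Lₚ.∈-++⁺ˡ (Lₚ.∈-++⁺ˡ l∈))))
        (Allₚ.++⁺ (All.tabulate λ l∈ → inj₁ (there (Lₚ.∈-++⁺ˡ (Lₚ.∈-++⁺ʳ (labels t) l∈))))
          (All.map (Sum.map₁ (Lₚ.∈-++⁺ʳ (l ∷ labels t ++ mlabels ms))) (others-dense e)))

-- The minors of the weight matrix

unique-≤1 : ∀ {A : Set} {as : List A} → Unique as → (∀ {a b} → a L.∈ as → b L.∈ as → a ≡ b) → length as ≤ 1
unique-≤1 {as = []}         _                   _     = z≤n
unique-≤1 {as = _ ∷ []}     _                   _     = s≤s z≤n
unique-≤1 {as = _ ∷ _ ∷ _} ((a≢b ∷ _) ∷ _) equal = ⊥-elim (a≢b (equal (here refl) (there (here refl))))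

≤1⇒≡ : ∀ {A : Set} {as : List A} {a b} → length as ≤ 1 → a L.∈ as → b L.∈ as → a ≡ b
≤1⇒≡ {as = _ ∷ []}    _         (here refl) (here refl) = refl
≤1⇒≡ {as = _ ∷ _ ∷ _} (s≤s ()) _           _

module Minors {N m : ℕ} (D : Dissection (suc N) m) (1<N : 1 < N) (i : Fin (suc N)) where

  private
    n = suc N
    -- Starting at i + 1 puts i at the last position N, so the root edge closes the range from 0 to
    -- N.
    o = toℕ (i ⊕ 1)

  open Dissection D
  open Positions {n}
  open Geometry D
  open Linear o
  open Construction o hiding (κ)
  open Entries D
  open TreeAlgebra algebra In (λ l k → at? (piece l) k)
  open ZigZags D
  open Descent o

  private
    v = vtx o
    0<N = <-trans (s≤s z≤n) 1<N

  s : ℕ → Poly (m ℕ.+ n)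
  s k = incident (allFin m) k

  open Spans s
  open Bounds s

  v-⊕ : ∀ k → v k ≡ i ⊕ suc k
  v-⊕ k = vtx-⊕ (toℕ i) 1 k

  v-N : v N ≡ i
  v-N = trans (v-⊕ N) (trans (vtx-wrap (toℕ i) 0) (vtx-origin i))

  v-0 : v 0 ≡ i ⊕ 1
  v-0 = v-⊕ 0

  star-s : ∀ {k} → k < n → star (v k) ≡ s k
  star-s {k} k<n = cong (∑ ∘ map X) (Listₚ.filter-≐ (λ l → v k ∈? piece l) (λ l → at? (piece l) k) ((λ k∈ → k<n , k∈) , proj₂) (allFin m))

  stars-∏s : ∀ f a k → (∀ t → f t ≡ v (t ℕ.+ a)) → k ℕ.+ a ≤ n → stars f k ≡ ∏s a k
  stars-∏s f a zero    f≗v _   = refl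
  stars-∏s f a (suc k) f≗v k+a≤n = cong₂ _⊠_
    (trans (cong star (f≗v 0)) (star-s (≤-trans (s≤s (m≤n+m a k)) k+a≤n)))
    (stars-∏s (f ∘ suc) (suc a) k (λ t → trans (f≗v (suc t)) (cong v (sym (+-suc t a)))) (subst (_≤ n) (sym (+-suc k a)) k+a≤n))

  product-↭ : ∀ {A : Set} (f : A → Poly (m ℕ.+ n)) {as bs} → as ↭ bs → ∏ (map f as) All′.≃ ∏ (map f bs)
  product-↭ f Perm.refl = Full.refl
  product-↭ f (prep a as↭bs) = Full.*-congˡ {f a} (product-↭ f as↭bs)
  product-↭ f (swap {as} {bs} a b as↭bs) = Full.trans (FullL.swap-head (f a) (f b) (∏ (map f as)))
    (Full.*-congˡ {f b} (Full.*-congˡ {f a} (product-↭ f as↭bs)))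
  product-↭ f (Perm.trans h h′) = Full.trans (product-↭ f h) (product-↭ f h′)

  sum-↭ : ∀ {A : Set} (f : A → Poly (m ℕ.+ n)) {as bs} → as ↭ bs → ∑ (map f as) Low.≃ ∑ (map f bs)
  sum-↭ f Perm.refl = Trun.refl
  sum-↭ f (prep a as↭bs) = Trun.+-congˡ {f a} (sum-↭ f as↭bs)
  sum-↭ f (swap {as} {bs} a b as↭bs) = Trun.trans (Trun.sym (Trun.+-assoc (f a) (f b) (∑ (map f as))))
    (Trun.trans (Trun.+-cong (Trun.+-comm (f a) (f b)) (sum-↭ f as↭bs)) (Trun.+-assoc (f b) (f a) (∑ (map f bs))))
  sum-↭ f (Perm.trans h h′) = Trun.trans (sum-↭ f h) (sum-↭ f h′)

  Q : ℕ → Poly (m ℕ.+ n)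
  Q k = ∏ (applyUpTo (λ t → q D (v t)) k)

  ∏-cong : ∀ {f g : ℕ → Poly (m ℕ.+ n)} → (∀ t → f t ≡ g t) → ∀ k → ∏ (applyUpTo f k) ≡ ∏ (applyUpTo g k)
  ∏-cong f≗g zero    = refl
  ∏-cong f≗g (suc k) = cong₂ _⊠_ (f≗g 0) (∏-cong (λ t → f≗g (suc t)) k)

  ∏-snoc : ∀ (f : ℕ → Poly (m ℕ.+ n)) k → ∏ (applyUpTo f (suc k)) All′.≃ ∏ (applyUpTo f k) ⊠ f k
  ∏-snoc f zero    = Full.trans (Full.*-identityʳ (f 0)) (Full.sym (Full.*-identityˡ (f 0)))
  ∏-snoc f (suc k) = Full.trans (Full.*-congˡ {f 0} (∏-snoc (f ∘ suc) k)) (Full.sym (Full.*-assoc (f 0) (∏ (applyUpTo (f ∘ suc) k)) (f (suc k))))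

  ∏-square : ∀ (f : ℕ → Poly (m ℕ.+ n)) k → ∏ (applyUpTo (λ t → f t ^ᴾ 2) k) All′.≃ square (∏ (applyUpTo f k))
  ∏-square f zero    = Full.sym (Full.*-identityˡ 1ᴾ)
  ∏-square f (suc k) = Full.trans
    (Full.*-cong (Full.*-congˡ {f 0} (Full.*-identityʳ (f 0))) (∏-square (f ∘ suc) k))
    (FullL.interchange (f 0) (f 0) (∏ (applyUpTo (f ∘ suc) k)) (∏ (applyUpTo (f ∘ suc) k)))

  qs-next : ∀ k → qs (i ⊕ 1) k ≡ Q k
  qs-next k = cong ∏ (Listₚ.map-upTo (λ s → q D (v s)) k)

  qs-first : ∀ k → qs i (suc k) ≡ q D i ⊠ Q k
  qs-first k = trans (cong ∏ (Listₚ.map-upTo (λ s → q D (i ⊕ s)) (suc k)))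
    (cong₂ _⊠_ (cong (q D) (vtx-origin i))
               (∏-cong (λ t → cong (q D) (sym (v-⊕ t))) k))

  monomial-square : ∀ ls → ∏ (map (λ l → x D l ^ᴾ (2 ℕ.* κ l)) ls) All′.≃ square (monomial ls)
  monomial-square []       = Full.sym (Full.*-identityˡ 1ᴾ)
  monomial-square (l ∷ ls) = Full.trans (Full.*-cong (double (κ l)) (monomial-square ls))
      (FullL.interchange (pow′ (κ l)) (pow′ (κ l)) (monomial ls) (monomial ls))
    where
    pow′ : ℕ → Poly (m ℕ.+ n)
    pow′ = power _⊠_ 1ᴾ (x D l)
    add : ∀ a b → x D l ^ᴾ (a ℕ.+ b) All′.≃ pow′ a ⊠ pow′ b
    add zero    b = Full.trans (Full.reflexive (sym (power-^ (x D l) b))) (Full.sym (Full.*-identityˡ (pow′ b)))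
    add (suc a) b = Full.trans (Full.*-congˡ {x D l} (add a b)) (Full.sym (Full.*-assoc (x D l) (pow′ a) (pow′ b)))
    double : ∀ a → x D l ^ᴾ (2 ℕ.* a) All′.≃ pow′ a ⊠ pow′ a
    double a = Full.trans (Full.reflexive (cong (λ b → x D l ^ᴾ (a ℕ.+ b)) (+-identityʳ a))) (add a a)

  qs-bounded : ∀ {X} a d → Bounded κ X → Bounded κ (X ⊠ qs a d)
  qs-bounded a d hX = All.map (λ {(_ , μ)} h l → subst (Vec.lookup μ (l ↑ˡ n) ≤_) (+-identityʳ (κ l)) (h l))
    (bounded-⊠ hX (let (e , h , eq) = qs-x-free (a ⊕_) (upTo d) in monic-bounded h (λ l → ≤-reflexive (eq l))))

  -- Both sides respect the exponent bound, so equality modulo the relations is enough.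
  entry-lift : ∀ {a b Y} d → a ≢ b → dist a b ≡ d → Bounded κ Y → stars (λ t → a ⊕ suc t) (d ∸ 1) Low.≃ Y →
               weightMatrix D a b All′.≃ Y ⊠ qs a d
  entry-lift {a} {b} {Y} d a≢b refl hY stars≃Y = ≃⇒≈ (entry-bounded a b) (qs-bounded a d hY)
    (Low.≃.trans (entry a≢b) (Low.⊠-cong stars≃Y Low.≃.refl))

  row-next : ∀ k {Y} → k ≤ N → Bounded κ Y → span 0 k Low.≃ Y → weightMatrix D (i ⊕ 1) (v k) All′.≃ Y ⊠ qs (i ⊕ 1) k
  -- The entry is v at (i + 1, i + 1), which is 0; Y is 0 modulo the relations and bounded, hence
  -- exactly 0.
  row-next zero {Y} _ hY 0≃Y = Full.trans
    (Full.reflexive (trans (cong (weightMatrix D (i ⊕ 1)) v-0) (entry-diagonal (i ⊕ 1))))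
    (Full.sym (Full.trans (Full.*-congʳ {qs (i ⊕ 1) 0} (≃⇒≈ hY [] (Low.≃.sym 0≃Y))) (Full.zeroˡ (qs (i ⊕ 1) 0))))
  row-next (suc k) {Y} k<N hY span≃Y = entry-lift (suc k) distinct-ends (dist-⊕ (i ⊕ 1) (s≤s k<N)) hY
    (Low.≃.trans (Low.≃.reflexive (stars-∏s _ 1 k (λ t → cong v (+-comm 1 t)) (≤-trans (≤-reflexive (+-comm k 1)) (m≤n⇒m≤1+n k<N)))) span≃Y)
    where
    distinct-ends : i ⊕ 1 ≢ v (suc k)
    distinct-ends eq = case vtx-injective o (s≤s z≤n) (s≤s k<N) (trans v-0 eq) of λ ()

  row-first : ∀ k {Y} → k < N → Bounded κ Y → hd (s 0) 0 k Low.≃ Y → weightMatrix D i (v k) All′.≃ Y ⊠ qs i (suc k)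
  row-first k {Y} k<N hY hd≃Y = entry-lift (suc k) distinct-ends (trans (cong (dist i) (v-⊕ k)) (dist-⊕ i (s≤s k<N))) hY
    (Low.≃.trans (Low.≃.reflexive (trans (stars-∏s _ 0 k (λ t → trans (sym (v-⊕ t)) (cong v (sym (+-identityʳ t))))
      (subst (_≤ n) (sym (+-identityʳ k)) (<⇒≤ (m<n⇒m<1+n k<N)))) (sym (hd-s 0 k)))) hd≃Y)
    where
    distinct-ends : i ≢ v k
    distinct-ends eq = <⇒≢ k<N (sym (vtx-injective o (n<1+n N) (m<n⇒m<1+n k<N) (trans v-N eq)))

  value : Fin n → Poly (m ℕ.+ n)
  value j = q D i ⊠ q D j ⊠ ∏ (map (λ t → q D (i ⊕ suc t) ^ᴾ 2) (upTo (dist i j ∸ 1)))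
              ⊠ ∏ (map (λ l → x D l ^ᴾ (2 ℕ.* (degree l ∸ 2))) (zigPieces D i j))

  OffDiagonal : Fin n → Set
  OffDiagonal j = edge i ≢ edge j →
    ((¬ (minor D i j ≈ 0ᴾ)) ⇔ ZigZag D (edge i) (edge j)) × (ZigZag D (edge i) (edge j) → minor D i j ≈ value j)

  ⊞⇒⊟ : ∀ {a b w : Poly (m ℕ.+ n)} → a All′.≃ w ⊞ b → a ⊟ b ≈ w
  ⊞⇒⊟ {a} {b} {w} h μ = begin
    coeff (a ⊟ b) μ                                   ≡⟨ coeff-⊟ a b μ ⟩
    coeff a μ ℤ.- coeff b μ                           ≡⟨ cong (ℤ._- coeff b μ) (trans (All′.at h μ tt) (coeff-⊞ w b μ)) ⟩
    (coeff w μ ℤ.+ coeff b μ) ℤ.- coeff b μ           ≡⟨ ℤₚ.+-assoc (coeff w μ) (coeff b μ) (ℤ.- coeff b μ) ⟩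
    coeff w μ ℤ.+ (coeff b μ ℤ.- coeff b μ)           ≡⟨ cong (λ z → coeff w μ ℤ.+ z) (ℤₚ.+-inverseʳ (coeff b μ)) ⟩
    coeff w μ ℤ.+ 0ℤ                                  ≡⟨ ℤₚ.+-identityʳ _ ⟩
    coeff w μ                                         ∎
    where open ≡-Reasoning

  module Rooted (t : Tree 0 N) where

    labels-↭ : labels t ↭ allFin m
    labels-↭ = same-elements⇒↭ (labels-unique t) (Uniqueₚ.allFin⁺ m) (λ _ → Lₚ.∈-allFin _) (λ _ → labels-complete refl 0<N t _)

    s-labels : ∀ k → s k Low.≃ incident (labels t) k
    s-labels k = sum-filter-↭ (↭-sym labels-↭)
      where
      sum-filter-↭ : ∀ {ls ls′} → ls ↭ ls′ → incident ls k Low.≃ incident ls′ k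
      sum-filter-↭ ls↭ls′ = sum-↭ X (filter-↭ (λ l → at? (piece l) k) ls↭ls′)

    covers : Covers t
    covers _ _ = s-labels _

    bounded-labels : ∀ {Y} → Bounded (exponents (labels t)) Y → Bounded κ Y
    bounded-labels = All.map λ h l → ≤-trans (h l) (exponents-unique (labels-unique t) l)

    module _ {p : ℕ} (p<N : p < N) (π : Path t p) where

      E-row : ∀ r → weightMatrix D (i ⊕ 1) (v (end p r)) All′.≃ E π r ⊠ qs (i ⊕ 1) (end p r)
      E-row r = row-next (end p r) (end-≤ r) (bounded-labels (bounded-E π r)) (proj₁ (span-path π r covers))
        where
        end-≤ : ∀ r → end p r ≤ N
        end-≤ false = <⇒≤ p<N
        end-≤ true  = p<N

      hd-F : ∀ r → hd (s 0) 0 (end p r) Low.≃ F π r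
      hd-F r = Low.≃.trans (hd-cong 0 (end p r) (s-labels 0)) (proj₂ (span-path π r covers))

      F-row : ∀ r → weightMatrix D i (v (end p r)) All′.≃ F π r ⊠ qs i (suc (end p r))
      F-row false = row-first p p<N (bounded-labels (bounded-F π false)) (hd-F false)
      F-row true with m≤n⇒m<n∨m≡n p<N
      ... | inj₁ 1+p<N = row-first (suc p) 1+p<N (bounded-labels (bounded-F π true)) (hd-F true)
      -- Here j + 1 = i and the entry is 0. The closed form agrees: it is the sum of the pieces at
      -- position 0 times the monomial of the whole tree, which kills it.
      ... | inj₂ refl = Full.trans
        (Full.reflexive (trans (cong (weightMatrix D i) v-N) (entry-diagonal i)))
        (Full.sym (Full.trans (Full.*-congʳ {qs i (suc N)} (≃⇒≈ (bounded-labels (bounded-F π true)) [] F≃0)) (Full.zeroˡ (qs i (suc N)))))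
        where
        F≃0 : F π true Low.≃ 0ᴾ
        F≃0 = Low.≃.trans (Low.≃.sym (proj₂ (span-path π true covers)))
          (Low.≃.trans (Low.≃.reflexive (hd-> (incident (labels t) 0) 0<N))
            (Low.≃.trans (Low.⊠-comm (incident (labels t) 0) (span 0 N))
              (Low.≃.trans (Low.⊠-cong (span-closed t covers) Low.≃.refl) (kill (labels t) 0))))

      minor-value : ∀ {V} → E π true ⊠ F π false All′.≃ V ⊞ E π false ⊠ F π true →
                    minor D i (v p) ≈ q D i ⊠ q D (v p) ⊠ (Q p ⊠ Q p) ⊠ V
      minor-value {V} det = subst (λ u → det₂ (w i (v p)) (w i u) (w (i ⊕ 1) (v p)) (w (i ⊕ 1) u) ≈ q D i ⊠ q D (v p) ⊠ (Q p ⊠ Q p) ⊠ V) next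
        (⊞⇒⊟ {w i (v p) ⊠ w (i ⊕ 1) (v (suc p))} {w i (v (suc p)) ⊠ w (i ⊕ 1) (v p)} (FullL.minor-det
          {F₀ = F π false} {F π true} {E π false} {E π true} (Q p) (q D i) (q D (v p)) V
          (Full.trans (F-row false) (Full.*-congˡ {F π false} (Full.reflexive (qs-first p))))
          (Full.trans (E-row true) (Full.*-congˡ {E π true} (Full.trans (Full.reflexive (qs-next (suc p))) (∏-snoc (λ t → q D (v t)) p))))
          (Full.trans (F-row true) (Full.*-congˡ {F π true} (Full.trans (Full.reflexive (qs-first (suc p))) (Full.*-congˡ {q D i} (∏-snoc (λ t → q D (v t)) p)))))
          (Full.trans (E-row false) (Full.*-congˡ {E π false} (Full.reflexive (qs-next p))))
          det))
        where
        w = weightMatrix D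
        next : v (suc p) ≡ v p ⊕ 1
        next = trans (cong v (+-comm 1 p)) (sym (vtx-⊕ o p 1))

    rotation-↭ : applyUpTo (i ⊕_) n ↭ allFin n
    rotation-↭ = same-elements⇒↭
      (Uniqueₚ.applyUpTo⁺₁ (i ⊕_) n (λ {j} {k} j<k k<n eq → <⇒≢ j<k (vtx-injective (toℕ i) (<-trans j<k k<n) k<n eq)))
      (Uniqueₚ.allFin⁺ n) (λ _ → Lₚ.∈-allFin _)
      (λ {u} _ → subst (L._∈ applyUpTo (i ⊕_) n) (⊕-dist i u) (Lₚ.∈-applyUpTo⁺ (i ⊕_) (m%n<n (toℕ u ℕ.+ (n ∸ toℕ i)) n)))

    ε-rotated : q D i ⊠ Q N All′.≃ ε D
    ε-rotated = Full.trans
      (Full.reflexive (trans (sym (qs-first N)) (cong ∏ (trans (Listₚ.map-∘ (upTo n)) (cong (map (q D)) (Listₚ.map-upTo (i ⊕_) n))))))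
      (product-↭ (q D) rotation-↭)

    c-labels : monomial (labels t) All′.≃ c D
    c-labels = Full.trans (product-↭ (λ l → power _⊠_ 1ᴾ (X l) (κ l)) labels-↭)
      (Full.reflexive (cong ∏ (Listₚ.map-cong (λ l → power-^ (X l) (κ l)) (allFin m))))

    -- As v at (i, i) is 0, only the product of v at (i, i + 1) and at (i + 1, i) is left: q_i times
    -- the closed span of the whole tree with the remaining q.
    diagonal-value : minor D i i ≈ -ᴾ (ε D ⊠ c D)
    diagonal-value μ = begin
      coeff (minor D i i) μ               ≡⟨ cong (λ z → coeff (z ⊠ w (i ⊕ 1) (i ⊕ 1) ⊟ w i (i ⊕ 1) ⊠ w (i ⊕ 1) i) μ) (entry-diagonal i) ⟩
      coeff (-ᴾ (w i (i ⊕ 1) ⊠ w (i ⊕ 1) i)) μ ≡⟨ coeff-neg (w i (i ⊕ 1) ⊠ w (i ⊕ 1) i) μ ⟩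
      ℤ.- coeff (w i (i ⊕ 1) ⊠ w (i ⊕ 1) i) μ ≡⟨ cong ℤ.-_ (All′.at product μ tt) ⟩
      ℤ.- coeff (ε D ⊠ c D) μ             ≡⟨ coeff-neg (ε D ⊠ c D) μ ⟨
      coeff (-ᴾ (ε D ⊠ c D)) μ            ∎
      where
      open ≡-Reasoning
      w = weightMatrix D
      forth : w i (i ⊕ 1) All′.≃ 1ᴾ ⊠ (q D i ⊠ 1ᴾ)
      forth = subst (λ u → w i u All′.≃ 1ᴾ ⊠ (q D i ⊠ 1ᴾ)) v-0
        (Full.trans (row-first 0 0<N (TruncatedAlgebra.bounded-1 algebra {κ}) Low.≃.refl) (Full.*-congˡ {1ᴾ} (Full.reflexive (qs-first 0))))
      back : w (i ⊕ 1) i All′.≃ monomial (labels t) ⊠ Q N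
      back = subst (λ u → w (i ⊕ 1) u All′.≃ monomial (labels t) ⊠ Q N) v-N
        (Full.trans (row-next N ≤-refl (bounded-labels (bounded-monomial (labels t))) (span-closed t covers))
          (Full.*-congˡ {monomial (labels t)} (Full.reflexive (qs-next N))))
      product : w i (i ⊕ 1) ⊠ w (i ⊕ 1) i All′.≃ ε D ⊠ c D
      product = Full.trans (FullL.diagonal-minor (q D i) (monomial (labels t)) (Q N) forth back) (Full.*-cong ε-rotated c-labels)

    module _ {p : ℕ} (p<N : p < N) where

      private j = v p

      dist-j : dist i j ≡ suc p
      dist-j = trans (cong (dist i) (v-⊕ p)) (dist-⊕ i (s≤s p<N))

      route-j : route (j ⊕ 1) i ≡ applyUpTo (λ e → v (suc p ℕ.+ e)) (N ∸ p)
      route-j = begin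
        map ((j ⊕ 1) ⊕_) (upTo (suc (dist (j ⊕ 1) i)))   ≡⟨ Listₚ.map-upTo _ (suc (dist (j ⊕ 1) i)) ⟩
        applyUpTo ((j ⊕ 1) ⊕_) (suc (dist (j ⊕ 1) i))    ≡⟨ cong₂ (λ u e → applyUpTo (u ⊕_) (suc e)) next distance ⟩
        applyUpTo (v (suc p) ⊕_) (suc (N ∸ suc p))       ≡⟨ cong (applyUpTo (v (suc p) ⊕_)) (ℕₚ.+-∸-assoc 1 p<N) ⟨
        applyUpTo (v (suc p) ⊕_) (N ∸ p)                 ≡⟨ applyUpTo-cong (vtx-⊕ o (suc p)) (N ∸ p) ⟩
        applyUpTo (λ e → v (suc p ℕ.+ e)) (N ∸ p)        ∎
        where
        open ≡-Reasoning
        next : j ⊕ 1 ≡ v (suc p)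
        next = trans (vtx-⊕ o p 1) (cong v (+-comm p 1))
        distance : dist (j ⊕ 1) i ≡ N ∸ suc p
        distance = trans (cong₂ dist next (sym (trans (cong v (m+[n∸m]≡n p<N)) v-N)))
          (dist-forward o (s≤s (≤-reflexive (m+[n∸m]≡n p<N))))
        applyUpTo-cong : ∀ {f g : ℕ → Fin n} → (∀ e → f e ≡ g e) → ∀ k → applyUpTo f k ≡ applyUpTo g k
        applyUpTo-cong f≗g zero    = refl
        applyUpTo-cong f≗g (suc k) = cong₂ _∷_ (f≗g 0) (applyUpTo-cong (λ e → f≗g (suc e)) k)

      route-in : ∀ {l k} → p < k → In l k → v k L.∈ filter (_∈? piece l) (route (j ⊕ 1) i)
      route-in {l} {k} p<k (k<n , k∈) = Lₚ.∈-filter⁺ (_∈? piece l) (subst (v k L.∈_) (sym route-j)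
        (subst (λ k → v k L.∈ _) (m+[n∸m]≡n p<k)
          (Lₚ.∈-applyUpTo⁺ (λ e → v (suc p ℕ.+ e)) (ℕₚ.∸-monoˡ-< k<n p<k)))) k∈

      in-range : ∀ {e} → e < N ∸ p → suc p ℕ.+ e < n
      in-range {e} e<N∸p = s≤s (subst (_≤ N) (+-suc p e)
        (subst (p ℕ.+ suc e ≤_) (m+[n∸m]≡n (<⇒≤ p<N)) (+-monoʳ-≤ p e<N∸p)))

      route-out : ∀ {l u} → u L.∈ filter (_∈? piece l) (route (j ⊕ 1) i) → ∃ λ k → p < k × In l k × u ≡ v k
      route-out {l} {u} u∈ with Lₚ.∈-filter⁻ (_∈? piece l) {xs = route (j ⊕ 1) i} u∈
      ... | u∈route , u∈l with Lₚ.∈-applyUpTo⁻ (λ e → v (suc p ℕ.+ e)) (subst (u L.∈_) route-j u∈route)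
      ...   | e , e<N∸p , refl = suc p ℕ.+ e , s≤s (m≤m+n p e) ,
              (in-range e<N∸p , u∈l) , refl

      route-unique : Unique (route (j ⊕ 1) i)
      route-unique = subst Unique (sym route-j) (Uniqueₚ.applyUpTo⁺₁ _ (N ∸ p) λ {a} {b} a<b b<N∸p eq →
        <⇒≢ (ℕₚ.+-monoʳ-< (suc p) a<b) (vtx-injective o (<-trans (ℕₚ.+-monoʳ-< (suc p) a<b) (in-range b<N∸p)) (in-range b<N∸p) eq))

      -- The route from j + 1 to i is the set of positions beyond p; `zigs-sparse` and
      -- `others-dense` say which pieces have at most one vertex there.
      zigs-↭ : {π : Path t p} (e : Ends π) → zigs e ↭ zigPieces D i j
      zigs-↭ e = same-elements⇒↭ (zigs-unique e) (Uniqueₚ.filter⁺ (zigPiece? D i j) (Uniqueₚ.allFin⁺ m))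
        (λ {l} l∈ → Lₚ.∈-filter⁺ (zigPiece? D i j) (Lₚ.∈-allFin l) (unique-≤1 (Uniqueₚ.filter⁺ (_∈? piece l) route-unique)
          λ a∈ b∈ → let (k , p<k , k∈ , a≡) = route-out {l} a∈
                        (k′ , p<k′ , k∈′ , b≡) = route-out {l} b∈
                    in trans a≡ (trans (cong v (All.lookup (zigs-sparse e) l∈ k k′ p<k p<k′ k∈ k∈′)) (sym b≡))))
        (λ {l} l∈ → case All.lookup (others-dense e) (labels-complete refl 0<N t l) of λ
          { (inj₁ l∈zigs) → l∈zigs
          ; (inj₂ (k , k′ , p<k , k<k′ , k∈ , k∈′)) → ⊥-elim (<⇒≢ k<k′ (vtx-injective o (proj₁ k∈) (proj₁ k∈′)
              (≤1⇒≡ (proj₂ (Lₚ.∈-filter⁻ (zigPiece? D i j) {xs = allFin m} l∈)) (route-in {l} p<k k∈) (route-in {l} (<-trans p<k k<k′) k∈′)))) })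

      value-ends : {π : Path t p} (e : Ends π) → minor D i j ≈ value j
      value-ends {π} e μ = trans (minor-value p<N π (det-ends e) μ) (All′.at
        (Full.*-cong (Full.*-congˡ {q D i ⊠ q D j} squares) (Full.trans (Full.sym (monomial-square (zigs e))) (product-↭ _ (zigs-↭ e)))) μ tt)
        where
        squares : Q p ⊠ Q p All′.≃ ∏ (map (λ e → q D (i ⊕ suc e) ^ᴾ 2) (upTo (dist i j ∸ 1)))
        squares = Full.trans (Full.sym (∏-square (λ e → q D (v e)) p)) (Full.reflexive (trans
          (∏-cong (λ e → cong (λ u → q D u ^ᴾ 2) (v-⊕ e)) p)
          (trans (cong ∏ (sym (Listₚ.map-upTo _ p)))
                 (cong (λ d → ∏ (map (λ e → q D (i ⊕ suc e) ^ᴾ 2) (upTo (d ∸ 1)))) (sym dist-j)))))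

      value-mid : (π : Path t p) → ¬ Ends π → minor D i j ≈ 0ᴾ
      value-mid π ¬e μ = trans (minor-value p<N π (det-mid π ¬e) μ)
        (All′.at (Full.zeroʳ (q D i ⊠ q D j ⊠ (Q p ⊠ Q p))) μ tt)

      -- A product of variables is a single term with coefficient 1.
      value-≉0 : ¬ (value j ≈ 0ᴾ)
      value-≉0 = monic-≉0 (monic-⊠ (monic-⊠ (monic-⊠ (monic-var (m ↑ʳ i)) (monic-var (m ↑ʳ j)))
          (proj₂ (monic-∏ _ _ (λ e → monic-^ (monic-var (m ↑ʳ (i ⊕ suc e))) 2) (upTo (dist i j ∸ 1)))))
        (proj₂ (monic-∏ _ _ (λ l → monic-^ (monic-var (l ↑ˡ n)) (2 ℕ.* (degree l ∸ 2))) (zigPieces D i j))))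

      edge-i : Joins (edge i) 0 N
      edge-i = inj₂ (cong₂ _,_ (sym v-N) (sym v-0))

      zigzag⇒ends : edge i ≢ edge j → ZigZag D (edge i) (edge j) → ∃ λ (π : Path t p) → Ends π
      zigzag⇒ends e≢f Z = descend t (n<1+n N) (s≤s p<N) edge-i
        -- As a forward side the root edge would span all positions and leave no place for a third
        -- vertex, so it closes its piece, and that piece is the root.
        (λ l e∈ _ → Sum.[ (λ forward → let (_ , _ , none) = consecutive-forward⁻ 0<N (n<1+n N) forward
                                           (k , k∈ , k≢0 , k≢N) = LinearPiece.third (linear-piece l) 0<N (n<1+n N)
                                       in ⊥-elim (none k (ℕₚ.n≢0⇒n>0 k≢0) (≤∧≢⇒< (≤-pred (proj₁ k∈)) k≢N) k∈))
                         , (λ backward → let (z∈ , N∈ , hull) = consecutive-backward⁻ 0<N (n<1+n N) backward in hull-root t z∈ N∈ hull)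
                         ]′ (sideOf⁻ {l} edge-i e∈))
        (zigzag⇒zig e≢f Z)

      ends⇒zigzag : {π : Path t p} → Ends π → ZigZag D (edge i) (edge j)
      ends⇒zigzag e = proj₁ (zig⇒zigzag (ascend t e 1<N (n<1+n N) edge-i (All.tabulate λ _ → [])))

      off-diagonal : OffDiagonal j
      off-diagonal e≢f = mk⇔ to (λ Z minor≈0 → value-≉0 λ μ → trans (sym (formula Z μ)) (minor≈0 μ)) , formula
        where
        formula : ZigZag D (edge i) (edge j) → minor D i j ≈ value j
        formula Z = value-ends (proj₂ (zigzag⇒ends e≢f Z))
        to : ¬ (minor D i j ≈ 0ᴾ) → ZigZag D (edge i) (edge j)
        to minor≉0 with ends? (path t z≤n p<N)
        ... | yes e = ends⇒zigzag e
        ... | no ¬e = ⊥-elim (minor≉0 (value-mid (path t z≤n p<N) ¬e))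

  abstract
    rooted-tree : Tree 0 N
    rooted-tree = tree N ≤-refl 0<N (n<1+n N) (λ _ → inj₁ (refl , refl))

  open Rooted rooted-tree

  diagonal-minors : minor D i i ≈ -ᴾ (ε D ⊠ c D)
  diagonal-minors = diagonal-value

  off-diagonal-minors : ∀ j → OffDiagonal j
  off-diagonal-minors j e≢f = subst OffDiagonal (vtx-pos o j) (λ e≢f → off-diagonal (p<N e≢f) e≢f) e≢f
    where
    -- Position N is i itself, which the assumption of different edges excludes.
    p<N : edge i ≢ edge (v (pos o j)) → pos o j < N
    p<N e≢f = ≤∧≢⇒< (≤-pred (pos-< o j)) λ p≡N → e≢f (cong edge (sym (trans (cong v p≡N) v-N)))

open import Data.Nat using (_*_)

theorem5p1 : (n : ℕ) .{{_ : NonZero n}} → n ≥ 3 → (m : ℕ) (D : Dissection n m) →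
    ((i : Fin n) → minor D i i ≈ -ᴾ (ε D ⊠ c D))
    × ((i j : Fin n) → edge i ≢ edge j →
    (¬ (minor D i j ≈ 0ᴾ)) ⇔ ZigZag D (edge i) (edge j))
    × ((i j : Fin n) → edge i ≢ edge j → ZigZag D (edge i) (edge j) →
    minor D i j ≈
    q D i ⊠ q D j
    ⊠ ∏ (map (λ t → q D (i ⊕ suc t) ^ᴾ 2) (upTo (dist i j ∸ 1)))
    ⊠ ∏ (map (λ l → x D l ^ᴾ (2 * (Dissection.degree D l ∸ 2))) (zigPieces D i j)))
theorem5p1 (suc N) (s≤s 1<N) m D =
    (λ i → Minors.diagonal-minors D 1<N i)
  , (λ i j e≢f → proj₁ (Minors.off-diagonal-minors D 1<N i j e≢f))
  , (λ i j e≢f → proj₂ (Minors.off-diagonal-minors D 1<N i j e≢f))
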